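{- Let $k\in\mathbb{N}$ be fixed and let $n$ be sufficiently large. Let $V$ be a set of $n$ vertices and suppose $M_1,\dots,M_k$ are (pairwise) edge-disjoint perfect matchings on $V$. Then the number of perfect matchings $M^*$ on $V$ such that $M^*\cup M_i$ forms a Hamilton cycle on $V$ for each $i\in[k]$ is $\Theta_k\left(n^{ -k/2}(n/e)^{n/2}\right)$.
   Context: A perfect matching on a finite set $V$ is a set of pairwise vertex-disjoint edges of the complete graph on $V$ covering all of $V$ (so $n=|V|$ is even). "$n$ sufficiently large" means $n\ge n_0(k)$. $\Theta_k(\cdot)$ means bounded above and below up to positive multiplicative constants depending only on $k$. $[k]=\{1,\dots,k\}$. -}

module Defs where

open import Data.Fin using (Fin; toℕ)
open import Data.Fin.Permutation using (Permutation′; _⟨$⟩ʳ_)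
open import Data.Fin.Subset using (Subset; _∈_; _∪_)
open import Data.Integer using (+_)
import Data.Integer as ℤ
import Data.Integer.Properties as ℤₚ
open import Data.List using (List; length)
import Data.List.Membership.Propositional as List
open import Data.List.Relation.Unary.Unique.Propositional using (Unique)
open import Data.Nat as ℕ using (ℕ; zero; suc; _!; NonZero)
import Data.Nat.DivMod as ℕ
import Data.Nat.Properties as ℕₚ
open import Data.Nat.Properties using (_!≢0)
open import Data.Nat.Tactic.RingSolver using (solve-∀)
open import Data.Product using (∃-syntax; _×_; _,_; proj₁; proj₂)
open import Data.Rational hiding (NonZero; Positive)
open import Data.Rational.Properties
open import Data.Rational.Solver using (module +-*-Solver)
import Data.Rational as ℚ
import Data.Rational.Unnormalised as ℚᵘ
import Data.Rational.Unnormalised.Properties as ℚᵘₚ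
open import Data.Sum using (_⊎_; inj₁; inj₂)
open import Data.Vec using (Vec; lookup; zipWith)
open import Function.Bundles using (_⇔_)
open import Relation.Binary.PropositionalEquality
open import Relation.Nullary using (¬_; yes; no; contradiction)

-- A set of edges is given by its adjacency matrix, so that propositional
-- equality of two edge sets is equality as sets.
EdgeSet : ℕ → Set
EdgeSet n = Vec (Subset n) n

_∋_∼_ : ∀ {n} → EdgeSet n → Fin n → Fin n → Set
E ∋ u ∼ v = v ∈ lookup E u

_∪ᴱ_ : ∀ {n} → EdgeSet n → EdgeSet n → EdgeSet n
_∪ᴱ_ = zipWith _∪_

EdgeDisjoint : ∀ {n} → EdgeSet n → EdgeSet n → Set
EdgeDisjoint E F = ∀ u v → ¬ (E ∋ u ∼ v × F ∋ u ∼ v)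

-- The first two fields say that the matrix is that of a set of edges of
-- the complete graph.
record IsPerfectMatching {n} (M : EdgeSet n) : Set where
  field
    symmetric   : ∀ u v → M ∋ u ∼ v → M ∋ v ∼ u
    irreflexive : ∀ u → ¬ (M ∋ u ∼ u)
    disjoint    : ∀ u v w → M ∋ u ∼ v → M ∋ u ∼ w → v ≡ w
    covers      : ∀ u → ∃[ v ] M ∋ u ∼ v

-- j is the position following i in the cyclic order 0, 1, …, n - 1.
CyclicSucc : ∀ {n} → Fin n → Fin n → Set
CyclicSucc {n} i j =
  toℕ j ≡ suc (toℕ i) ⊎ (suc (toℕ i) ≡ n × toℕ j ≡ 0)

-- The edges are exactly the pairs of cyclically consecutive vertices
-- in some ordering of all the vertices.
record IsHamiltonCycle {n} (E : EdgeSet n) : Set where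
  field
    3≤n   : 3 ℕ.≤ n
    order : Permutation′ n
    edges : ∀ i j → E ∋ (order ⟨$⟩ʳ i) ∼ (order ⟨$⟩ʳ j) ⇔
                    (CyclicSucc i j ⊎ CyclicSucc j i)

HasCardinality : {A : Set} → (A → Set) → ℕ → Set
HasCardinality {A} P N = ∃[ xs ]
  (Unique xs × (∀ (x : A) → x List.∈ xs ⇔ P x) × length xs ≡ N)

record ℝ : Set where
  constructor mkℝ
  field
    seq    : ℕ → ℚ
    cauchy : ∀ ε → 0ℚ < ε →
             ∃[ N ] (∀ m n → N ℕ.≤ m → N ℕ.≤ n → ∣ seq m - seq n ∣ ≤ ε)

open ℝ public

infix 4 _≤ʳ_

_≤ʳ_ : ℝ → ℝ → Set
x ≤ʳ y = ∀ ε → 0ℚ < ε → ∃[ N ] (∀ n → N ℕ.≤ n → seq x n ≤ seq y n + ε)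

-- The strict inequality 0 < x between real numbers.
Positive : ℝ → Set
Positive x = ∃[ δ ] (0ℚ < δ × ∃[ N ] (∀ n → N ℕ.≤ n → δ ≤ seq x n))

ofℚ : ℚ → ℝ
ofℚ q = mkℝ (λ _ → q) λ ε 0<ε →
  0 , λ _ _ _ _ → subst (_≤ ε) (sym (cong ∣_∣ (+-inverseʳ q))) (<⇒≤ 0<ε)

ofℕ : ℕ → ℝ
ofℕ n = ofℚ (+ n / 1)

∣∣-≤ : ∀ {p ε} → p ≤ ε → - p ≤ ε → ∣ p ∣ ≤ ε
∣∣-≤ {p} a b with ∣p∣≡p∨∣p∣≡-p p
... | inj₁ eq rewrite eq = a
... | inj₂ eq rewrite eq = b

diff-≤ : ∀ {p q ε} → p ≤ q + ε → p - q ≤ ε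
diff-≤ {p} {q} {ε} h = subst (p - q ≤_) lemma (+-monoˡ-≤ (- q) h)
  where
  open +-*-Solver
  lemma : q + ε - q ≡ ε
  lemma = solve 2 (λ q ε → q :+ ε :- q := ε) refl q ε

dist-≤ : ∀ {p q ε} → p ≤ q + ε → q ≤ p + ε → ∣ p - q ∣ ≤ ε
dist-≤ {p} {q} {ε} h k = ∣∣-≤ (diff-≤ h) (subst (_≤ ε) lemma (diff-≤ k))
  where
  open +-*-Solver
  lemma : q - p ≡ - (p - q)
  lemma = solve 2 (λ p q → q :- p := :- (p :- q)) refl p q

*-mono-≤-nonNeg : ∀ {p q r s} → 0ℚ ≤ p → 0ℚ ≤ s → p ≤ q → r ≤ s → p * r ≤ q * s
*-mono-≤-nonNeg {p} {q} {r} {s} 0≤p 0≤s p≤q r≤s = ≤-trans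
  (*-monoˡ-≤-nonNeg p {{nonNegative 0≤p}} r≤s)
  (*-monoʳ-≤-nonNeg s {{nonNegative 0≤s}} p≤q)

*-pos : ∀ {p q} → 0ℚ < p → 0ℚ < q → 0ℚ < p * q
*-pos {p} {q} 0<p 0<q =
  positive⁻¹ (p * q) {{pos*pos⇒pos p {{positive 0<p}} q {{positive 0<q}}}}

0<1/ : ∀ {p} (0<p : 0ℚ < p) → 0ℚ < (1/ p) {{>-nonZero 0<p}}
0<1/ {p} 0<p = positive⁻¹ _ {{1/pos⇒pos p {{positive 0<p}}}}

module _ where
  open +-*-Solver

  split-sum : ∀ a b → a ≡ b + (a - b)
  split-sum = solve 2 (λ a b → a := b :+ (a :- b)) refl

  split-product : ∀ a b c d → a * b - c * d ≡ a * (b - d) + (a - c) * d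
  split-product = solve 4 (λ a b c d →
    a :* b :- c :* d := a :* (b :- d) :+ (a :- c) :* d) refl

  factor-out : ∀ A B η → A * η + η * B ≡ η * (A + B)
  factor-out = solve 3 (λ A B η → A :* η :+ η :* B := η :* (A :+ B)) refl

  cross-multiply : ∀ i j p q → (i - j) * (p * q) ≡ q * (i * p) - p * (j * q)
  cross-multiply = solve 4 (λ i j p q →
    (i :- j) :* (p :* q) := q :* (i :* p) :- p :* (j :* q)) refl

bounded : (x : ℝ) → ∃[ B ] (0ℚ < B × ∃[ N ] (∀ n → N ℕ.≤ n → ∣ seq x n ∣ ≤ B))
bounded x = ∣ seq x N ∣ + 1ℚ , 0<B , N , bound
  where
  0<1 : 0ℚ < 1ℚ
  0<1 = *<* (ℤ.+<+ (ℕ.s≤s ℕ.z≤n))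
  N = proj₁ (cauchy x 1ℚ 0<1)
  0<B : 0ℚ < ∣ seq x N ∣ + 1ℚ
  0<B = subst (_< ∣ seq x N ∣ + 1ℚ) (+-identityˡ 0ℚ)
          (+-mono-≤-< (0≤∣p∣ (seq x N)) 0<1)
  bound : ∀ n → N ℕ.≤ n → ∣ seq x n ∣ ≤ ∣ seq x N ∣ + 1ℚ
  bound n N≤n = begin
    ∣ seq x n ∣                            ≡⟨ cong ∣_∣ (split-sum (seq x n) (seq x N)) ⟩
    ∣ seq x N + (seq x n - seq x N) ∣      ≤⟨ ∣p+q∣≤∣p∣+∣q∣ (seq x N) _ ⟩
    ∣ seq x N ∣ + ∣ seq x n - seq x N ∣    ≤⟨ +-monoʳ-≤ ∣ seq x N ∣ (proj₂ (cauchy x 1ℚ 0<1) n N N≤n ℕₚ.≤-refl) ⟩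
    ∣ seq x N ∣ + 1ℚ                       ∎
    where open ≤-Reasoning

product-dist : ∀ {a b c d A B η} → 0ℚ ≤ η → 0ℚ ≤ B →
               ∣ a ∣ ≤ A → ∣ d ∣ ≤ B → ∣ a - c ∣ ≤ η → ∣ b - d ∣ ≤ η →
               ∣ a * b - c * d ∣ ≤ A * η + η * B
product-dist {a} {b} {c} {d} {A} {B} {η} 0≤η 0≤B a≤A d≤B ac bd = begin
  ∣ a * b - c * d ∣                      ≡⟨ cong ∣_∣ (split-product a b c d) ⟩
  ∣ a * (b - d) + (a - c) * d ∣          ≤⟨ ∣p+q∣≤∣p∣+∣q∣ (a * (b - d)) ((a - c) * d) ⟩
  ∣ a * (b - d) ∣ + ∣ (a - c) * d ∣      ≡⟨ cong₂ _+_ (∣p*q∣≡∣p∣*∣q∣ a (b - d)) (∣p*q∣≡∣p∣*∣q∣ (a - c) d) ⟩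
  ∣ a ∣ * ∣ b - d ∣ + ∣ a - c ∣ * ∣ d ∣  ≤⟨ +-mono-≤ (*-mono-≤-nonNeg (0≤∣p∣ a) 0≤η a≤A bd)
                                                    (*-mono-≤-nonNeg (0≤∣p∣ (a - c)) 0≤B ac d≤B) ⟩
  A * η + η * B                          ∎
  where open ≤-Reasoning

share : ∀ {S} → 0ℚ < S → ∀ ε → 0ℚ < ε → ∃[ η ] (0ℚ < η × η * S ≡ ε)
share {S} 0<S ε 0<ε = ε * i , *-pos 0<ε (0<1/ 0<S) ,
  trans (*-assoc ε i S) (trans (cong (ε *_) i*S≡1) (*-identityʳ ε))
  where
  i = (1/ S) {{>-nonZero 0<S}}
  i*S≡1 : i * S ≡ 1ℚ
  i*S≡1 = *-inverseˡ S {{>-nonZero 0<S}}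

infixl 7 _*ʳ_
infixr 8 _^ʳ_

*-cauchy : (x y : ℝ) → ∀ ε → 0ℚ < ε →
           ∃[ N ] (∀ m n → N ℕ.≤ m → N ℕ.≤ n →
             ∣ seq x m * seq y m - seq x n * seq y n ∣ ≤ ε)
*-cauchy x y ε 0<ε = N , λ m n N≤m N≤n →
  subst (∣ seq x m * seq y m - seq x n * seq y n ∣ ≤_) (trans (factor-out A B η) ηS≡ε)
    (product-dist (<⇒≤ 0<η) (<⇒≤ 0<B)
      (a m (ℕₚ.≤-trans N₁≤N N≤m)) (b n (ℕₚ.≤-trans N₂≤N N≤n))
      (cx m n (ℕₚ.≤-trans N₃≤N N≤m) (ℕₚ.≤-trans N₃≤N N≤n))
      (cy m n (ℕₚ.≤-trans N₄≤N N≤m) (ℕₚ.≤-trans N₄≤N N≤n)))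
  where
  A = proj₁ (bounded x)
  0<A = proj₁ (proj₂ (bounded x))
  N₁ = proj₁ (proj₂ (proj₂ (bounded x)))
  a = proj₂ (proj₂ (proj₂ (bounded x)))
  B = proj₁ (bounded y)
  0<B = proj₁ (proj₂ (bounded y))
  N₂ = proj₁ (proj₂ (proj₂ (bounded y)))
  b = proj₂ (proj₂ (proj₂ (bounded y)))
  η-spec = share (+-mono-< 0<A 0<B) ε 0<ε
  η = proj₁ η-spec
  0<η = proj₁ (proj₂ η-spec)
  ηS≡ε = proj₂ (proj₂ η-spec)
  N₃ = proj₁ (cauchy x η 0<η)
  cx = proj₂ (cauchy x η 0<η)
  N₄ = proj₁ (cauchy y η 0<η)
  cy = proj₂ (cauchy y η 0<η)
  N = (N₁ ℕ.+ N₂) ℕ.+ (N₃ ℕ.+ N₄)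
  N₁≤N : N₁ ℕ.≤ N
  N₁≤N = ℕₚ.≤-trans (ℕₚ.m≤m+n N₁ N₂) (ℕₚ.m≤m+n (N₁ ℕ.+ N₂) (N₃ ℕ.+ N₄))
  N₂≤N : N₂ ℕ.≤ N
  N₂≤N = ℕₚ.≤-trans (ℕₚ.m≤n+m N₂ N₁) (ℕₚ.m≤m+n (N₁ ℕ.+ N₂) (N₃ ℕ.+ N₄))
  N₃≤N : N₃ ℕ.≤ N
  N₃≤N = ℕₚ.≤-trans (ℕₚ.m≤m+n N₃ N₄) (ℕₚ.m≤n+m (N₃ ℕ.+ N₄) (N₁ ℕ.+ N₂))
  N₄≤N : N₄ ℕ.≤ N
  N₄≤N = ℕₚ.≤-trans (ℕₚ.m≤n+m N₄ N₃) (ℕₚ.m≤n+m (N₃ ℕ.+ N₄) (N₁ ℕ.+ N₂))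

_*ʳ_ : ℝ → ℝ → ℝ
x *ʳ y = mkℝ (λ n → seq x n * seq y n) (*-cauchy x y)

_^ʳ_ : ℝ → ℕ → ℝ
x ^ʳ zero  = ofℚ 1ℚ
x ^ʳ suc m = x *ʳ (x ^ʳ m)

0<⊔ : ∀ {δ} → 0ℚ < δ → ∀ q → 0ℚ < δ ⊔ q
0<⊔ {δ} 0<δ q = <-≤-trans 0<δ (p≤p⊔q δ q)

-- Only finitely many terms of x lie below δ; the maximum replaces them
-- by δ, so that every term can be inverted.
recip : (x : ℝ) → Positive x → ℝ
recip x (δ , 0<δ , K , δ≤x) = mkℝ inv proof
  where
  inv : ℕ → ℚ
  inv n = (1/ (δ ⊔ seq x n)) {{>-nonZero (0<⊔ 0<δ (seq x n))}}

  inv-dist : ∀ p q ε .{{_ : ℚ.NonZero p}} .{{_ : ℚ.NonZero q}} → 0ℚ < ε →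
             δ ≤ p → δ ≤ q → ∣ q - p ∣ ≤ ε * (δ * δ) → ∣ 1/ p - 1/ q ∣ ≤ ε
  inv-dist p q ε 0<ε δ≤p δ≤q h =
    *-cancelʳ-≤-pos (p * q) {{positive (*-pos 0<p 0<q)}} (begin
      ∣ 1/ p - 1/ q ∣ * (p * q)        ≡⟨ cong (∣ 1/ p - 1/ q ∣ *_) (0≤p⇒∣p∣≡p (<⇒≤ (*-pos 0<p 0<q))) ⟨
      ∣ 1/ p - 1/ q ∣ * ∣ p * q ∣      ≡⟨ ∣p*q∣≡∣p∣*∣q∣ (1/ p - 1/ q) (p * q) ⟨
      ∣ (1/ p - 1/ q) * (p * q) ∣      ≡⟨ cong ∣_∣ (cross-multiply (1/ p) (1/ q) p q) ⟩
      ∣ q * (1/ p * p) - p * (1/ q * q) ∣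
                                       ≡⟨ cong₂ (λ s t → ∣ q * s - p * t ∣) (*-inverseˡ p) (*-inverseˡ q) ⟩
      ∣ q * 1ℚ - p * 1ℚ ∣              ≡⟨ cong₂ (λ s t → ∣ s - t ∣) (*-identityʳ q) (*-identityʳ p) ⟩
      ∣ q - p ∣                        ≤⟨ h ⟩
      ε * (δ * δ)                      ≤⟨ *-monoˡ-≤-nonNeg ε {{nonNegative (<⇒≤ 0<ε)}}
                                            (*-mono-≤-nonNeg (<⇒≤ 0<δ) (<⇒≤ 0<q) δ≤p δ≤q) ⟩
      ε * (p * q)                      ∎)
    where
    open ≤-Reasoning
    0<p = <-≤-trans 0<δ δ≤p
    0<q = <-≤-trans 0<δ δ≤q

  proof : ∀ ε → 0ℚ < ε →
          ∃[ N ] (∀ m n → N ℕ.≤ m → N ℕ.≤ n → ∣ inv m - inv n ∣ ≤ ε)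
  proof ε 0<ε = K ℕ.+ proj₁ c , λ m n N≤m N≤n →
    inv-dist (δ ⊔ seq x m) (δ ⊔ seq x n) ε
      {{>-nonZero (0<⊔ 0<δ (seq x m))}} {{>-nonZero (0<⊔ 0<δ (seq x n))}}
      0<ε (p≤p⊔q δ _) (p≤p⊔q δ _)
      (subst₂ (λ s t → ∣ s - t ∣ ≤ ε * (δ * δ))
        (sym (p≤q⇒p⊔q≡q (δ≤x n (ℕₚ.≤-trans (ℕₚ.m≤m+n K _) N≤n))))
        (sym (p≤q⇒p⊔q≡q (δ≤x m (ℕₚ.≤-trans (ℕₚ.m≤m+n K _) N≤m))))
        (proj₂ c n m (ℕₚ.≤-trans (ℕₚ.m≤n+m _ K) N≤n) (ℕₚ.≤-trans (ℕₚ.m≤n+m _ K) N≤m)))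
    where c = cauchy x (ε * (δ * δ)) (*-pos 0<ε (*-pos 0<δ 0<δ))

/-mono : ∀ a b c d .{{_ : NonZero b}} .{{_ : NonZero d}} →
         a ℕ.* d ℕ.≤ c ℕ.* b → + a / b ≤ + c / d
/-mono a b@(suc b-1) c d@(suc d-1) h = toℚᵘ-cancel-≤
  (ℚᵘₚ.≤-respˡ-≃ (ℚᵘₚ.≃-sym (toℚᵘ-fromℚᵘ (ℚᵘ.mkℚᵘ (+ a) b-1)))
  (ℚᵘₚ.≤-respʳ-≃ (ℚᵘₚ.≃-sym (toℚᵘ-fromℚᵘ (ℚᵘ.mkℚᵘ (+ c) d-1)))
  (ℚᵘ.*≤* (subst₂ ℤ._≤_ (ℤₚ.pos-* a d) (ℤₚ.pos-* c b) (ℤ.+≤+ h)))))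

/-+ : ∀ a c b .{{_ : NonZero b}} → + a / b + + c / b ≡ + (a ℕ.+ c) / b
/-+ a c b@(suc b-1) = toℚᵘ-injective (begin
  toℚᵘ (+ a / b + + c / b)
    ≈⟨ toℚᵘ-homo-+ (+ a / b) (+ c / b) ⟩
  toℚᵘ (+ a / b) ℚᵘ.+ toℚᵘ (+ c / b)
    ≈⟨ ℚᵘₚ.+-cong (toℚᵘ-fromℚᵘ (ℚᵘ.mkℚᵘ (+ a) b-1)) (toℚᵘ-fromℚᵘ (ℚᵘ.mkℚᵘ (+ c) b-1)) ⟩
  ℚᵘ.mkℚᵘ (+ a) b-1 ℚᵘ.+ ℚᵘ.mkℚᵘ (+ c) b-1
    ≈⟨ ℚᵘ.*≡* lemma ⟩
  ℚᵘ.mkℚᵘ (+ (a ℕ.+ c)) b-1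
    ≈⟨ ℚᵘₚ.≃-sym (toℚᵘ-fromℚᵘ (ℚᵘ.mkℚᵘ (+ (a ℕ.+ c)) b-1)) ⟩
  toℚᵘ (+ (a ℕ.+ c) / b) ∎)
  where
  open ℚᵘₚ.≃-Reasoning
  lemma : (+ a ℤ.* + b ℤ.+ + c ℤ.* + b) ℤ.* + b ≡ + (a ℕ.+ c) ℤ.* (+ b ℤ.* + b)
  lemma = trans (cong (ℤ._* + b) (trans (sym (ℤₚ.*-distribʳ-+ (+ b) (+ a) (+ c)))
                  (cong (ℤ._* + b) (sym (ℤₚ.pos-+ a c)))))
                (ℤₚ.*-assoc (+ (a ℕ.+ c)) (+ b) (+ b))

0≤1/ : ∀ b .{{_ : NonZero b}} → 0ℚ ≤ + 1 / b
0≤1/ b = /-mono 0 1 1 b ℕ.z≤n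

archimedean : ∀ ε → 0ℚ < ε → ∀ m .{{_ : NonZero m}} → ↧ₙ ε ℕ.≤ m → + 1 / m ≤ ε
archimedean ε@(mkℚ (+ zero) d _) (*<* (ℤ.+<+ ())) m h
archimedean ε@(mkℚ (+ suc p) d _) 0<ε m h = subst (+ 1 / m ≤_) (↥p/↧p≡p ε)
  (/-mono 1 m (suc p) (suc d) (begin
    1 ℕ.* suc d    ≡⟨ ℕₚ.*-identityˡ (suc d) ⟩
    suc d          ≤⟨ h ⟩
    m              ≤⟨ ℕₚ.m≤m+n m (p ℕ.* m) ⟩
    suc p ℕ.* m    ∎))
  where open ℕₚ.≤-Reasoning

1/fact : ℕ → ℚ
1/fact j = (+ 1 / (j !)) {{j !≢0}}

expSum : ℕ → ℚ
expSum zero    = 1/fact 0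
expSum (suc j) = expSum j + 1/fact (suc j)

expSum-mono : ∀ {m n} → m ℕ.≤′ n → expSum m ≤ expSum n
expSum-mono ℕ.≤′-refl = ≤-refl
expSum-mono (ℕ.≤′-step {n} h) = ≤-trans (expSum-mono h)
  (subst (_≤ expSum (suc n)) (+-identityʳ (expSum n))
    (+-monoʳ-≤ (expSum n) (0≤1/ (suc n !) {{suc n !≢0}})))

term-halves : ∀ j → 1 ℕ.≤ j → 1/fact (suc j) + 1/fact (suc j) ≤ 1/fact j
term-halves j@(suc i) _ = subst (_≤ 1/fact j) (sym (/-+ 1 1 (suc j !) {{suc j !≢0}}))
  (/-mono 2 (suc j !) 1 (j !) {{suc j !≢0}} {{j !≢0}} (begin
    2 ℕ.* j !              ≤⟨ ℕₚ.*-monoˡ-≤ (j !) (ℕ.s≤s (ℕ.s≤s (ℕ.z≤n {i}))) ⟩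
    suc j ℕ.* j !          ≡⟨ ℕₚ.*-identityˡ (suc j !) ⟨
    1 ℕ.* suc j !          ∎))
  where open ℕₚ.≤-Reasoning

expSum-tail : ∀ {m n} → 1 ℕ.≤ m → m ℕ.≤′ n → expSum n + 1/fact n ≤ expSum m + 1/fact m
expSum-tail _ ℕ.≤′-refl = ≤-refl
expSum-tail 1≤m (ℕ.≤′-step {n} h) = ≤-trans
  (subst (_≤ expSum n + 1/fact n) (sym (+-assoc (expSum n) _ _))
    (+-monoʳ-≤ (expSum n) (term-halves n (ℕₚ.≤-trans 1≤m (ℕₚ.≤′⇒≤ h)))))
  (expSum-tail 1≤m h)

n≤n! : ∀ n → n ℕ.≤ n !
n≤n! zero    = ℕ.z≤n
n≤n! (suc n) = ℕₚ.m≤m*n (suc n) (n !) {{n !≢0}}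

expSum-close : ∀ ε → 0ℚ < ε → ∀ m n → ↧ₙ ε ℕ.≤ m → m ℕ.≤ n →
               expSum n ≤ expSum m + ε
expSum-close ε 0<ε m n q≤m m≤n = begin
  expSum n             ≡⟨ +-identityʳ (expSum n) ⟨
  expSum n + 0ℚ        ≤⟨ +-monoʳ-≤ (expSum n) (0≤1/ (n !) {{n !≢0}}) ⟩
  expSum n + 1/fact n    ≤⟨ expSum-tail (ℕₚ.≤-trans (ℕ.s≤s ℕ.z≤n) q≤m) (ℕₚ.≤⇒≤′ m≤n) ⟩
  expSum m + 1/fact m    ≤⟨ +-monoʳ-≤ (expSum m) (archimedean ε 0<ε (m !) {{m !≢0}} (ℕₚ.≤-trans q≤m (n≤n! m))) ⟩
  expSum m + ε         ∎
  where open ≤-Reasoning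

≤+ε : ∀ {p q ε} → 0ℚ < ε → p ≤ q → p ≤ q + ε
≤+ε {p} {q} {ε} 0<ε h =
  subst (_≤ q + ε) (+-identityʳ p) (+-mono-≤ h (<⇒≤ 0<ε))

e : ℝ
e = mkℝ expSum λ ε 0<ε → ↧ₙ ε , λ m n q≤m q≤n → close ε 0<ε m n q≤m q≤n
  where
  close : ∀ ε → 0ℚ < ε → ∀ m n → ↧ₙ ε ℕ.≤ m → ↧ₙ ε ℕ.≤ n →
          ∣ expSum m - expSum n ∣ ≤ ε
  close ε 0<ε m n q≤m q≤n with ℕₚ.≤-total m n
  ... | inj₁ m≤n = dist-≤ (≤+ε 0<ε (expSum-mono (ℕₚ.≤⇒≤′ m≤n))) (expSum-close ε 0<ε m n q≤m m≤n)
  ... | inj₂ n≤m = dist-≤ (expSum-close ε 0<ε n m q≤n n≤m) (≤+ε 0<ε (expSum-mono (ℕₚ.≤⇒≤′ n≤m)))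

0<e : Positive e
0<e = 1ℚ , *<* (ℤ.+<+ (ℕ.s≤s ℕ.z≤n)) , 0 , λ n _ → expSum-mono {0} {n} (ℕₚ.≤⇒≤′ ℕ.z≤n)

isqrt : ∀ n → ∃[ s ] (s ℕ.* s ℕ.≤ n × n ℕ.< suc s ℕ.* suc s)
isqrt zero = 0 , ℕ.z≤n , ℕ.s≤s ℕ.z≤n
isqrt (suc n) with isqrt n
... | s , lo , hi with suc s ℕ.* suc s ℕ.≤? suc n
...   | yes p = suc s , p , ℕₚ.≤-<-trans hi (ℕₚ.*-mono-< {suc s} {suc (suc s)} (ℕₚ.n<1+n _) (ℕₚ.n<1+n _))
...   | no ¬p = s , ℕₚ.m≤n⇒m≤1+n lo , ℕₚ.≰⇒> ¬p

-- ⌊ p √n ⌋ / p for p = j + 1, which is within 1 / p of √n.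
sqrtApprox : ℕ → ℕ → ℚ
sqrtApprox n j = + proj₁ (isqrt (n ℕ.* (suc j ℕ.* suc j))) / suc j

*-cancel-square : ∀ {a b} → a ℕ.* a ℕ.≤ b ℕ.* b → a ℕ.≤ b
*-cancel-square {a} {b} h with a ℕ.≤? b
... | yes p = p
... | no ¬p = contradiction (ℕₚ.*-mono-< (ℕₚ.≰⇒> ¬p) (ℕₚ.≰⇒> ¬p)) (ℕₚ.≤⇒≯ h)

sqrtApprox-close : ∀ n ε → 0ℚ < ε → ∀ i j → ↧ₙ ε ℕ.≤ j →
                   sqrtApprox n i ≤ sqrtApprox n j + ε
sqrtApprox-close n ε 0<ε i j q≤j with isqrt (n ℕ.* (suc i ℕ.* suc i)) | isqrt (n ℕ.* (suc j ℕ.* suc j))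
... | a , alo , ahi | b , blo , bhi = begin
  + a / suc i                   ≤⟨ /-mono a (suc i) (b ℕ.+ 1) (suc j) (*-cancel-square squares) ⟩
  + (b ℕ.+ 1) / suc j           ≡⟨ /-+ b 1 (suc j) ⟨
  + b / suc j + + 1 / suc j     ≤⟨ +-monoʳ-≤ (+ b / suc j) (archimedean ε 0<ε (suc j) (ℕₚ.m≤n⇒m≤1+n q≤j)) ⟩
  + b / suc j + ε               ∎
  where
  open ≤-Reasoning
  p = suc i
  q = suc j
  rearrange₁ : ∀ a q → (a ℕ.* q) ℕ.* (a ℕ.* q) ≡ (a ℕ.* a) ℕ.* (q ℕ.* q)
  rearrange₁ = solve-∀
  rearrange₂ : ∀ n p q → (n ℕ.* (p ℕ.* p)) ℕ.* (q ℕ.* q) ≡ (n ℕ.* (q ℕ.* q)) ℕ.* (p ℕ.* p)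
  rearrange₂ = solve-∀
  squares : (a ℕ.* q) ℕ.* (a ℕ.* q) ℕ.≤ ((b ℕ.+ 1) ℕ.* p) ℕ.* ((b ℕ.+ 1) ℕ.* p)
  squares = ℕR.begin
    (a ℕ.* q) ℕ.* (a ℕ.* q)                            ℕR.≡⟨ rearrange₁ a q ⟩
    (a ℕ.* a) ℕ.* (q ℕ.* q)                            ℕR.≤⟨ ℕₚ.*-monoˡ-≤ (q ℕ.* q) alo ⟩
    (n ℕ.* (p ℕ.* p)) ℕ.* (q ℕ.* q)                    ℕR.≡⟨ rearrange₂ n p q ⟩
    (n ℕ.* (q ℕ.* q)) ℕ.* (p ℕ.* p)                    ℕR.≤⟨ ℕₚ.*-monoˡ-≤ (p ℕ.* p) (ℕₚ.<⇒≤ bhi) ⟩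
    (suc b ℕ.* suc b) ℕ.* (p ℕ.* p)                    ℕR.≡⟨ rearrange₁ (suc b) p ⟨
    (suc b ℕ.* p) ℕ.* (suc b ℕ.* p)                    ℕR.≡⟨ cong (λ t → (t ℕ.* p) ℕ.* (t ℕ.* p)) (ℕₚ.+-comm 1 b) ⟩
    ((b ℕ.+ 1) ℕ.* p) ℕ.* ((b ℕ.+ 1) ℕ.* p)            ℕR.∎
    where module ℕR = ℕₚ.≤-Reasoning

√_ : ℕ → ℝ
√ n = mkℝ (sqrtApprox n) λ ε 0<ε → ↧ₙ ε , λ i j q≤i q≤j →
  dist-≤ (sqrtApprox-close n ε 0<ε i j q≤j) (sqrtApprox-close n ε 0<ε j i q≤i)

0<√ : ∀ n .{{_ : NonZero n}} → Positive (√ n)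
0<√ n = 1ℚ , *<* (ℤ.+<+ (ℕ.s≤s ℕ.z≤n)) , 0 , λ j _ → 1≤ j
  where
  1≤ : ∀ j → 1ℚ ≤ sqrtApprox n j
  1≤ j with isqrt (n ℕ.* (suc j ℕ.* suc j))
  ... | s , _ , hi = /-mono 1 1 s (suc j) (begin
    1 ℕ.* suc j    ≡⟨ ℕₚ.*-identityˡ (suc j) ⟩
    suc j          ≤⟨ ℕₚ.≤-pred (lt (ℕₚ.≤-<-trans (ℕₚ.m≤n*m (suc j ℕ.* suc j) n) hi)) ⟩
    s              ≡⟨ ℕₚ.*-identityʳ s ⟨
    s ℕ.* 1        ∎)
    where
    open ℕₚ.≤-Reasoning
    lt : suc j ℕ.* suc j ℕ.< suc s ℕ.* suc s → suc j ℕ.< suc s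
    lt h with suc j ℕ.<? suc s
    ... | yes p = p
    ... | no ¬p = contradiction (ℕₚ.*-mono-≤ (ℕₚ.≮⇒≥ ¬p) (ℕₚ.≮⇒≥ ¬p)) (ℕₚ.<⇒≱ h)

-- n^(-k/2) (n/e)^(n/2); n is meant to be even, so that n / 2 is exact.
growth : (k n : ℕ) .{{_ : NonZero n}} → ℝ
growth k n = recip (√ n) (0<√ n) ^ʳ k *ʳ (ofℕ n *ʳ recip e 0<e) ^ʳ (n ℕ./ 2)

-- Choose the edges of M* one at a time. When vw is chosen, delete v and w and
-- join their partners in every M_i: the union of M* and M_i is a Hamilton cycle
-- iff w was not a partner of v and the rest of M* is good for the contracted
-- matchings. Always take for v a vertex at which two of the contracted matchings
-- agree ("dirty"), if there is one. Otherwise v has exactly m - 1 - k admissible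
-- partners among the m remaining vertices, and all but O(1) of them create no
-- dirty vertex, so that the number of completions stays within a factor
-- 1 + O(c / m) of the product of the numbers m - 1 - k, where the penalty c is
-- exponential in the number of dirty vertices.
--
-- The lower bound needs one completion from every clean state of some large
-- constant size. This is shown by induction on k: two of the matchings are made
-- equal, at the price of few vertices where others agree, and are then
-- treated as one. An edge vw that is forbidden by some M_i is replaced by two
-- edges from v and w to the ends of an edge xy of the matchings to be changed.
--
-- Finally the product is compared with n^(-k/2) (n/e)^(n/2) by telescoping, using
-- (1 + 1/y)^(2y+1) = e^2 (1 + O(1/y^2)).
module Submission where

open import Data.Bool using (Bool; true; false; not)
open import Data.Bool.Properties using (not-involutive)
open import Data.Empty using (⊥)
open import Data.Fin using (Fin; toℕ; fromℕ<; zero; suc)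
import Data.Fin as Fin
import Data.Fin.Properties as Fin
open import Data.List using (List; []; _∷_; _++_; map; filter; length; concatMap; allFin; cartesianProduct)
open import Data.List.Properties using (length-map; length-++; length-tabulate; map-cong; filter-none)
open import Data.List.Membership.Propositional using (_∈_; _∉_; find; lose)
open import Data.List.Membership.Propositional.Properties
open import Data.List.Relation.Binary.Subset.Propositional using (_⊆_)
open import Data.List.Relation.Unary.All as All using (All; []; _∷_)
import Data.List.Relation.Unary.All.Properties as All
open import Data.List.Relation.Unary.AllPairs as AllPairs using (AllPairs; []; _∷_)
import Data.List.Relation.Unary.AllPairs.Properties as AllPairs
open import Data.List.Relation.Unary.Any as Any using (Any; here; there; any?)
import Data.List.Relation.Unary.Any.Properties as Any
open import Data.List.Relation.Unary.Unique.Propositional using (Unique)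
import Data.List.Relation.Unary.Unique.Propositional.Properties as Unique
open import Data.Product using (∃-syntax; _×_; _,_; proj₁; proj₂)
open import Data.Sum using (_⊎_; inj₁; inj₂)
open import Function using (_∘_; id)
open import Relation.Binary.Definitions using (DecidableEquality; tri<; tri≈; tri>)
open import Relation.Binary.PropositionalEquality
open import Relation.Nullary using (¬_; yes; no; ¬?; contradiction; Dec; does; _×-dec_)
open import Relation.Nullary.Decidable using (True; toWitness)
open import Relation.Unary using (Decidable)

-- With P the product of the numbers of choices at clean vertices, c the penalty and m the number of
-- vertices, the recursion proves `count` ≤ Q P (1 + (c - E) / m) and S `count` ≥ P (1 + (E - c) /
-- m). The constant E exceeds the penalty K of a clean state by G. As m drops by 2, the term G / m
-- grows by an amount of order 1 / m², and this pays for the O(1) choices among m that raise the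
-- penalty. At a dirty vertex the number of choices may exceed m - 1 - k, a relative error of order
-- 1 / m; it is paid for by the penalty falling by a factor of 32. The lower bound is void for c ≥ m
-- + E, so only base states with few dirty vertices for their size need a completion. The factor
-- n^(-k/2) stems from replacing m - 1 - k by m - 1 throughout the product: changing every factor by
-- one changes the product by √n up to constants. This is seen on squares, which also removes the
-- roots: all estimates are between natural numbers, with `expNum j` / j! in place of e.

-- Counting in lists without repetitions

module ListCounting where
  open import Data.Nat hiding (_≟_)
  open import Data.Nat.Properties hiding (_≟_)
  open import Data.Nat.Tactic.RingSolver using (solve-∀)
  open import Data.Nat.ListAction using (sum)

  unique-⊆-length : ∀ {A : Set} {xs ys : List A} → Unique xs → xs ⊆ ys → length xs ≤ length ys
  unique-⊆-length [] _ = z≤n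
  unique-⊆-length {xs = x ∷ xs} {ys} (x∉xs ∷ xs!) xs⊆ys
    with as , bs , refl ← ∈-∃++ (xs⊆ys (here refl)) = begin
      suc (length xs)            ≤⟨ s≤s (unique-⊆-length xs! rest) ⟩
      suc (length (as ++ bs))    ≡⟨ cong suc (length-++ as) ⟩
      suc (length as + length bs) ≡⟨ +-suc (length as) (length bs) ⟨
      length as + suc (length bs) ≡⟨ length-++ as ⟨
      length (as ++ x ∷ bs)      ∎
    where
    open ≤-Reasoning
    rest : xs ⊆ as ++ bs
    rest z∈xs with ∈-++⁻ as (xs⊆ys (there z∈xs))
    ... | inj₁ z∈as = ∈-++⁺ˡ z∈as
    ... | inj₂ (here refl) = contradiction refl (All.lookup x∉xs z∈xs)
    ... | inj₂ (there z∈bs) = ∈-++⁺ʳ as z∈bs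

  length-filter-∁ : ∀ {A : Set} {P : A → Set} (P? : Decidable P) xs →
                    length (filter P? xs) + length (filter (¬? ∘ P?) xs) ≡ length xs
  length-filter-∁ P? [] = refl
  length-filter-∁ P? (x ∷ xs) with P? x
  ... | yes _ = cong suc (length-filter-∁ P? xs)
  ... | no _ = trans (+-suc _ _) (cong suc (length-filter-∁ P? xs))

  sum-map-≤ : ∀ {A : Set} (f g : A → ℕ) (xs : List A) →
              (∀ {x} → x ∈ xs → f x ≤ g x) → sum (map f xs) ≤ sum (map g xs)
  sum-map-≤ f g [] _ = z≤n
  sum-map-≤ f g (x ∷ xs) f≤g = +-mono-≤ (f≤g (here refl)) (sum-map-≤ f g xs (f≤g ∘ there))

  sum-map-const : ∀ {A : Set} c (xs : List A) → sum (map (λ _ → c) xs) ≡ length xs * c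
  sum-map-const c [] = refl
  sum-map-const c (x ∷ xs) = cong (c +_) (sum-map-const c xs)

  length-concatMap : ∀ {A B : Set} (f : A → List B) xs →
                     length (concatMap f xs) ≡ sum (map (length ∘ f) xs)
  length-concatMap f [] = refl
  length-concatMap f (x ∷ xs) = trans (length-++ (f x)) (cong (length (f x) +_) (length-concatMap f xs))

  length-cartesianProduct : ∀ {A B : Set} (xs : List A) (ys : List B) →
                            length (cartesianProduct xs ys) ≡ length xs * length ys
  length-cartesianProduct [] ys = refl
  length-cartesianProduct (x ∷ xs) ys = trans (length-++ (map (x ,_) ys))
    (cong₂ _+_ (length-map (x ,_) ys) (length-cartesianProduct xs ys))

  -- The larger bound is used only at entries that lie in `ys`, and `xs` has at most `length ys` of
  -- those since it has no repetitions.
  sum-map-exceptions : ∀ {A : Set} (_≟_ : DecidableEquality A) (f : A → ℕ) (b d : ℕ) {xs : List A} →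
    Unique xs → ∀ ys → (∀ {x} → x ∈ xs → x ∉ ys → f x ≤ b) → (∀ {x} → x ∈ xs → f x ≤ b + d) →
    sum (map f xs) ≤ length xs * b + length ys * d
  sum-map-exceptions {A} _≟_ f b d {xs} xs! ys small large = begin
    sum (map f xs)                          ≤⟨ split xs small large ⟩
    length xs * b + length (filter (_∈? ys) xs) * d
      ≤⟨ +-monoʳ-≤ (length xs * b) (*-monoˡ-≤ d
           (unique-⊆-length (Unique.filter⁺ (_∈? ys) xs!) (proj₂ ∘ ∈-filter⁻ (_∈? ys) {xs = xs}))) ⟩
    length xs * b + length ys * d           ∎
    where
    open ≤-Reasoning
    open import Data.List.Membership.DecPropositional _≟_ using (_∈?_)
    split : ∀ zs → (∀ {x} → x ∈ zs → x ∉ ys → f x ≤ b) → (∀ {x} → x ∈ zs → f x ≤ b + d) →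
            sum (map f zs) ≤ length zs * b + length (filter (_∈? ys) zs) * d
    split [] _ _ = z≤n
    split (z ∷ zs) s l with z ∈? ys
    ... | no z∉ys = ≤-trans (+-mono-≤ (s (here refl) z∉ys) (split zs (s ∘ there) (l ∘ there)))
                      (≤-reflexive (sym (+-assoc b _ _)))
    ... | yes _ = ≤-trans (+-mono-≤ (l (here refl)) (split zs (s ∘ there) (l ∘ there)))
                    (≤-reflexive (interchange b d _ _))
      where
      interchange : ∀ a b c d → a + b + (c + d) ≡ a + c + (b + d)
      interchange = solve-∀

  module Difference {V : Set} (_≟_ : DecidableEquality V) where
    open import Data.List.Membership.DecPropositional _≟_ using (_∈?_; _∉?_)

    infixl 6 _∖_
    abstract
      _∖_ : List V → List V → List V
      A ∖ L = filter (_∉? L) A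

      ∈-∖⁺ : ∀ {A L : List V} {x : V} → x ∈ A → x ∉ L → x ∈ A ∖ L
      ∈-∖⁺ {L = L} = ∈-filter⁺ (_∉? L)

      ∈-∖⁻ : ∀ {A L : List V} {x : V} → x ∈ A ∖ L → x ∈ A × x ∉ L
      ∈-∖⁻ {L = L} = ∈-filter⁻ (_∉? L)

      ∖-unique : ∀ {A} L → Unique A → Unique (A ∖ L)
      ∖-unique L = Unique.filter⁺ (_∉? L)

      length-∖ : ∀ {A} L → Unique A → length A ≤ length (A ∖ L) + length L
      length-∖ {A} L A! = begin
        length A                                   ≡⟨ length-filter-∁ (_∈? L) A ⟨
        length (filter (_∈? L) A) + length (A ∖ L) ≤⟨ +-monoˡ-≤ _ (unique-⊆-length (Unique.filter⁺ (_∈? L) A!) (proj₂ ∘ ∈-filter⁻ (_∈? L) {xs = A})) ⟩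
        length L + length (A ∖ L)                  ≡⟨ +-comm (length L) _ ⟩
        length (A ∖ L) + length L                  ∎
        where open ≤-Reasoning

      length-∖-exact : ∀ {A} L → Unique A → Unique L → L ⊆ A → length (A ∖ L) + length L ≡ length A
      length-∖-exact {A} L A! L! L⊆A = ≤-antisym (begin
        length (A ∖ L) + length L                  ≡⟨ +-comm _ (length L) ⟩
        length L + length (A ∖ L)                  ≤⟨ +-monoˡ-≤ _ (unique-⊆-length L! λ x∈L → ∈-filter⁺ (_∈? L) (L⊆A x∈L) x∈L) ⟩
        length (filter (_∈? L) A) + length (A ∖ L) ≡⟨ length-filter-∁ (_∈? L) A ⟩
        length A                                   ∎)
        (length-∖ L A!)
        where open ≤-Reasoning

    avoid : ∀ {A} L → Unique A → length L < length A → ∃[ x ] (x ∈ A × x ∉ L)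
    avoid {A} L A! L<A with A ∖ L in eq | length-∖ L A!
    ... | [] | A≤L = contradiction A≤L (<⇒≱ L<A)
    ... | x ∷ _ | _ = x , ∈-∖⁻ (subst (x ∈_) (sym eq) (here refl))

-- The induction steps of the two counting bounds

module RecursionArithmetic where
  open import Data.Nat hiding (_≟_)
  open import Data.Nat.Properties hiding (_≟_)
  open import Data.Nat.Tactic.RingSolver using (solve-∀)

  open ≤-Reasoning

  -- The induction steps from p to p + 2 vertices: a is the sum of the counts over
  -- all choices, N the number of choices at a clean vertex (at least this number
  -- in the lower bounds), and Y the weight after a good choice.
  upper-clean : ∀ {a p N R K G} .{{_ : NonZero p}} → p + 2 ≤ 2 * N →
    a * p + N * (R * (K + G)) ≤ R * (N * p + N * K + G) →
    a * (p + 2) + R * N * (K + G) ≤ R * N * (p + 2 + K)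
  upper-clean {a} {p} {N} {R} {K} {G} m≤2N hyp = *-cancelˡ-≤ p (+-cancelʳ-≤ (2 * (R * N * (K + G))) _ _ (begin
    p * (a * (p + 2) + R * N * (K + G)) + 2 * (R * N * (K + G)) ≡⟨ e₁ a p N R K G ⟩
    (p + 2) * (a * p + N * (R * (K + G)))                       ≤⟨ *-monoʳ-≤ (p + 2) hyp ⟩
    (p + 2) * (R * (N * p + N * K + G))                         ≡⟨ e₂ p N R K G ⟩
    R * ((p + 2) * (N * p + N * K)) + R * ((p + 2) * G)
      ≤⟨ +-monoʳ-≤ (R * ((p + 2) * (N * p + N * K))) (*-monoʳ-≤ R (*-monoˡ-≤ G m≤2N)) ⟩
    R * ((p + 2) * (N * p + N * K)) + R * (2 * N * G)           ≡⟨ e₃ p N R K G ⟩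
    p * (R * N * (p + 2 + K)) + 2 * (R * N * (K + G))           ∎))
    where
    e₁ : ∀ a p N R K G → p * (a * (p + 2) + R * N * (K + G)) + 2 * (R * N * (K + G)) ≡
                         (p + 2) * (a * p + N * (R * (K + G)))
    e₁ = solve-∀
    e₂ : ∀ p N R K G → (p + 2) * (R * (N * p + N * K + G)) ≡
                       R * ((p + 2) * (N * p + N * K)) + R * ((p + 2) * G)
    e₂ = solve-∀
    e₃ : ∀ p N R K G → R * ((p + 2) * (N * p + N * K)) + R * (2 * N * G) ≡
                       p * (R * N * (p + 2 + K)) + 2 * (R * N * (K + G))
    e₃ = solve-∀

  -- Divided by R N p, the hypothesis reads a / (R N) ≥ 1 + G (1 - 1/N) / p, and G (1 - 1/N) / p ≥ G
  -- / (p + 2) follows from p + 2 ≤ 2 N. The upper bound is the mirror image of this.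
  lower-clean : ∀ {a p N R K G} .{{_ : NonZero p}} → p + 2 ≤ 2 * N →
    N * (R * (p + (K + G))) ≤ a * p + R * (N * K + G) →
    R * N * (p + 2 + (K + G)) ≤ a * (p + 2) + R * N * K
  lower-clean {a} {p} {N} {R} {K} {G} m≤2N hyp = *-cancelˡ-≤ p (+-cancelʳ-≤ (2 * (R * N * (K + G))) _ _ (begin
    p * (R * N * (p + 2 + (K + G))) + 2 * (R * N * (K + G)) ≡⟨ e₁ p N R K G ⟩
    (p + 2) * (N * (R * (p + (K + G))))                     ≤⟨ *-monoʳ-≤ (p + 2) hyp ⟩
    (p + 2) * (a * p + R * (N * K + G))                     ≡⟨ e₂ a p N R K G ⟩
    (p + 2) * (a * p + R * (N * K)) + R * ((p + 2) * G)
      ≤⟨ +-monoʳ-≤ ((p + 2) * (a * p + R * (N * K))) (*-monoʳ-≤ R (*-monoˡ-≤ G m≤2N)) ⟩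
    (p + 2) * (a * p + R * (N * K)) + R * (2 * N * G)       ≡⟨ e₃ a p N R K G ⟩
    p * (a * (p + 2) + R * N * K) + 2 * (R * N * (K + G))   ∎))
    where
    e₁ : ∀ p N R K G → p * (R * N * (p + 2 + (K + G))) + 2 * (R * N * (K + G)) ≡
                       (p + 2) * (N * (R * (p + (K + G))))
    e₁ = solve-∀
    e₂ : ∀ a p N R K G → (p + 2) * (a * p + R * (N * K + G)) ≡
                         (p + 2) * (a * p + R * (N * K)) + R * ((p + 2) * G)
    e₂ = solve-∀
    e₃ : ∀ a p N R K G → (p + 2) * (a * p + R * (N * K)) + R * (2 * N * G) ≡
                         p * (a * (p + 2) + R * N * K) + 2 * (R * N * (K + G))
    e₃ = solve-∀

  private
    m²≤4pN : ∀ {m p N} → m ≤ 2 * N → m ≤ 2 * p → m * m ≤ 4 * (p * N)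
    m²≤4pN {m} {p} {N} m≤2N m≤2p = begin
      m * m             ≤⟨ *-mono-≤ m≤2p m≤2N ⟩
      2 * p * (2 * N)   ≡⟨ e₀ p N ⟩
      4 * (p * N)       ∎
      where
      e₀ : ∀ p N → 2 * p * (2 * N) ≡ 4 * (p * N)
      e₀ = solve-∀

  -- The penalty is 32 Y before the choice and Y after a good one. The surplus covers, in units of
  -- m² Y with m = p + 2: one for the K extra choices, two for the step from p + 2 to p, one for the
  -- penalty Y after each choice and one for the bad choices. These five units are at most 20 p N Y.
  -- Writing p = E + r avoids subtracting E.
  upper-dirty : ∀ {a E r N R K G L Y} (let p = E + r) .{{_ : NonZero p}} →
    p + 2 ≤ 2 * N → p + 2 ≤ 2 * p → N + K ≡ p + 2 → 1 ≤ Y → K ≤ Y → G ≤ (p + 2) * Y → L ≤ p + 2 →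
    a * p + L * (R * E) ≤ R * (L * p + L * Y + G) →
    a * (p + 2) + R * N * E ≤ R * N * (p + 2 + 32 * Y)
  upper-dirty {a} {E} {r} {N} {R} {K} {G} {L} {Y} m≤2N m≤2p N+K≡m 1≤Y K≤Y G≤mY L≤m hyp = begin
    a * m + R * N * E                             ≤⟨ +-monoˡ-≤ (R * N * E) (*-cancelˡ-≤ p main) ⟩
    R * N * (r + 2 + 32 * Y) + R * N * E          ≡⟨ e₆ R N E r Y ⟩
    R * N * (p + 2 + 32 * Y)                      ∎
    where
    p = E + r
    m = p + 2
    e₆ : ∀ R N E r Y → R * N * (r + 2 + 32 * Y) + R * N * E ≡ R * N * (E + r + 2 + 32 * Y)
    e₆ = solve-∀
    e₁ : ∀ R L E r Y G → R * (L * (E + r) + L * Y + G) ≡ R * (L * (r + Y) + G) + L * (R * E)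
    e₁ = solve-∀
    ap : a * p ≤ R * (L * (r + Y) + G)
    ap = +-cancelʳ-≤ (L * (R * E)) _ _ (≤-trans hyp (≤-reflexive (e₁ R L E r Y G)))
    e₂ : ∀ a p m → p * (a * m) ≡ m * (a * p)
    e₂ = solve-∀
    e₃ : ∀ m R r Y → m * (R * (m * (r + Y) + m * Y)) ≡ R * (m * m * r + 2 * (m * m * Y))
    e₃ = solve-∀
    e₄ : ∀ p N K m r → p * (N + K) * r + 2 * m * r ≡ p * N * r + (p * K * r + 2 * (m * r))
    e₄ = solve-∀
    e₅ : ∀ p m → (p + 2) * m ≡ p * m + 2 * m
    e₅ = solve-∀
    r≤m : r ≤ m
    r≤m = ≤-trans (m≤n+m r E) (m≤m+n p 2)
    m≤mY : m ≤ m * Y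
    m≤mY = ≤-trans (≤-reflexive (sym (*-identityʳ m))) (*-monoʳ-≤ m 1≤Y)
    e₇ : ∀ m Y → m * Y * m + 2 * (m * Y * m) ≡ 3 * (m * m * Y)
    e₇ = solve-∀
    mmr : m * m * r ≤ p * N * r + 3 * (m * m * Y)
    mmr = begin
      m * m * r                                   ≡⟨ cong (_* r) (e₅ p m) ⟩
      (p * m + 2 * m) * r                         ≡⟨ *-distribʳ-+ r (p * m) (2 * m) ⟩
      p * m * r + 2 * m * r                       ≡⟨ cong (λ t → p * t * r + 2 * m * r) (sym N+K≡m) ⟩
      p * (N + K) * r + 2 * m * r                 ≡⟨ e₄ p N K m r ⟩
      p * N * r + (p * K * r + 2 * (m * r))       ≤⟨ +-monoʳ-≤ (p * N * r) (+-mono-≤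
         (*-mono-≤ (*-mono-≤ (m≤m+n p 2) K≤Y) r≤m) (*-monoʳ-≤ 2 (*-mono-≤ m≤mY r≤m))) ⟩
      p * N * r + (m * Y * m + 2 * (m * Y * m))   ≡⟨ cong (p * N * r +_) (e₇ m Y) ⟩
      p * N * r + 3 * (m * m * Y)                 ∎
    e₈ : ∀ a b → a + 3 * b + 2 * b ≡ a + 5 * b
    e₈ = solve-∀
    e₉ : ∀ p N r Y → p * N * r + 5 * (4 * (p * N) * Y) + (2 * (p * N) + 12 * (p * N * Y)) ≡ p * N * (r + 2 + 32 * Y)
    e₉ = solve-∀
    e₁₀ : ∀ R p N t → R * (p * N * t) ≡ p * (R * N * t)
    e₁₀ = solve-∀
    main : p * (a * m) ≤ p * (R * N * (r + 2 + 32 * Y))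
    main = begin
      p * (a * m)                                 ≡⟨ e₂ a p m ⟩
      m * (a * p)                                 ≤⟨ *-monoʳ-≤ m ap ⟩
      m * (R * (L * (r + Y) + G))                 ≤⟨ *-monoʳ-≤ m (*-monoʳ-≤ R (+-mono-≤ (*-monoˡ-≤ (r + Y) L≤m) G≤mY)) ⟩
      m * (R * (m * (r + Y) + m * Y))             ≡⟨ e₃ m R r Y ⟩
      R * (m * m * r + 2 * (m * m * Y))           ≤⟨ *-monoʳ-≤ R (+-monoˡ-≤ (2 * (m * m * Y)) mmr) ⟩
      R * (p * N * r + 3 * (m * m * Y) + 2 * (m * m * Y))
                                                  ≡⟨ cong (R *_) (e₈ (p * N * r) (m * m * Y)) ⟩
      R * (p * N * r + 5 * (m * m * Y))           ≤⟨ *-monoʳ-≤ R (+-monoʳ-≤ (p * N * r) (*-monoʳ-≤ 5 (*-monoˡ-≤ Y (m²≤4pN {p = p} {N} m≤2N m≤2p)))) ⟩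
      R * (p * N * r + 5 * (4 * (p * N) * Y))     ≤⟨ *-monoʳ-≤ R (m≤m+n _ _) ⟩
      R * (p * N * r + 5 * (4 * (p * N) * Y) + (2 * (p * N) + 12 * (p * N * Y)))
                                                  ≡⟨ cong (R *_) (e₉ p N r Y) ⟩
      R * (p * N * (r + 2 + 32 * Y))              ≡⟨ e₁₀ R p N (r + 2 + 32 * Y) ⟩
      p * (R * N * (r + 2 + 32 * Y))              ∎

  -- That there are at least N choices helps only if the bound for a single choice is nonnegative,
  -- that is, if Y ≤ p + E. Otherwise the penalty 32 Y on the right is enough by itself.
  lower-dirty : ∀ {a p E N R G L Y} .{{_ : NonZero p}} →
    p + 2 ≤ 2 * N → p + 2 ≤ 2 * p → 1 ≤ Y → G ≤ (p + 2) * Y → N ≤ L →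
    L * (R * (p + E)) ≤ a * p + R * (L * Y + G) →
    R * N * (p + 2 + E) ≤ a * (p + 2) + R * N * (32 * Y)
  lower-dirty {a} {p} {E} {N} {R} {G} {L} {Y} m≤2N m≤2p 1≤Y G≤mY N≤L hyp with ≤-total (p + E) Y
  ... | inj₁ p+E≤Y = ≤-trans (*-monoʳ-≤ (R * N) small) (m≤n+m _ (a * (p + 2)))
    where
    e₁ : ∀ p E → p + 2 + E ≡ p + E + 2 * 1
    e₁ = solve-∀
    e₂ : ∀ Y → Y + 2 * Y + 29 * Y ≡ 32 * Y
    e₂ = solve-∀
    small : p + 2 + E ≤ 32 * Y
    small = begin
      p + 2 + E             ≡⟨ e₁ p E ⟩
      p + E + 2 * 1         ≤⟨ +-mono-≤ p+E≤Y (*-monoʳ-≤ 2 1≤Y) ⟩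
      Y + 2 * Y             ≤⟨ m≤m+n _ (29 * Y) ⟩
      Y + 2 * Y + 29 * Y    ≡⟨ e₂ Y ⟩
      32 * Y                ∎
  ... | inj₂ Y≤p+E with r , p+E≡Y+r ← m≤n⇒∃[o]m+o≡n Y≤p+E = *-cancelˡ-≤ p (begin
      p * (R * N * (m + E))                       ≡⟨ e₁ p R N E ⟩
      R * (p * N * (p + E + 2))                   ≡⟨ cong (λ t → R * (p * N * (t + 2))) p+E≡Y+r ⟨
      R * (p * N * (Y + r + 2))                   ≡⟨ e₂ R p N Y r ⟩
      p * (N * (R * r)) + R * (p * N * Y + 2 * (p * N * 1))
        ≤⟨ +-mono-≤ (*-mono-≤ (m≤m+n p 2) NRr) (*-monoʳ-≤ R (+-monoʳ-≤ (p * N * Y) (*-monoʳ-≤ 2 (*-monoʳ-≤ (p * N) 1≤Y)))) ⟩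
      m * (a * p + R * (m * Y)) + R * (p * N * Y + 2 * (p * N * Y))
                                                  ≡⟨ e₃ m a p R N Y ⟩
      p * (a * m) + R * (m * m * Y + 3 * (p * N * Y))
        ≤⟨ +-monoʳ-≤ (p * (a * m)) (*-monoʳ-≤ R (+-monoˡ-≤ (3 * (p * N * Y)) (*-monoˡ-≤ Y (m²≤4pN {p = p} {N} m≤2N m≤2p)))) ⟩
      p * (a * m) + R * (4 * (p * N) * Y + 3 * (p * N * Y))
        ≤⟨ +-monoʳ-≤ (p * (a * m)) (*-monoʳ-≤ R (m≤m+n _ (25 * (p * N * Y)))) ⟩
      p * (a * m) + R * (4 * (p * N) * Y + 3 * (p * N * Y) + 25 * (p * N * Y))
                                                  ≡⟨ e₄ p a m R N Y ⟩
      p * (a * m + R * N * (32 * Y))              ∎)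
    where
    m = p + 2
    e₁ : ∀ p R N E → p * (R * N * (p + 2 + E)) ≡ R * (p * N * (p + E + 2))
    e₁ = solve-∀
    e₂ : ∀ R p N Y r → R * (p * N * (Y + r + 2)) ≡ p * (N * (R * r)) + R * (p * N * Y + 2 * (p * N * 1))
    e₂ = solve-∀
    e₃ : ∀ m a p R N Y → m * (a * p + R * (m * Y)) + R * (p * N * Y + 2 * (p * N * Y)) ≡
                         p * (a * m) + R * (m * m * Y + 3 * (p * N * Y))
    e₃ = solve-∀
    e₄ : ∀ p a m R N Y → p * (a * m) + R * (4 * (p * N) * Y + 3 * (p * N * Y) + 25 * (p * N * Y)) ≡
                         p * (a * m + R * N * (32 * Y))
    e₄ = solve-∀
    e₅ : ∀ L R Y r → L * (R * (Y + r)) ≡ L * (R * r) + R * (L * Y)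
    e₅ = solve-∀
    e₆ : ∀ a p R L Y G → a * p + R * (L * Y + G) ≡ a * p + R * G + R * (L * Y)
    e₆ = solve-∀
    NRr : N * (R * r) ≤ a * p + R * (m * Y)
    NRr = begin
      N * (R * r)                ≤⟨ *-monoˡ-≤ (R * r) N≤L ⟩
      L * (R * r)                ≤⟨ +-cancelʳ-≤ (R * (L * Y)) _ _ (begin
        L * (R * r) + R * (L * Y)      ≡⟨ e₅ L R Y r ⟨
        L * (R * (Y + r))              ≡⟨ cong (λ t → L * (R * t)) p+E≡Y+r ⟩
        L * (R * (p + E))              ≤⟨ hyp ⟩
        a * p + R * (L * Y + G)        ≡⟨ e₆ a p R L Y G ⟩
        a * p + R * G + R * (L * Y)    ∎) ⟩
      a * p + R * G              ≤⟨ +-monoʳ-≤ (a * p) (*-monoʳ-≤ R G≤mY) ⟩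
      a * p + R * (m * Y)        ∎

-- Constants of the recursion and of the existence proof

module Constants where
  open import Data.Nat hiding (_≟_)
  open import Data.Nat.Properties hiding (_≟_)
  open import Data.Nat.Tactic.RingSolver using (solve-∀)

  -- Every vertex left is counted as a possible partner. The crude bound does no harm, as it serves
  -- only at the bottom of the recursion, where the size is constant.
  enumBound : ℕ → ℕ
  enumBound zero    = 1
  enumBound (suc h) = 2 * suc (suc h) * enumBound h

  -- The size of `star` and `bad` together: the vertices to avoid for a legal choice that makes no
  -- vertex dirty.
  dirtyBound : ℕ → ℕ
  dirtyBound k = suc k + (k * k + k * k)

  module Weights (k : ℕ) where
    -- D bounds the number of partners whose choice creates dirty vertices and T the
    -- factor by which the weight then grows; the base 32 leaves room for the constants
    -- in RecursionArithmetic.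
    D T K G E : ℕ
    D = k * k + k * k
    T = 32 ^ (k + k)
    K = suc k
    G = D * (K * T)
    E = K + G

    -- The penalty for c dirty vertices. The factor `K` makes every penalty at least as large as the
    -- number, up to `K`, of choices that a dirty vertex may have beyond `N`. With it, `G` bounds
    -- what the `D` bad choices at a clean vertex add to the total penalty.
    weight : ℕ → ℕ
    weight c = K * 32 ^ c

    weight-mono : ∀ {c c′} → c ≤ c′ → weight c ≤ weight c′
    weight-mono c≤c′ = *-monoʳ-≤ K (^-monoʳ-≤ 32 c≤c′)

    K≤weight : ∀ c → K ≤ weight c
    K≤weight c = subst (_≤ weight c) (*-identityʳ K) (weight-mono {0} {c} z≤n)

    weight-+ : ∀ c → weight (c + (k + k)) ≡ weight c * T
    weight-+ c = trans (cong (K *_) (^-distribˡ-+-* 32 c (k + k))) (sym (*-assoc K (32 ^ c) T))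

    weight-suc : ∀ c → weight (suc c) ≡ 32 * weight c
    weight-suc c = e₀ K (32 ^ c)
      where
      e₀ : ∀ a b → a * (32 * b) ≡ 32 * (a * b)
      e₀ = solve-∀

    -- With m d vertices left, a vertex that is not dirty has N d admissible partners.
    module Sizes (h₁ : ℕ) (large : E + D * T + 2 ≤ h₁) where
      h₀ : ℕ
      h₀ = k + h₁

      m N P : ℕ → ℕ
      m d = 2 * suc (d + h₀)
      N d = 2 * d + (2 * h₁ + K)
      P zero    = 1
      P (suc d) = N (suc d) * P d

      N+K≡m : ∀ d → N d + K ≡ m d
      N+K≡m d = e₀ d h₁ k
        where
        e₀ : ∀ d h k → 2 * d + (2 * h + suc k) + suc k ≡ 2 * suc (d + (k + h))
        e₀ = solve-∀

      m-suc : ∀ d → m (suc d) ≡ m d + 2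
      m-suc d = trans (*-suc 2 (suc (d + h₀))) (+-comm 2 _)

      h₁≤m : ∀ d → h₁ ≤ m d
      h₁≤m d = ≤-trans (≤-trans (m≤n+m h₁ k) (m≤n+m h₀ d)) (≤-trans (n≤1+n _) (m≤m+n (suc (d + h₀)) _))

      E≤m : ∀ d → E ≤ m d
      E≤m d = ≤-trans (≤-trans (≤-trans (m≤m+n E (D * T)) (m≤m+n _ 2)) large) (h₁≤m d)

      DT≤m : ∀ d → D * T ≤ m d
      DT≤m d = ≤-trans (≤-trans (≤-trans (m≤n+m (D * T) E) (m≤m+n _ 2)) large) (h₁≤m d)

      2≤m : ∀ d → 2 ≤ m d
      2≤m d = ≤-trans (≤-trans (m≤n+m 2 (E + D * T)) large) (h₁≤m d)

      m≤2N : ∀ d → m d + 2 ≤ 2 * N (suc d)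
      m≤2N d = begin
        m d + 2                   ≡⟨ m-suc d ⟨
        m (suc d)                 ≡⟨ N+K≡m (suc d) ⟨
        N (suc d) + K             ≤⟨ +-monoʳ-≤ (N (suc d)) (≤-trans (m≤n+m K (2 * h₁)) (m≤n+m _ (2 * suc d))) ⟩
        N (suc d) + N (suc d)     ≡⟨ cong (N (suc d) +_) (+-identityʳ (N (suc d))) ⟨
        2 * N (suc d)             ∎
        where open ≤-Reasoning

      m≤2m : ∀ d → m d + 2 ≤ 2 * m d
      m≤2m d = ≤-trans (+-monoʳ-≤ (m d) (2≤m d)) (≤-reflexive (cong (m d +_) (sym (+-identityʳ (m d)))))

      exceptional-weight : ∀ d Y → D * (Y * T) ≤ (m d + 2) * Y
      exceptional-weight d Y = begin
        D * (Y * T)       ≡⟨ e₀ D Y T ⟩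
        D * T * Y         ≤⟨ *-monoˡ-≤ Y (≤-trans (DT≤m d) (m≤m+n (m d) 2)) ⟩
        (m d + 2) * Y     ∎
        where
        open ≤-Reasoning
        e₀ : ∀ a b c → a * (b * c) ≡ a * c * b
        e₀ = solve-∀

      -- Both make d = 0 work. As E < m 0, already Q (m 0 - E) is at least the trivial bound times m
      -- 0; and S is the value of m + E there, so that a single completion suffices for the lower
      -- bound.
      Q S : ℕ
      Q = enumBound h₀ * m 0
      S = m 0 + E

  -- The sizes needed to get rid of one of κ + 2 colours, if M suffices for κ + 1.
  module MergeSizes (κ M : ℕ) where
    k exclusions rest needed b c room : ℕ
    k = suc (suc κ)
    exclusions = suc k + (suc k + (k * k + k * k))

    -- A round uses up two pairs of vertices and makes at most 4 (κ + 1) vertices dirty for the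
    -- colours that are kept.
    rounds : ℕ → ℕ
    rounds u = u * (4 * suc κ + 2)

    -- More than `rest` vertices cannot all lie in one star or in one bad set of the kept colours.
    -- `needed` is what `merge-all` asks for when at most `rest` vertices are unmerged and at most
    -- `rest` are dirty, `b` is a number of helper pairs exceeding it, `c` bounds the dirty vertices
    -- made by `b` gadgets, and `room` is the size of a ball of radius 8 around these, all helpers
    -- and one more vertex.
    rest = suc k + (suc κ * suc κ + suc κ * suc κ)
    needed = M + rest + dirtyBound (suc κ) + rounds rest + exclusions
    b = suc needed
    c = 4 * k * b
    room = suc k ^ 8 * suc (c + 2 * b)

  -- The summand `2 * b` is there because each of the `b` gadgets uses up two pairs of vertices.
  solvableSize : ℕ → ℕ
  solvableSize zero          = 0
  solvableSize (suc zero)    = 0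
  solvableSize (suc (suc κ)) = room + 2 * b
    where open MergeSizes κ (solvableSize (suc κ))

-- Contracting matchings along a chosen edge

module Contraction {V : Set} (_≟_ : DecidableEquality V) where
  open import Data.Nat hiding (_≟_)
  open import Data.Nat.Properties hiding (_≟_)
  open import Data.Nat.Tactic.RingSolver using (solve-∀)
  open import Data.Nat.ListAction using (sum)
  open ListCounting
  open Difference _≟_
  open RecursionArithmetic
  open Constants

  -- A perfect matching on `A` is an involution without fixed points. Its values outside `A` are
  -- arbitrary, so vertices are removed by shrinking `A` alone, and two matchings are compared on
  -- `A` only.
  record Matching (A : List V) (f : V → V) : Set where
    field
      closed : ∀ {x} → x ∈ A → f x ∈ A
      irrefl : ∀ {x} → x ∈ A → f x ≢ x
      invol  : ∀ {x} → x ∈ A → f (f x) ≡ x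

    injective : ∀ {x y} → x ∈ A → y ∈ A → f x ≡ f y → x ≡ y
    injective x∈A y∈A fx≡fy = trans (sym (invol x∈A)) (trans (cong f fx≡fy) (invol y∈A))

    swap : ∀ {x y} → x ∈ A → f x ≡ y → f y ≡ x
    swap x∈A refl = invol x∈A

  open Matching

  -- The matching that remains of f when v and w become joined by a path of
  -- edges that has to be traversed: the partners of v and w are matched.
  abstract
    fuse : V → V → (V → V) → V → V
    fuse v w f x with f x ≟ v | f x ≟ w
    ... | yes _ | _     = f w
    ... | no _  | yes _ = f v
    ... | no _  | no _  = f x

  data Fused (v w : V) (f : V → V) (x : V) : V → Set where
    at-v  : f x ≡ v → Fused v w f x (f w)
    at-w  : f x ≡ w → Fused v w f x (f v)
    other : f x ≢ v → f x ≢ w → Fused v w f x (f x)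

  abstract
    fused : ∀ v w f x → Fused v w f x (fuse v w f x)
    fused v w f x with f x ≟ v | f x ≟ w
    ... | yes p | _     = at-v p
    ... | no _  | yes p = at-w p
    ... | no p  | no q  = other p q

    fuse-v : ∀ {v w f x} → f x ≡ v → fuse v w f x ≡ f w
    fuse-v {v} {w} {f} {x} p with f x ≟ v
    ... | yes _ = refl
    ... | no ¬p = contradiction p ¬p

    fuse-w : ∀ {v w f x} → v ≢ w → f x ≡ w → fuse v w f x ≡ f v
    fuse-w {v} {w} {f} {x} v≢w p with f x ≟ v | f x ≟ w
    ... | yes q | _ = contradiction (trans (sym q) p) v≢w
    ... | no _ | yes _ = refl
    ... | no _ | no ¬p = contradiction p ¬p

    fuse-other : ∀ {v w f x} → f x ≢ v → f x ≢ w → fuse v w f x ≡ f x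
    fuse-other {v} {w} {f} {x} p q with f x ≟ v | f x ≟ w
    ... | yes r | _ = contradiction r p
    ... | no _ | yes r = contradiction r q
    ... | no _ | no _ = refl

  abstract
    del : V → V → List V → List V
    del v w A = A ∖ (v ∷ w ∷ [])

    ∈-del⁺ : ∀ {v w A x} → x ∈ A → x ≢ v → x ≢ w → x ∈ del v w A
    ∈-del⁺ x∈A x≢v x≢w = ∈-∖⁺ x∈A λ { (here p) → x≢v p ; (there (here p)) → x≢w p }

    ∈-del⁻ : ∀ {v w A x} → x ∈ del v w A → x ∈ A × x ≢ v × x ≢ w
    ∈-del⁻ {A = A} p with ∈-∖⁻ {A = A} p
    ... | x∈A , x∉ = x∈A , (x∉ ∘ here) , (x∉ ∘ there ∘ here)

    del-unique : ∀ {v w A} → Unique A → Unique (del v w A)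
    del-unique {v} {w} = ∖-unique (v ∷ w ∷ [])

    length-del : ∀ {v w A} → Unique A → v ∈ A → w ∈ A → v ≢ w → length (del v w A) + 2 ≡ length A
    length-del {v} {w} A! v∈A w∈A v≢w = length-∖-exact (v ∷ w ∷ []) A! ((v≢w ∷ []) ∷ [] ∷ [])
      λ { (here refl) → v∈A ; (there (here refl)) → w∈A }

  extend : V → V → (V → V) → V → V
  extend v w g x with x ≟ v | x ≟ w
  ... | yes _ | _     = w
  ... | no _  | yes _ = v
  ... | no _  | no _  = g x

  extend-v : ∀ {v w g} → extend v w g v ≡ w
  extend-v {v} with v ≟ v
  ... | yes _ = refl
  ... | no ¬p = contradiction refl ¬p

  extend-w : ∀ {v w g} → v ≢ w → extend v w g w ≡ v
  extend-w {v} {w} v≢w with w ≟ v | w ≟ w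
  ... | yes p | _ = contradiction (sym p) v≢w
  ... | no _ | yes _ = refl
  ... | no _ | no ¬p = contradiction refl ¬p

  extend-other : ∀ {v w g x} → x ≢ v → x ≢ w → extend v w g x ≡ g x
  extend-other {v} {w} {g} {x} p q with x ≟ v | x ≟ w
  ... | yes r | _ = contradiction r p
  ... | no _ | yes r = contradiction r q
  ... | no _ | no _ = refl

  data Position (v w x : V) : Set where
    is-v  : x ≡ v → Position v w x
    is-w  : x ≡ w → Position v w x
    other : x ≢ v → x ≢ w → Position v w x

  position : ∀ v w x → Position v w x
  position v w x with x ≟ v | x ≟ w
  ... | yes p | _     = is-v p
  ... | no _  | yes p = is-w p
  ... | no p  | no q  = other p q

  -- The condition `f v ≢ w` keeps the partners of v and w among the remaining vertices; otherwise
  -- the edge vw would close a cycle with the edge of f.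
  fuse-matching : ∀ {A f v w} → Matching A f → v ∈ A → w ∈ A → v ≢ w → f v ≢ w →
                  Matching (del v w A) (fuse v w f)
  fuse-matching {A} {f} {v} {w} m v∈A w∈A v≢w fv≢w = record
    { closed = cl ; irrefl = irr ; invol = inv }
    where
    fw≢v : f w ≢ v
    fw≢v p = fv≢w (swap m w∈A p)

    cl : ∀ {x} → x ∈ del v w A → fuse v w f x ∈ del v w A
    cl {x} x∈ with ∈-del⁻ x∈ | fuse v w f x | fused v w f x
    ... | x∈A , x≢v , x≢w | _ | at-v p = ∈-del⁺ (closed m w∈A) fw≢v (irrefl m w∈A)
    ... | x∈A , x≢v , x≢w | _ | at-w p = ∈-del⁺ (closed m v∈A) (irrefl m v∈A) fv≢w
    ... | x∈A , x≢v , x≢w | _ | other p q = ∈-del⁺ (closed m x∈A) p q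

    irr : ∀ {x} → x ∈ del v w A → fuse v w f x ≢ x
    irr {x} x∈ with ∈-del⁻ x∈ | fuse v w f x | fused v w f x
    ... | x∈A , x≢v , x≢w | _ | at-v p = λ q → v≢w (trans (sym p) (trans (cong f (sym q)) (invol m w∈A)))
    ... | x∈A , x≢v , x≢w | _ | at-w p = λ q → v≢w (trans (sym (invol m v∈A)) (trans (cong f q) p))
    ... | x∈A , x≢v , x≢w | _ | other p q = irrefl m x∈A

    inv : ∀ {x} → x ∈ del v w A → fuse v w f (fuse v w f x) ≡ x
    inv {x} x∈ with ∈-del⁻ x∈ | fuse v w f x | fused v w f x
    ... | x∈A , x≢v , x≢w | _ | at-v p = trans (fuse-w v≢w (invol m w∈A)) (swap m x∈A p)
    ... | x∈A , x≢v , x≢w | _ | at-w p = trans (fuse-v (invol m v∈A)) (swap m x∈A p)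
    ... | x∈A , x≢v , x≢w | _ | other p q =
      trans (fuse-other (x≢v ∘ trans (sym (invol m x∈A))) (x≢w ∘ trans (sym (invol m x∈A)))) (invol m x∈A)

  extend-matching : ∀ {A g v w} → v ∈ A → w ∈ A → v ≢ w → Matching (del v w A) g →
                    Matching A (extend v w g)
  extend-matching {A} {g} {v} {w} v∈A w∈A v≢w m = record { closed = cl ; irrefl = irr ; invol = inv }
    where
    cl : ∀ {x} → x ∈ A → extend v w g x ∈ A
    cl {x} x∈A with x ≟ v | x ≟ w
    ... | yes _ | _ = w∈A
    ... | no _ | yes _ = v∈A
    ... | no p | no q = proj₁ (∈-del⁻ (closed m (∈-del⁺ x∈A p q)))
    irr : ∀ {x} → x ∈ A → extend v w g x ≢ x
    irr {x} x∈A with x ≟ v | x ≟ w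
    ... | yes refl | _ = v≢w ∘ sym
    ... | no _ | yes refl = v≢w
    ... | no p | no q = irrefl m (∈-del⁺ x∈A p q)
    inv : ∀ {x} → x ∈ A → extend v w g (extend v w g x) ≡ x
    inv {x} x∈A with position v w x
    ... | is-v refl = trans (cong (extend v w g) extend-v) (extend-w v≢w)
    ... | is-w refl = trans (cong (extend v w g) (extend-w v≢w)) extend-v
    ... | other p q with ∈-del⁻ (closed m (∈-del⁺ x∈A p q))
    ...   | _ , gx≢v , gx≢w = trans (cong (extend v w g) (extend-other p q))
                               (trans (extend-other gx≢v gx≢w) (invol m (∈-del⁺ x∈A p q)))

  restrict-matching : ∀ {A g v} → Matching A g → v ∈ A → Matching (del v (g v) A) g
  restrict-matching {A} {g} {v} m v∈A = record
    { closed = cl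
    ; irrefl = irrefl m ∘ proj₁ ∘ ∈-del⁻
    ; invol = invol m ∘ proj₁ ∘ ∈-del⁻ }
    where
    cl : ∀ {x} → x ∈ del v (g v) A → g x ∈ del v (g v) A
    cl x∈ with ∈-del⁻ x∈
    ... | x∈A , x≢v , x≢gv = ∈-del⁺ (closed m x∈A) (λ p → x≢gv (sym (swap m x∈A p)))
                                (λ p → x≢v (injective m x∈A v∈A p))

  -- The graph with edges from f and g is connected on A, in a form that is
  -- insensitive to the length of paths.
  Connected : List V → (V → V) → (V → V) → Set
  Connected A f g = ∀ (s : V → Bool) → (∀ {x} → x ∈ A → s (f x) ≡ s x) → (∀ {x} → x ∈ A → s (g x) ≡ s x) →
                    ∀ {x y} → x ∈ A → y ∈ A → s x ≡ s y

  -- A labelling that is constant along edges agrees at v and w, hence at both ends of the path f v,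
  -- v, w, f w, which `fuse` replaces by an edge.
  connected-extend : ∀ {A f g v w} → Matching A f → v ∈ A → w ∈ A → v ≢ w → f v ≢ w →
                     Connected (del v w A) (fuse v w f) g → Connected A f (extend v w g)
  connected-extend {A} {f} {g} {v} {w} m v∈A w∈A v≢w fv≢w con s sf sg = all-equal
    where
    fv∈ : f v ∈ del v w A
    fv∈ = ∈-del⁺ (closed m v∈A) (irrefl m v∈A) fv≢w
    s-vw : s v ≡ s w
    s-vw = trans (sym (sg v∈A)) (cong s extend-v)
    sf′ : ∀ {x} → x ∈ del v w A → s (fuse v w f x) ≡ s x
    sf′ {x} x∈ with ∈-del⁻ x∈ | fuse v w f x | fused v w f x
    ... | x∈A , _ , _ | _ | at-v p = trans (sf w∈A) (trans (sym s-vw) (trans (cong s (sym p)) (sf x∈A)))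
    ... | x∈A , _ , _ | _ | at-w p = trans (sf v∈A) (trans s-vw (trans (cong s (sym p)) (sf x∈A)))
    ... | x∈A , _ , _ | _ | other _ _ = sf x∈A
    sg′ : ∀ {x} → x ∈ del v w A → s (g x) ≡ s x
    sg′ x∈ with ∈-del⁻ x∈
    ... | x∈A , x≢v , x≢w = trans (cong s (sym (extend-other x≢v x≢w))) (sg x∈A)
    to-v : ∀ {x} → x ∈ A → s x ≡ s v
    to-v {x} x∈A with position v w x
    ... | is-v refl = refl
    ... | is-w refl = sym s-vw
    ... | other p q = trans (con s sf′ sg′ (∈-del⁺ x∈A p q) fv∈) (sf v∈A)
    all-equal : ∀ {x y} → x ∈ A → y ∈ A → s x ≡ s y
    all-equal x∈A y∈A = trans (to-v x∈A) (sym (to-v y∈A))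

  -- A labelling of the contracted graph extends to v and g v by its value at f v. This is also its
  -- value at the f-partner of g v, because fusing has matched these two.
  connected-restrict : ∀ {A f g v} → Matching A f → Matching A g → v ∈ A → f v ≢ g v →
                       Connected A f g → Connected (del v (g v) A) (fuse v (g v) f) g
  connected-restrict {A} {f} {g} {v} mf mg v∈A fv≢w con s sf sg {x} {y} x∈ y∈ = begin
    s x   ≡⟨ s⁺-other (proj₂ (∈-del⁻ x∈)) ⟨
    s⁺ x  ≡⟨ con s⁺ sf⁺ sg⁺ (proj₁ (∈-del⁻ x∈)) (proj₁ (∈-del⁻ y∈)) ⟩
    s⁺ y  ≡⟨ s⁺-other (proj₂ (∈-del⁻ y∈)) ⟩
    s y   ∎
    where
    open ≡-Reasoning
    w = g v
    w∈A = closed mg v∈A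
    v≢w : v ≢ w
    v≢w p = irrefl mg v∈A (sym p)
    fw≢v : f w ≢ v
    fw≢v p = fv≢w (swap mf w∈A p)
    fv∈ : f v ∈ del v w A
    fv∈ = ∈-del⁺ (closed mf v∈A) (irrefl mf v∈A) fv≢w
    ends : s (f w) ≡ s (f v)
    ends = trans (cong s (sym (fuse-v (invol mf v∈A)))) (sf fv∈)
    s⁺ : V → Bool
    s⁺ z with z ≟ v | z ≟ w
    ... | yes _ | _ = s (f v)
    ... | no _ | yes _ = s (f v)
    ... | no _ | no _ = s z
    s⁺-v : s⁺ v ≡ s (f v)
    s⁺-v with v ≟ v
    ... | yes _ = refl
    ... | no ¬p = contradiction refl ¬p
    s⁺-w : s⁺ w ≡ s (f v)
    s⁺-w with w ≟ v | w ≟ w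
    ... | yes _ | _ = refl
    ... | no _ | yes _ = refl
    ... | no _ | no ¬p = contradiction refl ¬p
    s⁺-other : ∀ {z} → z ≢ v × z ≢ w → s⁺ z ≡ s z
    s⁺-other {z} (p , q) with z ≟ v | z ≟ w
    ... | yes r | _ = contradiction r p
    ... | no _ | yes r = contradiction r q
    ... | no _ | no _ = refl
    sf⁺ : ∀ {z} → z ∈ A → s⁺ (f z) ≡ s⁺ z
    sf⁺ {z} z∈A with position v w z
    ... | is-v refl = trans (s⁺-other (irrefl mf v∈A , fv≢w)) (sym s⁺-v)
    ... | is-w refl = trans (s⁺-other (fw≢v , irrefl mf w∈A)) (trans ends (sym s⁺-w))
    ... | other p q with position v w (f z)
    ...   | is-v r = trans (cong s⁺ r) (trans s⁺-v (trans (cong s (swap mf z∈A r)) (sym (s⁺-other (p , q)))))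
    ...   | is-w r = trans (cong s⁺ r) (trans s⁺-w (trans (sym ends) (trans (cong s (swap mf z∈A r)) (sym (s⁺-other (p , q))))))
    ...   | other p′ q′ = trans (s⁺-other (p′ , q′)) (trans (cong s (sym (fuse-other p′ q′)))
                            (trans (sf (∈-del⁺ z∈A p q)) (sym (s⁺-other (p , q)))))
    sg⁺ : ∀ {z} → z ∈ A → s⁺ (g z) ≡ s⁺ z
    sg⁺ {z} z∈A with position v w z
    ... | is-v refl = trans s⁺-w (sym s⁺-v)
    ... | is-w refl = trans (cong s⁺ (invol mg v∈A)) (trans s⁺-v (sym s⁺-w))
    ... | other p q with ∈-del⁻ (closed (restrict-matching mg v∈A) (∈-del⁺ z∈A p q))
    ...   | _ , r = trans (s⁺-other r) (trans (sg (∈-del⁺ z∈A p q)) (sym (s⁺-other (p , q))))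

  -- An edge of both f and g is a component of its own.
  connected⇒disjoint : ∀ {A f g v z} → Matching A f → Matching A g → v ∈ A → Connected A f g →
                       z ∈ A → z ≢ v → z ≢ g v → f v ≢ g v
  connected⇒disjoint {A} {f} {g} {v} {z} mf mg v∈A con z∈A z≢v z≢w fv≡w =
    contradiction (trans (sym s-v) (trans (con s (inv mf fv≡w) (inv mg refl) v∈A z∈A) s-z)) λ ()
    where
    w = g v
    s : V → Bool
    s x with x ≟ v | x ≟ w
    ... | yes _ | _ = true
    ... | no _ | yes _ = true
    ... | no _ | no _ = false
    s-v : s v ≡ true
    s-v with v ≟ v
    ... | yes _ = refl
    ... | no ¬p = contradiction refl ¬p
    s-w : s w ≡ true
    s-w with w ≟ v | w ≟ w
    ... | yes _ | _ = refl
    ... | no _ | yes _ = refl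
    ... | no _ | no ¬p = contradiction refl ¬p
    s-other : ∀ {x} → x ≢ v → x ≢ w → s x ≡ false
    s-other {x} p q with x ≟ v | x ≟ w
    ... | yes r | _ = contradiction r p
    ... | no _ | yes r = contradiction r q
    ... | no _ | no _ = refl
    s-z = s-other z≢v z≢w
    inv : ∀ {h} → Matching A h → h v ≡ w → ∀ {x} → x ∈ A → s (h x) ≡ s x
    inv {h} m hv≡w {x} x∈A with position v w x
    ... | is-v refl = trans (cong s hv≡w) (trans s-w (sym s-v))
    ... | is-w refl = trans (cong s (swap m v∈A hv≡w)) (trans s-v (sym s-w))
    ... | other p q = trans (s-other (λ r → q (trans (sym (swap m x∈A r)) hv≡w))
                                     (λ r → p (trans (sym (swap m x∈A r)) (swap m v∈A hv≡w))))
                            (sym (s-other p q))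

  connected-pair : ∀ {A f g} → Matching A f → ∀ {x y} → A ≡ x ∷ y ∷ [] → Connected A f g
  connected-pair {A} {f} mf {x} {y} refl s sf sg = λ { (here refl) (here refl) → refl
                                            ; (here refl) (there (here refl)) → sym xy
                                            ; (there (here refl)) (here refl) → xy
                                            ; (there (here refl)) (there (here refl)) → refl }
    where
    xy : s y ≡ s x
    xy with closed mf (here refl)
    ... | here p = contradiction p (irrefl mf (here refl))
    ... | there (here p) = trans (cong s (sym p)) (sf (here refl))

  -- Enumeration of the good matchings

  Colouring : ℕ → Set
  Colouring k = Fin k → V → V

  IsColouring : ∀ {k} → List V → Colouring k → Set
  IsColouring A f = ∀ i → Matching A (f i)

  fuse* : ∀ {k} → V → V → Colouring k → Colouring k
  fuse* v w f i = fuse v w (f i)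

  length-del-suc : ∀ h {A v w} → Unique A → length A ≡ 2 * suc (suc h) → v ∈ A → w ∈ A → v ≢ w →
                   length (del v w A) ≡ 2 * suc h
  length-del-suc h A! eq v∈A w∈A v≢w = +-cancelʳ-≡ 2 _ _ (trans (length-del A! v∈A w∈A v≢w)
    (trans eq (trans (*-suc 2 (suc h)) (+-comm 2 _))))

  SameOn : List V → (V → V) → (V → V) → Set
  SameOn A g g′ = ∀ {x} → x ∈ A → g′ x ≡ g x

  Differ : List V → (V → V) → (V → V) → Set
  Differ A g g′ = ∃[ x ] (x ∈ A × g x ≢ g′ x)

  module _ {k : ℕ} where

    neighbours : Colouring k → V → List V
    neighbours f v = map (λ i → f i v) (allFin k)

    length-neighbours : ∀ f v → length (neighbours f v) ≡ k
    length-neighbours f v = trans (length-map _ (allFin k)) (length-tabulate {n = k} id)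

    ∈-neighbours : ∀ (f : Colouring k) v i → f i v ∈ neighbours f v
    ∈-neighbours f v i = ∈-map⁺ (λ i → f i v) (∈-allFin i)

    abstract
      -- The vertices that v cannot be matched to as long as other vertices remain: an edge shared
      -- with some colour would be a closed component.
      star : Colouring k → V → List V
      star f v = v ∷ neighbours f v

      star-def : ∀ f v → star f v ≡ v ∷ neighbours f v
      star-def f v = refl

      length-star : ∀ f v → length (star f v) ≡ suc k
      length-star f v = cong suc (length-neighbours f v)

      ∉-star⇒≢ : ∀ {f v w} → w ∉ star f v → v ≢ w
      ∉-star⇒≢ w∉ refl = w∉ (here refl)

      ∉-star⇒nonadjacent : ∀ {f v w} → w ∉ star f v → ∀ i → f i v ≢ w
      ∉-star⇒nonadjacent {f} {v} w∉ i refl = w∉ (there (∈-neighbours f v i))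

      ∉-star : ∀ {f : Colouring k} {v w} → v ≢ w → (∀ i → f i v ≢ w) → w ∉ star f v
      ∉-star p q (here r) = p (sym r)
      ∉-star {f} {v} p q (there r) with ∈-map⁻ (λ i → f i v) r
      ... | i , _ , refl = q i refl

    fuse*-colouring : ∀ {A} {f : Colouring k} {v w} → IsColouring A f → v ∈ A → w ∈ A → w ∉ star f v →
                      IsColouring (del v w A) (fuse* v w f)
    fuse*-colouring F v∈A w∈A w∉ i =
      fuse-matching (F i) v∈A w∈A (∉-star⇒≢ w∉) (∉-star⇒nonadjacent w∉ i)

    -- The union of two perfect matchings consists of closed alternating walks, so on at least three
    -- vertices it is a Hamilton cycle exactly if it is connected.
    Good : List V → Colouring k → (V → V) → Set
    Good A f g = Matching A g × (∀ i → Connected A (f i) g)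

    good-extend : ∀ {A f v w g} → IsColouring A f → v ∈ A → w ∈ A → w ∉ star f v →
                  Good (del v w A) (fuse* v w f) g → Good A f (extend v w g)
    good-extend {A} {f} {v} {w} {g} F v∈A w∈A w∉ (m , con) =
      extend-matching v∈A w∈A (∉-star⇒≢ w∉) m ,
      λ i → connected-extend (F i) v∈A w∈A (∉-star⇒≢ w∉) (∉-star⇒nonadjacent w∉ i) (con i)

    good-restrict : ∀ {A f v g} → IsColouring A f → v ∈ A → g v ∉ star f v → Good A f g →
                    Good (del v (g v) A) (fuse* v (g v) f) g
    good-restrict F v∈A w∉ (m , con) =
      restrict-matching m v∈A , λ i → connected-restrict (F i) m v∈A (∉-star⇒nonadjacent w∉ i) (con i)

    good⇒∉-star : ∀ {A f v g} → Unique A → 2 < length A → IsColouring A f → v ∈ A → Good A f g →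
                  g v ∉ star f v
    good⇒∉-star {A} {f} {v} {g} A! 2<A F v∈A (m , con)
      with z , z∈A , z∉ ← avoid (v ∷ g v ∷ []) A! 2<A =
      ∉-star (irrefl m v∈A ∘ sym) λ i → connected⇒disjoint (F i) m v∈A (con i) z∈A (z∉ ∘ here) (z∉ ∘ there ∘ here)

    Dirty : Colouring k → V → Set
    Dirty f x = ∃[ i ] ∃[ j ] (i ≢ j × f i x ≡ f j x)

    abstract
      dirty? : ∀ (f : Colouring k) x → Dec (Dirty f x)
      dirty? f x = Fin.any? λ i → Fin.any? λ j → ¬? (i Fin.≟ j) ×-dec (f i x ≟ f j x)

    dirties : Colouring k → List V → List V
    dirties f = filter (dirty? f)

    pick : Colouring k → V → List V → V
    pick f x xs with any? (dirty? f) (x ∷ xs)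
    ... | yes p = proj₁ (find p)
    ... | no _  = x

    pick-∈ : ∀ f x xs → pick f x xs ∈ x ∷ xs
    pick-∈ f x xs with any? (dirty? f) (x ∷ xs)
    ... | yes p = proj₁ (proj₂ (find p))
    ... | no _  = here refl

    pick-dirty : ∀ f x xs → pick f x xs ∈ dirties f (x ∷ xs) ⊎ dirties f (x ∷ xs) ≡ []
    pick-dirty f x xs with any? (dirty? f) (x ∷ xs)
    ... | yes p = inj₁ (∈-filter⁺ (dirty? f) (proj₁ (proj₂ (find p))) (proj₂ (proj₂ (find p))))
    ... | no ¬p = inj₂ (filter-none′ (x ∷ xs) ¬p)
      where
      open import Data.List.Properties using (filter-none)
      filter-none′ : ∀ ys → ¬ Any (Dirty f) ys → dirties f ys ≡ []
      filter-none′ ys ¬p = filter-none (dirty? f) (All.¬Any⇒All¬ ys ¬p)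

    -- Branching over the partner of a single vertex makes matchings from different branches differ
    -- at that vertex, so nothing is counted twice. The last two vertices are matched to each other
    -- unconditionally, since every colour matches them as well and a single pair is connected.
    enum : ℕ → Colouring k → List V → List (V → V)
    enum h      f []           = []
    enum zero     f (x ∷ [])     = []
    enum zero     f (x ∷ y ∷ _)  = extend x y id ∷ []
    enum (suc h) f (x ∷ xs)     = concatMap
      (λ w → map (extend v w) (enum h (fuse* v w f) (del v w (x ∷ xs)))) ((x ∷ xs) ∖ star f v)
      where v = pick f x xs

    private
      2<length : ∀ h {A : List V} → length A ≡ 2 * suc (suc h) → 2 < length A
      2<length h eq = subst (2 <_) (sym (trans eq (*-suc 2 (suc h)))) (s≤s (s≤s (s≤s z≤n)))

    enum-sound : ∀ h {f A} → Unique A → IsColouring A f → length A ≡ 2 * suc h → All (Good A f) (enum h f A)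
    enum-sound h {A = []} A! F eq = []
    enum-sound zero {A = x ∷ []} A! F eq = []
    enum-sound zero {f} {x ∷ y ∷ []} A!@((x≢y ∷ []) ∷ _) F eq = (m , λ i → connected-pair (F i) refl) ∷ []
      where
      m : Matching (x ∷ y ∷ []) (extend x y id)
      m = extend-matching (here refl) (there (here refl)) x≢y record
        { closed = λ p → p
        ; irrefl = λ p → contradiction p no-vertex
        ; invol = λ p → contradiction p no-vertex }
        where
        no-vertex : ∀ {z} → z ∉ del x y (x ∷ y ∷ [])
        no-vertex p with ∈-del⁻ p
        ... | here r , q , _ = q r
        ... | there (here r) , _ , q = q r
    enum-sound zero {A = x ∷ y ∷ z ∷ A} A! F ()
    enum-sound (suc h) {f} {A@(x ∷ xs)} A! F eq = All.concat⁺ (All.map⁺ (All.tabulate λ {w} w∈ → All.map⁺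
      (All.map (good-extend F v∈A (proj₁ (∈-∖⁻ w∈)) (proj₂ (∈-∖⁻ w∈)))
        (enum-sound h (del-unique A!) (fuse*-colouring F v∈A (proj₁ (∈-∖⁻ w∈)) (proj₂ (∈-∖⁻ w∈)))
          (length-del-suc h A! eq v∈A (proj₁ (∈-∖⁻ w∈)) (∉-star⇒≢ (proj₂ (∈-∖⁻ w∈))))))))
      where v∈A = pick-∈ f x xs

    enum-complete : ∀ h {f A g} → Unique A → IsColouring A f → length A ≡ 2 * suc h → Good A f g →
                    Any (SameOn A g) (enum h f A)
    enum-complete h {A = []} A! F () good
    enum-complete zero {A = x ∷ []} A! F () good
    enum-complete zero {f} {x ∷ y ∷ []} {g} A!@((x≢y ∷ []) ∷ _) F eq (m , _) = here λ
      { (here refl) → trans extend-v (sym gx≡y)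
      ; (there (here refl)) → trans (extend-w x≢y) (sym (swap m (here refl) gx≡y)) }
      where
      gx≡y : g x ≡ y
      gx≡y with closed m (here refl)
      ... | here p = contradiction p (irrefl m (here refl))
      ... | there (here p) = p
    enum-complete zero {A = x ∷ y ∷ z ∷ A} A! F () good
    enum-complete (suc h) {f} {A@(x ∷ xs)} {g} A! F eq good@(m , _) =
      Any.concatMap⁺ _ (lose (∈-∖⁺ (closed m v∈A) w∉) (Any.map⁺ (Any.map lift
        (enum-complete h (del-unique A!) (fuse*-colouring F v∈A (closed m v∈A) w∉)
          (length-del-suc h A! eq v∈A (closed m v∈A) (∉-star⇒≢ w∉)) (good-restrict F v∈A w∉ good)))))
      where
      v = pick f x xs
      v∈A = pick-∈ f x xs
      w∉ : g v ∉ star f v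
      w∉ = good⇒∉-star A! (2<length h {A} eq) F v∈A good
      lift : ∀ {g′} → SameOn (del v (g v) A) g g′ → SameOn A g (extend v (g v) g′)
      lift same {z} z∈A with position v (g v) z
      ... | is-v refl = extend-v
      ... | is-w refl = trans (extend-w (∉-star⇒≢ w∉)) (sym (invol m v∈A))
      ... | other p q = trans (extend-other p q) (same (∈-del⁺ z∈A p q))

    enum-distinct : ∀ h {f A} → Unique A → AllPairs (Differ A) (enum h f A)
    enum-distinct h {A = []} A! = []
    enum-distinct zero {A = x ∷ []} A! = []
    enum-distinct zero {A = x ∷ y ∷ A} A! = [] ∷ []
    enum-distinct (suc h) {f} {A@(x ∷ xs)} A! = AllPairs.concat⁺
      (All.map⁺ (All.tabulate λ {w} w∈ → AllPairs.map⁺ (AllPairs.map lift (enum-distinct h (del-unique A!)))))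
      (AllPairs.map⁺ (AllPairs.map differ (∖-unique (star f v) A!)))
      where
      v = pick f x xs
      block : V → List (V → V)
      block w = map (extend v w) (enum h (fuse* v w f) (del v w A))
      lift : ∀ {w g g′} → Differ (del v w A) g g′ → Differ A (extend v w g) (extend v w g′)
      lift (z , z∈ , gz≢g′z) with ∈-del⁻ z∈
      ... | z∈A , p , q = z , z∈A , λ r → gz≢g′z (trans (sym (extend-other p q)) (trans r (extend-other p q)))
      differ : ∀ {w w′} → w ≢ w′ → All (λ g → All (Differ A g) (block w′)) (block w)
      differ w≢w′ = All.map⁺ (All.tabulate λ _ → All.map⁺ (All.tabulate λ _ →
        v , pick-∈ f x xs , λ r → w≢w′ (trans (sym extend-v) (trans r extend-v))))

  -- How a choice changes the set of dirty vertices

  module _ {k : ℕ} where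

    private
      pairs : List (Fin k × Fin k)
      pairs = cartesianProduct (allFin k) (allFin k)

      length-map-pairs : ∀ (g : Fin k × Fin k → V) → length (map g pairs) ≡ k * k
      length-map-pairs g = trans (length-map g pairs) (trans (length-cartesianProduct (allFin k) (allFin k))
        (cong₂ _*_ (length-tabulate {n = k} id) (length-tabulate {n = k} id)))

      word₃ word₂ : Colouring k → V → Fin k × Fin k → V
      word₃ f v (i , j) = f i (f j (f i v))
      word₂ f v (i , j) = f i (f j v)

    abstract
      -- Obtained by solving for w the equations under which two colours newly agree at some x: if
      -- the partners of x change in both, then w = f i (f j v); if only the one in colour i
      -- changes, then w = f i (f j (f i v)).
      bad : Colouring k → V → List V
      bad f v = map (word₃ f v) pairs ++ map (word₂ f v) pairs

      length-bad : ∀ f v → length (bad f v) ≡ k * k + k * k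
      length-bad f v = trans (length-++ (map (word₃ f v) pairs))
        (cong₂ _+_ (length-map-pairs (word₃ f v)) (length-map-pairs (word₂ f v)))

      bad₃ : ∀ (f : Colouring k) v i j {w} → w ≡ f i (f j (f i v)) → w ∈ bad f v
      bad₃ f v i j refl = ∈-++⁺ˡ (∈-map⁺ (word₃ f v) (∈-cartesianProduct⁺ (∈-allFin i) (∈-allFin j)))

      bad₂ : ∀ (f : Colouring k) v i j {w} → w ≡ f i (f j v) → w ∈ bad f v
      bad₂ f v i j refl = ∈-++⁺ʳ (map (word₃ f v) pairs)
        (∈-map⁺ (word₂ f v) (∈-cartesianProduct⁺ (∈-allFin i) (∈-allFin j)))

    no-new-dirty : ∀ {A} {f : Colouring k} {v w x} → IsColouring A f → v ∈ A → w ∈ A → w ∉ bad f v → x ∈ A →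
                   Dirty (fuse* v w f) x → Dirty f x
    no-new-dirty {A} {f} {v} {w} {x} F v∈A w∈A w∉ x∈A (i , j , i≢j , eq)
      with fuse v w (f i) x | fused v w (f i) x | fuse v w (f j) x | fused v w (f j) x
    ... | _ | at-v p | _ | at-v q = i , j , i≢j , trans p (sym q)
    ... | _ | at-v p | _ | at-w q = contradiction (bad₂ f v i j (sym (swap (F i) w∈A eq))) w∉
    ... | _ | at-v p | _ | other _ _ = contradiction (bad₃ f v i j (trans (sym (swap (F i) w∈A eq))
            (cong (f i ∘ f j) (sym (swap (F i) x∈A p))))) w∉
    ... | _ | at-w p | _ | at-v q = contradiction (bad₂ f v j i (sym (swap (F j) w∈A (sym eq)))) w∉
    ... | _ | at-w p | _ | at-w q = i , j , i≢j , trans p (sym q)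
    ... | _ | at-w p | _ | other _ _ = contradiction (bad₃ f v i j (trans (sym p)
            (cong (f i) (sym (swap (F j) x∈A (sym eq)))))) w∉
    ... | _ | other _ _ | _ | at-v q = contradiction (bad₃ f v j i (trans (sym (swap (F j) w∈A (sym eq)))
            (cong (f j ∘ f i) (sym (swap (F j) x∈A q))))) w∉
    ... | _ | other _ _ | _ | at-w q = contradiction (bad₃ f v j i (trans (sym q)
            (cong (f j) (sym (swap (F i) x∈A eq))))) w∉
    ... | _ | other _ _ | _ | other _ _ = i , j , i≢j , eq

    -- Only vertices matched to v or w by some colour get new partners, which limits the damage of a
    -- bad choice to 2 k vertices.
    dirty⇒near : ∀ {A} {f : Colouring k} {v w x} → IsColouring A f → x ∈ A → Dirty (fuse* v w f) x →
                 Dirty f x ⊎ x ∈ neighbours f v ++ neighbours f w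
    dirty⇒near {A} {f} {v} {w} {x} F x∈A (i , j , i≢j , eq)
      with fuse v w (f i) x | fused v w (f i) x | fuse v w (f j) x | fused v w (f j) x
    ... | _ | at-v p | _ | _ = inj₂ (∈-++⁺ˡ (subst (_∈ neighbours f v) (swap (F i) x∈A p) (∈-neighbours f v i)))
    ... | _ | at-w p | _ | _ = inj₂ (∈-++⁺ʳ (neighbours f v) (subst (_∈ neighbours f w) (swap (F i) x∈A p) (∈-neighbours f w i)))
    ... | _ | other _ _ | _ | at-v q = inj₂ (∈-++⁺ˡ (subst (_∈ neighbours f v) (swap (F j) x∈A q) (∈-neighbours f v j)))
    ... | _ | other _ _ | _ | at-w q = inj₂ (∈-++⁺ʳ (neighbours f v) (subst (_∈ neighbours f w) (swap (F j) x∈A q) (∈-neighbours f w j)))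
    ... | _ | other _ _ | _ | other _ _ = inj₁ (i , j , i≢j , eq)

    dirtiness : Colouring k → List V → ℕ
    dirtiness f A = length (dirties f A)

    module _ {A : List V} {f : Colouring k} {v w : V} (A! : Unique A) (F : IsColouring A f) where
      private
        D = dirties f A
        D! : Unique D
        D! = Unique.filter⁺ (dirty? f) A!
        D′! : Unique (dirties (fuse* v w f) (del v w A))
        D′! = Unique.filter⁺ (dirty? (fuse* v w f)) (del-unique A!)

      dirtiness-fuse-good : v ∈ A → w ∈ A → w ∉ bad f v →
                            dirties (fuse* v w f) (del v w A) ⊆ D ∖ (v ∷ [])
      dirtiness-fuse-good v∈A w∈A w∉ x∈ with ∈-filter⁻ (dirty? (fuse* v w f)) {xs = del v w A} x∈
      ... | x∈A′ , d with ∈-del⁻ x∈A′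
      ...   | x∈A , x≢v , _ = ∈-∖⁺ (∈-filter⁺ (dirty? f) x∈A (no-new-dirty F v∈A w∈A w∉ x∈A d)) λ { (here p) → x≢v p }

      dirtiness-fuse-any : dirties (fuse* v w f) (del v w A) ⊆ D ∖ (v ∷ []) ++ (neighbours f v ++ neighbours f w)
      dirtiness-fuse-any x∈ with ∈-filter⁻ (dirty? (fuse* v w f)) {xs = del v w A} x∈
      ... | x∈A′ , d with ∈-del⁻ x∈A′
      ...   | x∈A , x≢v , _ with dirty⇒near F x∈A d
      ...     | inj₁ d′ = ∈-++⁺ˡ (∈-∖⁺ (∈-filter⁺ (dirty? f) x∈A d′) λ { (here p) → x≢v p })
      ...     | inj₂ near = ∈-++⁺ʳ (D ∖ (v ∷ [])) near

      private
        length-D∖v : length (D ∖ (v ∷ [])) ≤ length D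
        length-D∖v = unique-⊆-length (∖-unique (v ∷ []) D!) (proj₁ ∘ ∈-∖⁻)

      -- `pred` treats both kinds of step alike: a dirty v disappears, and in a clean state the
      -- number is and stays 0.
      length-dirties-∖ : v ∈ D ⊎ D ≡ [] → length (D ∖ (v ∷ [])) ≤ pred (length D)
      length-dirties-∖ (inj₁ v∈D) = ≤-pred (≤-reflexive (trans (+-comm 1 _)
        (trans (length-∖-exact (v ∷ []) D! ([] ∷ []) λ { (here refl) → v∈D })
          (sym (suc-pred (length D) {{>-nonZero (∈-length v∈D)}})))))
      length-dirties-∖ (inj₂ D≡[]) = ≤-trans length-D∖v (≤-reflexive (trans (cong length D≡[]) (cong (pred ∘ length) (sym D≡[]))))

      private
        any-bound : ∀ {b} → length (D ∖ (v ∷ [])) ≤ b → dirtiness (fuse* v w f) (del v w A) ≤ b + (k + k)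
        any-bound {b} h = begin
          dirtiness (fuse* v w f) (del v w A)                         ≤⟨ unique-⊆-length D′! dirtiness-fuse-any ⟩
          length (D ∖ (v ∷ []) ++ (neighbours f v ++ neighbours f w)) ≡⟨ length-++ (D ∖ (v ∷ [])) ⟩
          length (D ∖ (v ∷ [])) + length (neighbours f v ++ neighbours f w)
            ≡⟨ cong (length (D ∖ (v ∷ [])) +_) (trans (length-++ (neighbours f v)) (cong₂ _+_ (length-neighbours f v) (length-neighbours f w))) ⟩
          length (D ∖ (v ∷ [])) + (k + k)                             ≤⟨ +-monoˡ-≤ (k + k) h ⟩
          b + (k + k)                                                 ∎
          where open ≤-Reasoning

      dirtiness-≤ : dirtiness (fuse* v w f) (del v w A) ≤ dirtiness f A + (k + k)
      dirtiness-≤ = any-bound length-D∖v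

      dirtiness-pick-≤ : v ∈ D ⊎ D ≡ [] → dirtiness (fuse* v w f) (del v w A) ≤ pred (dirtiness f A) + (k + k)
      dirtiness-pick-≤ p = any-bound (length-dirties-∖ p)

      dirtiness-good-≤ : v ∈ A → w ∈ A → w ∉ bad f v → v ∈ D ⊎ D ≡ [] →
                         dirtiness (fuse* v w f) (del v w A) ≤ pred (dirtiness f A)
      dirtiness-good-≤ v∈A w∈A w∉ p = ≤-trans (unique-⊆-length D′! (dirtiness-fuse-good v∈A w∈A w∉)) (length-dirties-∖ p)

    clean⇒injective : ∀ {f : Colouring k} {v i j} → ¬ Dirty f v → f i v ≡ f j v → i ≡ j
    clean⇒injective {i = i} {j} clean p with i Fin.≟ j
    ... | yes i≡j = i≡j
    ... | no i≢j = contradiction (i , j , i≢j , p) clean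

    clean-star-unique : ∀ {A} {f : Colouring k} {v} → IsColouring A f → v ∈ A → ¬ Dirty f v → Unique (star f v)
    clean-star-unique {A} {f} {v} F v∈A clean = subst Unique (sym (star-def f v))
      (All.tabulate irreflexive ∷ Unique.map⁺ (clean⇒injective {f} {v} clean) (Unique.allFin⁺ k))
      where
      irreflexive : ∀ {x} → x ∈ neighbours f v → v ≢ x
      irreflexive x∈ refl with ∈-map⁻ (λ i → f i v) x∈
      ... | i , _ , p = irrefl (F i) v∈A (sym p)

    star-⊆ : ∀ {A} {f : Colouring k} {v} → IsColouring A f → v ∈ A → star f v ⊆ A
    star-⊆ {A} {f} {v} F v∈A x∈ with subst (_ ∈_) (star-def f v) x∈
    ... | here refl = v∈A
    ... | there p with ∈-map⁻ (λ i → f i v) p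
    ...   | i , _ , refl = closed (F i) v∈A

    clean : ∀ {A} {f : Colouring k} {v} → dirties f A ≡ [] → v ∈ A → ¬ Dirty f v
    clean {A} {f} {v} none v∈A d with subst (v ∈_) none (∈-filter⁺ (dirty? f) v∈A d)
    ... | ()

  -- Existence of a completion

  Solvable : ∀ {k} → List V → Colouring k → Set
  Solvable A f = ∃[ g ] Good A f g

  record State (k h : ℕ) : Set where
    field
      verts     : List V
      col       : Colouring k
      unique    : Unique verts
      colouring : IsColouring verts col
      size      : length verts ≡ 2 * suc h

  open State

  Solved : ∀ {k h} → State k h → Set
  Solved S = Solvable (verts S) (col S)

  module _ {k h : ℕ} (S : State k (suc h)) {v w : V} (v∈ : v ∈ verts S) (w∈ : w ∈ verts S) (w∉ : w ∉ star (col S) v) where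
    fuseState : State k h
    fuseState = record
      { verts = del v w (verts S)
      ; col = fuse* v w (col S)
      ; unique = del-unique (unique S)
      ; colouring = fuse*-colouring (colouring S) v∈ w∈ w∉
      ; size = length-del-suc h (unique S) (size S) v∈ w∈ (∉-star⇒≢ w∉) }

    solved-fuse : Solved fuseState → Solved S
    solved-fuse (g , good) = _ , good-extend (colouring S) v∈ w∈ w∉ good

  -- With at most one colour a star has at most two vertices, while at least four are left until the
  -- last step, so any greedy choice succeeds.
  few-colours : ∀ {k} → k ≤ 1 → ∀ h (S : State k h) → Solved S
  few-colours k≤1 zero S with verts S in eq | size S
  ... | x ∷ y ∷ [] | _ = _ , All.head (enum-sound 0 {col S} {x ∷ y ∷ []}
          (subst Unique eq (unique S)) (subst (λ A → IsColouring A (col S)) eq (colouring S)) refl)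
  few-colours {k} k≤1 (suc h) S with avoid {verts S} [] (unique S) (subst (0 <_) (sym (size S)) (s≤s z≤n))
  ... | v , v∈ , _ with avoid {verts S} (star (col S) v) (unique S) (begin-strict
          length (star (col S) v)   ≡⟨ length-star (col S) v ⟩
          suc k                     ≤⟨ s≤s k≤1 ⟩
          2                         <⟨ s≤s (s≤s (s≤s z≤n)) ⟩
          2 + 2 * suc h             ≡⟨ *-suc 2 (suc h) ⟨
          2 * suc (suc h)           ≡⟨ size S ⟨
          length (verts S)          ∎)
    where open ≤-Reasoning
  ...   | w , w∈ , w∉ = solved-fuse S v∈ w∈ w∉ (few-colours k≤1 h (fuseState S v∈ w∈ w∉))

  CleanSolvable : ℕ → ℕ → Set
  CleanSolvable k M = ∀ h (S : State k h) → M ≤ h → dirties (col S) (verts S) ≡ [] → Solved S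

  length-star++bad : ∀ {k} (f : Colouring k) v → length (star f v ++ bad f v) ≡ dirtyBound k
  length-star++bad f v = trans (length-++ (star f v)) (cong₂ _+_ (length-star f v) (length-bad f v))

  -- Matching a dirty vertex to one outside `star` and `bad` removes it and makes no other vertex
  -- dirty, so every dirty vertex costs just one pair.
  solve-dirty : ∀ {k M} → CleanSolvable k M → ∀ c h (S : State k h) →
                dirtiness (col S) (verts S) ≤ c → M + c + dirtyBound k ≤ h → Solved S
  solve-dirty {k} {M} solve c h S few h-large with dirties (col S) (verts S) in eq
  ... | [] = solve h S (≤-trans (≤-trans (m≤m+n M c) (m≤m+n _ _)) h-large) eq
  solve-dirty {k} {M} solve (suc c) (suc h) S few h-large | v ∷ vs
    with avoid (star (col S) v ++ bad (col S) v) (unique S) (begin-strict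
      length (star (col S) v ++ bad (col S) v) ≡⟨ length-star++bad (col S) v ⟩
      dirtyBound k                             ≤⟨ m≤n+m _ (M + suc c) ⟩
      M + suc c + dirtyBound k                 ≤⟨ h-large ⟩
      suc h                                    <⟨ n<1+n (suc h) ⟩
      suc (suc h)                              ≤⟨ m≤n*m (suc (suc h)) 2 ⟩
      2 * suc (suc h)                          ≡⟨ size S ⟨
      length (verts S)                         ∎)
    where open ≤-Reasoning
  ... | w , w∈ , w∉ = solved-fuse S v∈ w∈ w∉star (solve-dirty solve c h (fuseState S v∈ w∈ w∉star)
          (≤-trans (dirtiness-good-≤ (unique S) (colouring S) v∈ w∈ (w∉ ∘ ∈-++⁺ʳ (star (col S) v)) (inj₁ v∈D))
            (≤-trans (≤-reflexive (cong (pred ∘ length) eq)) (≤-pred few)))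
          (≤-pred (≤-trans (≤-reflexive (cong (_+ dirtyBound k) (sym (+-suc M c)))) h-large)))
    where
    v∈D : v ∈ dirties (col S) (verts S)
    v∈D = subst (v ∈_) (sym eq) (here refl)
    v∈ : v ∈ verts S
    v∈ = proj₁ (∈-filter⁻ (dirty? (col S)) {xs = verts S} v∈D)
    w∉star : w ∉ star (col S) v
    w∉star = w∉ ∘ ∈-++⁺ˡ
  solve-dirty {k} {M} solve (suc c) zero S few h-large | v ∷ vs =
    contradiction (≤-trans (≤-trans (m≤n+m (suc c) M) (m≤m+n _ _)) h-large) λ ()
  solve-dirty {k} {M} solve zero h S () h-large | v ∷ vs

  -- Making two colours equal

  tail : ∀ {k} → Colouring (suc k) → Colouring k
  tail f i = f (suc i)

  -- The first two colours are to be made equal, which reduces the number of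
  -- colours by one.
  module Merge (κ M : ℕ) where
    open MergeSizes κ M public

    pattern 0ᶠ = Fin.zero
    pattern 1ᶠ = Fin.suc Fin.zero

    Merged : Colouring k → V → Set
    Merged f x = f 0ᶠ x ≡ f 1ᶠ x

    merged? : ∀ f x → Dec (Merged f x)
    merged? f x = f 0ᶠ x ≟ f 1ᶠ x

    unmerged : Colouring k → List V → List V
    unmerged f = filter (¬? ∘ merged? f)

    solvable-merged : ∀ {A} {f : Colouring k} → (∀ {x} → x ∈ A → Merged f x) → Solvable A (tail f) → Solvable A f
    solvable-merged {A} {f} merged (g , m , con) = g , m , λ
      { 0ᶠ → λ s sf sg → con 0ᶠ s (λ x∈A → trans (cong s (sym (merged x∈A))) (sf x∈A)) sg
      ; (suc i) → con i }

    -- As y and y′ are partners for both of the first two colours, the fusions z₀y and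
    -- z₂y′ act on these like z₀z₂, which may be forbidden by another colour.
    module Round {h : ℕ} (S : State k (suc (suc h))) where
      A = verts S
      f = col S
      U = unmerged f A
      D = dirties (tail f) A

      module _ {a : V} (a∈U : a ∈ U) where
        F = colouring S
        a∈ : a ∈ A
        a∈ = proj₁ (∈-filter⁻ (¬? ∘ merged? f) {xs = A} a∈U)
        a-unmerged : ¬ Merged f a
        a-unmerged = proj₂ (∈-filter⁻ (¬? ∘ merged? f) {xs = A} a∈U)
        z₀ = f 0ᶠ a
        z₂ = f 1ᶠ a
        z₀∈ : z₀ ∈ A
        z₀∈ = closed (F 0ᶠ) a∈
        z₂∈ : z₂ ∈ A
        z₂∈ = closed (F 1ᶠ) a∈

        X = star f z₀ ++ (star f z₂ ++ bad f z₂)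

        length-X : length X ≡ suc k + (suc k + (k * k + k * k))
        length-X = trans (length-++ (star f z₀)) (cong₂ _+_ (length-star f z₀) (length-star++bad f z₂))

        module _ {y : V} (y∈ : y ∈ A) (y∉ : y ∉ U ++ (D ++ X)) where
          y-merged : Merged f y
          y-merged with merged? f y
          ... | yes p = p
          ... | no ¬p = contradiction (∈-++⁺ˡ (∈-filter⁺ (¬? ∘ merged? f) y∈ ¬p)) y∉
          y-clean : ¬ Dirty (tail f) y
          y-clean d = y∉ (∈-++⁺ʳ U (∈-++⁺ˡ (∈-filter⁺ (dirty? (tail f)) y∈ d)))
          y∉star : y ∉ star f z₀
          y∉star = y∉ ∘ ∈-++⁺ʳ U ∘ ∈-++⁺ʳ D ∘ ∈-++⁺ˡ
          y∉star₂ : y ∉ star f z₂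
          y∉star₂ = y∉ ∘ ∈-++⁺ʳ U ∘ ∈-++⁺ʳ D ∘ ∈-++⁺ʳ (star f z₀) ∘ ∈-++⁺ˡ
          y∉bad₂ : y ∉ bad f z₂
          y∉bad₂ = y∉ ∘ ∈-++⁺ʳ U ∘ ∈-++⁺ʳ D ∘ ∈-++⁺ʳ (star f z₀) ∘ ∈-++⁺ʳ (star f z₂)
          y′ = f 0ᶠ y
          y′∈ : y′ ∈ A
          y′∈ = closed (F 0ᶠ) y∈
          S′ = fuseState S z₀∈ y∈ y∉star
          f′ = col S′
          z₂∈′ : z₂ ∈ verts S′
          z₂∈′ = ∈-del⁺ z₂∈ (a-unmerged ∘ sym) (∉-star⇒≢ y∉star₂)
          y′≢z₀ : y′ ≢ z₀
          y′≢z₀ p = ∉-star⇒nonadjacent y∉star 0ᶠ (swap (F 0ᶠ) y∈ p)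
          y′∈′ : y′ ∈ verts S′
          y′∈′ = ∈-del⁺ y′∈ y′≢z₀ (irrefl (F 0ᶠ) y∈)
          nonadjacent : ∀ j → f′ j z₂ ≢ y′
          nonadjacent j p with fuse z₀ y (f j) z₂ | fused z₀ y (f j) z₂
          nonadjacent 0ᶠ p | _ | at-v q = irrefl (F 1ᶠ) a∈ (injective (F 0ᶠ) z₂∈ a∈ q)
          nonadjacent 1ᶠ p | _ | at-v q = irrefl (F 0ᶠ) a∈ (sym (trans (sym (invol (F 1ᶠ) a∈)) q))
          -- Here z₂ was matched to z₀, so its new partner is that of y in this colour. It is y′,
          -- the partner of y in the first two colours, only if y is dirty for the kept colours.
          nonadjacent (suc (suc j)) p | _ | at-v q = y-clean (suc j , 0ᶠ , (λ ()) , trans p y-merged)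
          nonadjacent j p | _ | at-w q = ∉-star⇒nonadjacent y∉star₂ j q
          nonadjacent j p | _ | other _ _ = y∉bad₂ (bad₂ f z₂ 0ᶠ j (sym (swap (F 0ᶠ) y∈ (sym p))))
          y′∉star : y′ ∉ star f′ z₂
          y′∉star = ∉-star (λ p → ∉-star⇒nonadjacent y∉star₂ 0ᶠ (swap (F 0ᶠ) y∈ (sym p))) nonadjacent
          S″ = fuseState S′ z₂∈′ y′∈′ y′∉star
          -- The common partner of x is none of the deleted vertices: z₀ and z₂ are the partners of
          -- the unmerged a, and y and y′ are partners of each other. So neither fusion touches that
          -- edge.
          still-merged : ∀ {x} → x ∈ verts S″ → Merged f x → Merged (col S″) x
          still-merged {x} x∈″ x-merged with ∈-del⁻ x∈″
          ... | x∈′ , x≢z₂ , x≢y′ with ∈-del⁻ x∈′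
          ...   | x∈ , x≢z₀ , x≢y = trans (kept 0ᶠ refl) (sym (kept 1ᶠ (sym x-merged)))
            where
            x′ = f 0ᶠ x
            x≢a : x ≢ a
            x≢a refl = a-unmerged x-merged
            x′≢z₀ : x′ ≢ z₀
            x′≢z₀ p = x≢a (injective (F 0ᶠ) x∈ a∈ p)
            x′≢z₂ : x′ ≢ z₂
            x′≢z₂ p = x≢a (injective (F 1ᶠ) x∈ a∈ (trans (sym x-merged) p))
            x′≢y : x′ ≢ y
            x′≢y p = x≢y′ (sym (swap (F 0ᶠ) x∈ p))
            x′≢y′ : x′ ≢ y′
            x′≢y′ p = x≢y (injective (F 0ᶠ) x∈ y∈ p)
            kept : ∀ i → f i x ≡ x′ → col S″ i x ≡ x′
            kept i p = trans (fuse-other (x′≢z₂ ∘ trans (sym p′)) (x′≢y′ ∘ trans (sym p′))) p′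
              where
              p′ : f′ i x ≡ x′
              p′ = trans (fuse-other (x′≢z₀ ∘ trans (sym p)) (x′≢y ∘ trans (sym p))) p
          z₀∈U : z₀ ∈ U
          z₀∈U = ∈-filter⁺ (¬? ∘ merged? f) z₀∈ λ p → a-unmerged
            (sym (swap (F 1ᶠ) z₀∈ (trans (sym p) (invol (F 0ᶠ) a∈))))
          -- No merged vertex becomes unmerged, and the unmerged `z₀` is deleted.
          few-u″ : length (unmerged (col S″) (verts S″)) < length U
          few-u″ = begin
            suc (length (unmerged (col S″) (verts S″)))   ≤⟨ s≤s (unique-⊆-length (Unique.filter⁺ (¬? ∘ merged? (col S″)) (unique S″)) shrink) ⟩
            suc (length (U ∖ (z₀ ∷ [])))                  ≡⟨ +-comm 1 _ ⟩
            length (U ∖ (z₀ ∷ [])) + 1                    ≡⟨ length-∖-exact (z₀ ∷ []) (Unique.filter⁺ (¬? ∘ merged? f) (unique S)) ([] ∷ []) (λ { (here refl) → z₀∈U }) ⟩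
            length U                                      ∎
            where
            open ≤-Reasoning
            shrink : unmerged (col S″) (verts S″) ⊆ U ∖ (z₀ ∷ [])
            shrink x∈U″ with ∈-filter⁻ (¬? ∘ merged? (col S″)) {xs = verts S″} x∈U″
            ... | x∈″ , ¬p with ∈-del⁻ (proj₁ (∈-del⁻ x∈″))
            ...   | x∈ , x≢z₀ , _ = ∈-∖⁺ (∈-filter⁺ (¬? ∘ merged? f) x∈ (¬p ∘ still-merged x∈″)) λ { (here p) → x≢z₀ p }

          few-t″ : dirtiness (tail (col S″)) (verts S″) ≤ dirtiness (tail f) A + 4 * suc κ
          few-t″ = begin
            dirtiness (tail (col S″)) (verts S″)                    ≤⟨ dirtiness-≤ (unique S′) (colouring S′ ∘ suc) ⟩
            dirtiness (tail f′) (verts S′) + (suc κ + suc κ)        ≤⟨ +-monoˡ-≤ _ (dirtiness-≤ (unique S) (F ∘ suc)) ⟩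
            dirtiness (tail f) A + (suc κ + suc κ) + (suc κ + suc κ) ≡⟨ e₀ (dirtiness (tail f) A) (suc κ) ⟩
            dirtiness (tail f) A + 4 * suc κ                        ∎
            where
            open ≤-Reasoning
            e₀ : ∀ t a → t + (a + a) + (a + a) ≡ t + 4 * a
            e₀ = solve-∀

          solved-round : Solved S″ → Solved S
          solved-round = solved-fuse S z₀∈ y∈ y∉star ∘ solved-fuse S′ z₂∈′ y′∈′ y′∉star

    module _ (cs : CleanSolvable (suc κ) M) where

      -- A round trades one unmerged vertex for boundedly many new dirty ones; the hypothesis on h
      -- reserves the vertices for all rounds in advance. Once every vertex is merged, colour 0
      -- repeats colour 1 and is dropped.
      merge-all : ∀ u t h (S : State k h) → length (unmerged (col S) (verts S)) ≤ u →
                  dirtiness (tail (col S)) (verts S) ≤ t →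
                  M + t + dirtyBound (suc κ) + rounds u + exclusions ≤ h → Solved S
      merge-all u t h S few-u few-t h-large with unmerged (col S) (verts S) in eq
      ... | [] = solvable-merged all-merged (solve-dirty cs t h
                   (record { verts = verts S ; col = tail (col S) ; unique = unique S
                           ; colouring = colouring S ∘ suc ; size = size S })
                   few-t (≤-trans (≤-trans (m≤m+n _ (rounds u)) (m≤m+n _ exclusions)) h-large))
        where
        all-merged : ∀ {x} → x ∈ verts S → Merged (col S) x
        all-merged {x} x∈ with merged? (col S) x
        ... | yes p = p
        ... | no ¬p with subst (x ∈_) eq (∈-filter⁺ (¬? ∘ merged? (col S)) x∈ ¬p)
        ...   | ()
      merge-all zero t h S () few-t h-large | a ∷ as
      merge-all (suc u) t zero S few-u few-t h-large | a ∷ as =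
        contradiction (≤-trans (m≤n+m exclusions _) h-large) λ ()
      merge-all (suc u) t (suc zero) S few-u few-t h-large | a ∷ as =
        contradiction (≤-trans (m≤n+m exclusions _) h-large) λ { (s≤s ()) }
      merge-all (suc u) t (suc (suc h)) S few-u few-t h-large | a ∷ as =
        solved-round a∈U y∈ y∉ (merge-all u (t + 4 * suc κ) h (S″ a∈U y∈ y∉)
          (≤-pred (≤-trans (few-u″ a∈U y∈ y∉) (≤-trans (≤-reflexive (cong length eq)) few-u)))
          (≤-trans (few-t″ a∈U y∈ y∉) (+-monoˡ-≤ (4 * suc κ) few-t)) h-large″)
        where
        open Round S
        a∈U : a ∈ unmerged (col S) (verts S)
        a∈U = subst (a ∈_) (sym eq) (here refl)
        enough : length (U ++ (D ++ X a∈U)) < length A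
        enough = begin-strict
          length (U ++ (D ++ X a∈U))            ≡⟨ trans (length-++ U) (cong (length U +_) (length-++ D)) ⟩
          length U + (length D + length (X a∈U))
            ≤⟨ +-mono-≤ (≤-trans (≤-reflexive (cong length eq)) few-u) (+-mono-≤ few-t (≤-reflexive (length-X a∈U))) ⟩
          suc u + (t + exclusions)          ≤⟨ +-monoˡ-≤ (t + exclusions) (m≤m*n (suc u) (4 * suc κ + 2) {{>-nonZero (≤-trans (s≤s z≤n) (m≤n+m 2 (4 * suc κ)))}}) ⟩
          rounds (suc u) + (t + exclusions) ≤⟨ m≤m+n _ (M + dirtyBound (suc κ)) ⟩
          rounds (suc u) + (t + exclusions) + (M + dirtyBound (suc κ))
                                            ≡⟨ e₀ (rounds (suc u)) t exclusions M (dirtyBound (suc κ)) ⟩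
          M + t + dirtyBound (suc κ) + rounds (suc u) + exclusions ≤⟨ h-large ⟩
          suc (suc h)                       <⟨ n<1+n _ ⟩
          suc (suc (suc h))                 ≤⟨ m≤n*m (suc (suc (suc h))) 2 ⟩
          2 * suc (suc (suc h))             ≡⟨ size S ⟨
          length A                          ∎
          where
          open ≤-Reasoning
          e₀ : ∀ r t x m b → r + (t + x) + (m + b) ≡ m + t + b + r + x
          e₀ = solve-∀
        helper = avoid (U ++ (D ++ X a∈U)) (unique S) enough
        y∈ = proj₁ (proj₂ helper)
        y∉ = proj₂ (proj₂ helper)
        h-large″ : M + (t + 4 * suc κ) + dirtyBound (suc κ) + rounds u + exclusions ≤ h
        h-large″ = +-cancelʳ-≤ 2 _ _ (≤-trans (≤-reflexive (e₀ M t (4 * suc κ) (dirtyBound (suc κ)) u exclusions))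
          (≤-trans h-large (≤-reflexive (+-comm 2 h))))
          where
          e₀ : ∀ m t a b u x → m + (t + a) + b + u * (a + 2) + x + 2 ≡ m + t + b + (a + 2 + u * (a + 2)) + x
          e₀ = solve-∀

    -- A supply of edges common to the first two colours. It stays in place while the other vertices
    -- are fused away, so that in the end the two colours differ at few vertices compared with those
    -- where they agree.
    record Helpers {h} (S : State k h) (H : List V) : Set where
      field
        H-unique : Unique H
        H⊆       : H ⊆ verts S
        H-merged : ∀ {y} → y ∈ H → Merged (col S) y
        H-closed : ∀ {y} → y ∈ H → col S 0ᶠ y ∈ H
        H-clean  : ∀ {y} → y ∈ H → ¬ Dirty (tail (col S)) y

    open Helpers

    module _ (cs : CleanSolvable (suc κ) M) where
      -- As H is closed under the first two colours, choices outside H do not change these on H, and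
      -- avoiding `bad` for the kept colours keeps the helpers clean. When at most `rest` vertices
      -- are left outside H, all unmerged and all dirty ones are among them.
      fuse-outside : ∀ h (S : State k h) {H} → Helpers S H → 2 * suc needed ≤ length H → Solved S
      fuse-outside h S {H} helpers many with length (verts S ∖ H) ≤? rest
      ... | yes few = merge-all cs rest rest h S
              (≤-trans (unique-⊆-length (Unique.filter⁺ (¬? ∘ merged? (col S)) (unique S)) unmerged⊆) few)
              (≤-trans (unique-⊆-length (Unique.filter⁺ (dirty? (tail (col S))) (unique S)) dirty⊆) few)
              (≤-pred (*-cancelˡ-≤ 2 (≤-trans many (≤-trans (unique-⊆-length (H-unique helpers) (H⊆ helpers)) (≤-reflexive (size S))))))
        where
        unmerged⊆ : unmerged (col S) (verts S) ⊆ verts S ∖ H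
        unmerged⊆ x∈ with ∈-filter⁻ (¬? ∘ merged? (col S)) {xs = verts S} x∈
        ... | x∈A , ¬p = ∈-∖⁺ x∈A (¬p ∘ H-merged helpers)
        dirty⊆ : dirties (tail (col S)) (verts S) ⊆ verts S ∖ H
        dirty⊆ x∈ with ∈-filter⁻ (dirty? (tail (col S))) {xs = verts S} x∈
        ... | x∈A , d = ∈-∖⁺ x∈A λ x∈H → H-clean helpers x∈H d
      fuse-outside zero S {H} helpers many | no ¬few =
        contradiction (begin
          3                                  ≤⟨ +-mono-≤ (≤-trans (s≤s z≤n) (≰⇒> ¬few)) (≤-trans (*-monoʳ-≤ 2 (s≤s z≤n)) many) ⟩
          length (verts S ∖ H) + length H    ≡⟨ length-∖-exact H (unique S) (H-unique helpers) (H⊆ helpers) ⟩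
          length (verts S)                   ≡⟨ size S ⟩
          2                                  ∎) λ { (s≤s (s≤s ())) }
        where open ≤-Reasoning
      fuse-outside (suc h) S {H} helpers many | no ¬few
        with v , v∈R , _ ← avoid {verts S ∖ H} [] (∖-unique H (unique S)) (≤-trans (s≤s z≤n) (≰⇒> ¬few))
        with w , w∈R , w∉ ← avoid {verts S ∖ H} (star (col S) v ++ bad (tail (col S)) v) (∖-unique H (unique S))
               (≤-trans (s≤s (≤-reflexive (trans (length-++ (star (col S) v))
                 (cong₂ _+_ (length-star (col S) v) (length-bad (tail (col S)) v))))) (≰⇒> ¬few))
        = solved-fuse S v∈ w∈ w∉star (fuse-outside h (fuseState S v∈ w∈ w∉star) helpers′ many)
        where
        f = col S
        v∈ = proj₁ (∈-∖⁻ v∈R)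
        v∉H = proj₂ (∈-∖⁻ v∈R)
        w∈ = proj₁ (∈-∖⁻ w∈R)
        w∉H = proj₂ (∈-∖⁻ w∈R)
        w∉star : w ∉ star f v
        w∉star = w∉ ∘ ∈-++⁺ˡ
        outside : ∀ {x} → x ∈ H → x ≢ v × x ≢ w
        outside x∈H = (λ { refl → v∉H x∈H }) , (λ { refl → w∉H x∈H })
        kept : ∀ i {y} → f i y ∈ H → fuse v w (f i) y ≡ f i y
        kept i p = fuse-other (proj₁ (outside p)) (proj₂ (outside p))
        f₁∈H : ∀ {y} → y ∈ H → f 1ᶠ y ∈ H
        f₁∈H y∈H = subst (_∈ H) (H-merged helpers y∈H) (H-closed helpers y∈H)
        helpers′ : Helpers (fuseState S v∈ w∈ w∉star) H
        helpers′ = record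
          { H-unique = H-unique helpers
          ; H⊆ = λ x∈H → ∈-del⁺ (H⊆ helpers x∈H) (proj₁ (outside x∈H)) (proj₂ (outside x∈H))
          ; H-merged = λ y∈H → trans (kept 0ᶠ (H-closed helpers y∈H))
              (trans (H-merged helpers y∈H) (sym (kept 1ᶠ (f₁∈H y∈H))))
          ; H-closed = λ y∈H → subst (_∈ H) (sym (kept 0ᶠ (H-closed helpers y∈H))) (H-closed helpers y∈H)
          ; H-clean = λ y∈H → H-clean helpers y∈H ∘
              no-new-dirty (colouring S ∘ suc) v∈ w∈ (w∉ ∘ ∈-++⁺ʳ (star f v)) (H⊆ helpers y∈H) }

    -- Gadgets that create helpers

    module _ (f : Colouring k) where
      abstract
        -- All vertices within r steps along edges of any colour. Repetitions are kept, which makes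
        -- the length an exact expression.
        ball : ℕ → List V → List V
        ball zero    L = L
        ball (suc r) L = ball r L ++ concatMap (neighbours f) (ball r L)

        ball-zero : ∀ {L x} → x ∈ L → x ∈ ball 0 L
        ball-zero p = p

        ball-suc : ∀ {r L x} → x ∈ ball r L → x ∈ ball (suc r) L
        ball-suc = ∈-++⁺ˡ

        ball-step : ∀ {r L x} i → x ∈ ball r L → f i x ∈ ball (suc r) L
        ball-step {r} {L} {x} i x∈ = ∈-++⁺ʳ (ball r L) (∈-concatMap⁺ (neighbours f) (lose x∈ (∈-neighbours f x i)))

        length-ball : ∀ r L → length (ball r L) ≡ suc k ^ r * length L
        length-ball zero L = sym (*-identityˡ (length L))
        length-ball (suc r) L = begin
          length (ball r L ++ concatMap (neighbours f) (ball r L))           ≡⟨ length-++ (ball r L) ⟩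
          length (ball r L) + length (concatMap (neighbours f) (ball r L))   ≡⟨ cong (length (ball r L) +_) (blocks (ball r L)) ⟩
          length (ball r L) + length (ball r L) * k                          ≡⟨ e₀ (length (ball r L)) k ⟩
          suc k * length (ball r L)                                          ≡⟨ cong (suc k *_) (length-ball r L) ⟩
          suc k * (suc k ^ r * length L)                                     ≡⟨ *-assoc (suc k) (suc k ^ r) (length L) ⟨
          suc k * suc k ^ r * length L                                       ∎
          where
          open ≡-Reasoning
          e₀ : ∀ a k → a + a * k ≡ suc k * a
          e₀ = solve-∀
          blocks : ∀ xs → length (concatMap (neighbours f) xs) ≡ length xs * k
          blocks [] = refl
          blocks (x ∷ xs) = trans (length-++ (neighbours f x)) (cong₂ _+_ (length-neighbours f x) (blocks xs))

      ball-mono : ∀ {r s L x} → r ≤′ s → x ∈ ball r L → x ∈ ball s L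
      ball-mono ≤′-refl p = p
      ball-mono (≤′-step r≤s) p = ball-suc (ball-mono r≤s p)

      apart : ∀ r s {L x z} {r≤s : True (r ≤? s)} → z ∈ ball r L → x ∉ ball s L → z ≢ x
      apart r s {r≤s = r≤s} z∈ x∉ refl = x∉ (ball-mono (≤⇒≤′ (toWitness r≤s)) z∈)

      -- The step back along the same edge would lead from the smaller ball into the larger one.
      far-step : ∀ {A r L x} → IsColouring A f → ∀ i → x ∈ A → x ∉ ball (suc r) L → f i x ∉ ball r L
      far-step {r = r} {L} F i x∈ x∉ p = x∉ (subst (_∈ ball (suc r) L) (invol (F i) x∈) (ball-step i p))

  module _ (κ M : ℕ) where
    open Merge κ M
    open Helpers

    -- The two fusions y₀x₀ and y₃x₁ act on colour 0 like y₀y₃ alone, which joins y₁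
    -- and y₂ by colour 0 as they are by colour 1; but y₀y₃ may be forbidden.
    module Gadget {A : List V} {f : Colouring k} (F : IsColouring A f)
      {y₀ y₁ y₂ y₃ x₀ x₁ : V} (Y₀ : f 0ᶠ y₁ ≡ y₀) (Y₂ : f 1ᶠ y₁ ≡ y₂) (Y₃ : f 0ᶠ y₂ ≡ y₃) (X₁ : f 0ᶠ x₀ ≡ x₁)
      (y₁∈ : y₁ ∈ A) (x₀∈ : x₀ ∈ A) {L : List V} (L-clean : ∀ {x} → x ∈ A → x ∉ L → ¬ Dirty f x)
      (y₁∉ : y₁ ∉ ball f 8 L) (x₀∉ : x₀ ∉ ball f 8 (y₁ ∷ L)) where

      private
        step∈ : ∀ {i x y} → f i x ≡ y → x ∈ A → y ∈ A
        step∈ {i} refl = closed (F i)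

        back : ∀ {i x y} → f i x ≡ y → x ∈ A → f i y ≡ x
        back {i} p x∈ = swap (F i) x∈ p

        step∉ : ∀ {r L i x y} → f i x ≡ y → x ∈ A → x ∉ ball f (suc r) L → y ∉ ball f r L
        step∉ {i = i} refl = far-step f F i

        step-near : ∀ {r L i x y} → f i x ≡ y → x ∈ ball f r L → y ∈ ball f (suc r) L
        step-near {i = i} refl = ball-step f i

      y₀∈ : y₀ ∈ A
      y₀∈ = step∈ Y₀ y₁∈
      y₂∈ : y₂ ∈ A
      y₂∈ = step∈ Y₂ y₁∈
      y₃∈ : y₃ ∈ A
      y₃∈ = step∈ Y₃ y₂∈
      x₁∈ : x₁ ∈ A
      x₁∈ = step∈ X₁ x₀∈

      private
        N = y₁ ∷ L

        y₀∉ : y₀ ∉ ball f 7 L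
        y₀∉ = step∉ Y₀ y₁∈ y₁∉
        y₂∉ : y₂ ∉ ball f 7 L
        y₂∉ = step∉ Y₂ y₁∈ y₁∉
        y₃∉ : y₃ ∉ ball f 6 L
        y₃∉ = step∉ Y₃ y₂∈ y₂∉
        x₁∉ : x₁ ∉ ball f 7 N
        x₁∉ = step∉ X₁ x₀∈ x₀∉

        y₁-near : y₁ ∈ ball f 0 N
        y₁-near = ball-zero f (here refl)
        y₀-near : y₀ ∈ ball f 1 N
        y₀-near = step-near Y₀ y₁-near
        y₂-near : y₂ ∈ ball f 1 N
        y₂-near = step-near Y₂ y₁-near
        y₃-near : y₃ ∈ ball f 2 N
        y₃-near = step-near Y₃ y₂-near

        in-L : ∀ r {x} → x ∉ ball f r L → x ∉ L
        in-L r x∉ p = x∉ (ball-mono f (≤⇒≤′ (z≤n {r})) (ball-zero f p))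

        in-N : ∀ r {x} → x ∉ ball f r N → x ∉ L
        in-N r x∉ p = x∉ (ball-mono f (≤⇒≤′ (z≤n {r})) (ball-zero f (there p)))

        y₁-clean : ¬ Dirty f y₁
        y₁-clean = L-clean y₁∈ (in-L 8 y₁∉)
        y₂-clean : ¬ Dirty f y₂
        y₂-clean = L-clean y₂∈ (in-L 7 y₂∉)
        x₀-clean : ¬ Dirty f x₀
        x₀-clean = L-clean x₀∈ (in-N 8 x₀∉)
        x₁-clean : ¬ Dirty f x₁
        x₁-clean = L-clean x₁∈ (in-N 7 x₁∉)

        y₀≢y₁ : y₀ ≢ y₁
        y₀≢y₁ = irrefl (F 0ᶠ) y₁∈ ∘ trans Y₀
        y₂≢y₁ : y₂ ≢ y₁
        y₂≢y₁ = irrefl (F 1ᶠ) y₁∈ ∘ trans Y₂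
        y₃≢y₂ : y₃ ≢ y₂
        y₃≢y₂ = irrefl (F 0ᶠ) y₂∈ ∘ trans Y₃
        y₀≢y₂ : y₀ ≢ y₂
        y₀≢y₂ p = y₁-clean (0ᶠ , 1ᶠ , (λ ()) , trans Y₀ (trans p (sym Y₂)))
        y₁≢y₃ : y₁ ≢ y₃
        y₁≢y₃ p = y₀≢y₂ (trans (sym Y₀) (back (trans Y₃ (sym p)) y₂∈))
        y₀≢y₃ : y₀ ≢ y₃
        y₀≢y₃ p = y₂≢y₁ (injective (F 0ᶠ) y₂∈ y₁∈ (trans Y₃ (trans (sym p) (sym Y₀))))

        near≢x₀ : ∀ r {z} {r≤ : True (r ≤? 8)} → z ∈ ball f r N → z ≢ x₀
        near≢x₀ r {r≤ = r≤} p = apart f r 8 {r≤s = r≤} p x₀∉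
        near≢x₁ : ∀ r {z} {r≤ : True (r ≤? 7)} → z ∈ ball f r N → z ≢ x₁
        near≢x₁ r {r≤ = r≤} p = apart f r 7 {r≤s = r≤} p x₁∉

      x₀∉star : x₀ ∉ star f y₀
      x₀∉star = ∉-star (near≢x₀ 1 y₀-near) λ i → near≢x₀ 2 (ball-step f i y₀-near)

      f′ f″ : Colouring k
      f′ = fuse* y₀ x₀ f
      f″ = fuse* y₃ x₁ f′

      y₃∈′ : y₃ ∈ del y₀ x₀ A
      y₃∈′ = ∈-del⁺ y₃∈ (y₀≢y₃ ∘ sym) (near≢x₀ 2 y₃-near)
      x₁∈′ : x₁ ∈ del y₀ x₀ A
      x₁∈′ = ∈-del⁺ x₁∈ (near≢x₁ 1 y₀-near ∘ sym) (irrefl (F 0ᶠ) x₀∈ ∘ trans X₁)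

      private
        nonadjacent : ∀ j {u} → Fused y₀ x₀ (f j) y₃ u → u ≢ x₁
        nonadjacent j (at-w q) p = near≢x₀ 3 (ball-step f j y₃-near) q
        nonadjacent j (other _ _) p = near≢x₁ 3 (ball-step f j y₃-near) p
        -- The new partner of y₃ is f j x₀. As x₀ is clean, this is x₁ for colour 0 only, but there
        -- the partner of y₃ is y₂ and not y₀.
        nonadjacent j (at-v q) p with clean⇒injective {f = f} {x₀} {j} {0ᶠ} x₀-clean (trans p (sym X₁))
        ... | refl = y₀≢y₂ (trans (sym q) (back Y₃ y₂∈))

      x₁∉star : x₁ ∉ star f′ y₃
      x₁∉star = ∉-star (near≢x₁ 2 y₃-near) λ j → nonadjacent j (fused y₀ x₀ (f j) y₃)

      private
        kept : ∀ i {z u} → f i z ≡ u → u ≢ y₀ → u ≢ x₀ → u ≢ y₃ → u ≢ x₁ → f″ i z ≡ u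
        kept i {z} refl p q r s = trans (fuse-other (r ∘ trans (sym e₀)) (s ∘ trans (sym e₀))) e₀
          where
          e₀ : fuse y₀ x₀ (f i) z ≡ f i z
          e₀ = fuse-other p q

      -- The first fusion joins y₁ to x₁, the partner of x₀; the second joins it on to y₂, the
      -- partner of y₃.
      f₀y₁ : f″ 0ᶠ y₁ ≡ y₂
      f₀y₁ = trans (fuse-w (near≢x₁ 2 y₃-near) (trans (fuse-v Y₀) X₁))
        (trans (fuse-other (y₀≢y₂ ∘ sym ∘ trans (sym e₀)) (near≢x₀ 1 y₂-near ∘ trans (sym e₀))) e₀)
        where
        e₀ : f 0ᶠ y₃ ≡ y₂
        e₀ = back Y₃ y₂∈
      f₁y₁ : f″ 1ᶠ y₁ ≡ y₂
      f₁y₁ = kept 1ᶠ Y₂ (y₀≢y₂ ∘ sym) (near≢x₀ 1 y₂-near) (y₃≢y₂ ∘ sym) (near≢x₁ 1 y₂-near)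
      f₀y₂ : f″ 0ᶠ y₂ ≡ y₁
      f₀y₂ = trans (fuse-v (trans (fuse-other (y₀≢y₃ ∘ sym ∘ trans (sym Y₃)) (near≢x₀ 2 y₃-near ∘ trans (sym Y₃))) Y₃))
        (trans (fuse-w (near≢x₀ 1 y₀-near) (back X₁ x₀∈)) (back Y₀ y₁∈))
      f₁y₂ : f″ 1ᶠ y₂ ≡ y₁
      f₁y₂ = kept 1ᶠ (back Y₂ y₁∈) (y₀≢y₁ ∘ sym) (near≢x₀ 0 y₁-near) y₁≢y₃ (near≢x₁ 0 y₁-near)

      L-∈ : ∀ {z} → z ∈ A → z ∈ L → z ∈ del y₃ x₁ (del y₀ x₀ A)
      L-∈ z∈ z∈L = ∈-del⁺ (∈-del⁺ z∈ (λ { refl → in-L 7 y₀∉ z∈L }) (λ { refl → in-N 8 x₀∉ z∈L }))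
                     (λ { refl → in-L 6 y₃∉ z∈L }) (λ { refl → in-N 7 x₁∉ z∈L })

      L-kept : ∀ i {z} → z ∈ A → z ∈ L → f″ i z ≡ f i z
      L-kept i z∈A z∈L = kept i refl
        (λ p → in-L 6 (step∉ (back p z∈A) y₀∈ y₀∉) z∈L)
        (λ p → in-N 7 (step∉ (back p z∈A) x₀∈ x₀∉) z∈L)
        (λ p → in-L 5 (step∉ (back p z∈A) y₃∈ y₃∉) z∈L)
        (λ p → in-N 6 (step∉ (back p z∈A) x₁∈ x₁∉) z∈L)

      private
        -- The tail colours at y₁ and y₂ are kept, except that one whose edge
        -- leads to a deleted vertex u is redirected far away.
        Redirected : V → V → Set
        Redirected u z = ∀ i → (tail f i z ≡ u × tail f″ i z ∉ ball f 6 N) ⊎ tail f″ i z ≡ tail f i z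

        -- As z is clean, at most one kept colour leads from z to u. Its redirected edge ends
        -- outside the ball of radius 6 around N, and all other edges at z end within radius 2.
        redirected-clean : ∀ {z} u → z ∈ ball f 1 N → ¬ Dirty f z → Redirected u z → ¬ Dirty (tail f″) z
        redirected-clean {z} u z-near z-clean view (i , j , i≢j , eq) = go (view i) (view j)
          where
          distinct : tail f i z ≢ tail f j z
          distinct p = z-clean (suc i , suc j , (λ { refl → i≢j refl }) , p)
          go : (tail f i z ≡ u × tail f″ i z ∉ ball f 6 N) ⊎ tail f″ i z ≡ tail f i z →
               (tail f j z ≡ u × tail f″ j z ∉ ball f 6 N) ⊎ tail f″ j z ≡ tail f j z → ⊥
          go (inj₁ (p , _)) (inj₁ (q , _)) = distinct (trans p (sym q))
          go (inj₂ p) (inj₂ q) = distinct (trans (sym p) (trans eq q))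
          go (inj₁ (_ , p)) (inj₂ q) = apart f 2 6 (ball-step f (suc j) z-near) p (trans (sym q) (sym eq))
          go (inj₂ p) (inj₁ (_ , q)) = apart f 2 6 (ball-step f (suc i) z-near) q (trans (sym p) eq)

        redirected-y₁ : Redirected y₃ y₁
        redirected-y₁ i = go (fused y₃ x₁ (f′ (suc i)) y₁)
          where
          near = ball-step f (suc i) y₁-near
          e₀ : f′ (suc i) y₁ ≡ f (suc i) y₁
          e₀ = fuse-other (λ p → y₁-clean (suc i , 0ᶠ , (λ ()) , trans p (sym Y₀))) (near≢x₀ 1 near)
          far₀ : f (suc i) x₁ ∉ ball f 6 N
          far₀ = far-step f F (suc i) x₁∈ x₁∉
          far : f′ (suc i) x₁ ∉ ball f 6 N
          far = subst (_∉ ball f 6 N) (sym (fuse-other (apart f 1 6 y₀-near far₀ ∘ sym)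
            (λ p → x₁-clean (suc i , 0ᶠ , (λ ()) , trans p (sym (back X₁ x₀∈)))))) far₀
          go : ∀ {u} → Fused y₃ x₁ (f′ (suc i)) y₁ u → (tail f i y₁ ≡ y₃ × u ∉ ball f 6 N) ⊎ u ≡ tail f i y₁
          go (at-v p) = inj₁ (trans (sym e₀) p , far)
          go (at-w p) = contradiction (trans (sym e₀) p) (near≢x₁ 1 near)
          go (other _ _) = inj₂ e₀

        redirected-y₂ : Redirected y₀ y₂
        redirected-y₂ i = by (f (suc i) y₂ ≟ y₀)
          where
          by : Dec (f (suc i) y₂ ≡ y₀) → (tail f i y₂ ≡ y₀ × tail f″ i y₂ ∉ ball f 6 N) ⊎ tail f″ i y₂ ≡ tail f i y₂
          by (no ¬p) = inj₂ (kept (suc i) refl ¬p (near≢x₀ 2 near)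
            (λ p → y₂-clean (suc i , 0ᶠ , (λ ()) , trans p (sym Y₃))) (near≢x₁ 2 near))
            where near = ball-step f (suc i) y₂-near
          by (yes p) = inj₁ (p , subst (_∉ ball f 6 N) (sym (trans (fuse-other ≢y₃ ≢x₁) e₀)) (λ q → far (ball-suc f q)))
            where
            far : f (suc i) x₀ ∉ ball f 7 N
            far = far-step f F (suc i) x₀∈ x₀∉
            e₀ : f′ (suc i) y₂ ≡ f (suc i) x₀
            e₀ = fuse-v p
            ≢y₃ : f′ (suc i) y₂ ≢ y₃
            ≢y₃ q = apart f 2 7 y₃-near far (sym (trans (sym e₀) q))
            ≢x₁ : f′ (suc i) y₂ ≢ x₁
            ≢x₁ q = x₀-clean (suc i , 0ᶠ , (λ ()) , trans (sym e₀) (trans q (sym X₁)))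

      y₁-tail-clean : ¬ Dirty (tail f″) y₁
      y₁-tail-clean = redirected-clean y₃ (ball-suc f y₁-near) y₁-clean redirected-y₁

      y₂-tail-clean : ¬ Dirty (tail f″) y₂
      y₂-tail-clean = redirected-clean y₀ y₂-near y₂-clean redirected-y₂

      y₁∈″ : y₁ ∈ del y₃ x₁ (del y₀ x₀ A)
      y₁∈″ = ∈-del⁺ (∈-del⁺ y₁∈ (y₀≢y₁ ∘ sym) (near≢x₀ 0 y₁-near)) y₁≢y₃ (near≢x₁ 0 y₁-near)
      y₂∈″ : y₂ ∈ del y₃ x₁ (del y₀ x₀ A)
      y₂∈″ = ∈-del⁺ (∈-del⁺ y₂∈ (y₀≢y₂ ∘ sym) (near≢x₀ 1 y₂-near)) (y₃≢y₂ ∘ sym) (near≢x₁ 1 y₂-near)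

      y₁∉L : y₁ ∉ L
      y₁∉L = in-L 8 y₁∉
      y₂∉L : y₂ ∉ L
      y₂∉L = in-L 7 y₂∉
      y₁≢y₂ : y₁ ≢ y₂
      y₁≢y₂ = y₂≢y₁ ∘ sym

    -- The gadget is placed far from all dirty vertices and earlier helpers, and x₀ also far from
    -- y₁. The radius 8 leaves room for the few steps taken from y₁ and x₀: all vertices used are
    -- clean, the two places do not interfere, and the earlier helpers keep their partners in every
    -- colour.
    gadget : ∀ {h} (S : State k (suc (suc h))) {H} → Helpers S H →
      (∀ L → length L ≤ suc (dirtiness (col S) (verts S) + length H) → length (ball (col S) 8 L) < length (verts S)) →
      (∀ (S″ : State k h) {y₁ y₂} → Helpers S″ (y₁ ∷ y₂ ∷ H) →
         dirtiness (col S″) (verts S″) ≤ dirtiness (col S) (verts S) + 4 * k → Solved S″) →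
      Solved S
    gadget {h} S {H} helpers sparse continue
      with y₁ , y₁∈ , y₁∉ ← avoid (ball (col S) 8 (dirties (col S) (verts S) ++ H)) (unique S)
             (sparse _ (≤-trans (≤-reflexive (length-++ (dirties (col S) (verts S)))) (n≤1+n _)))
      with x₀ , x₀∈ , x₀∉ ← avoid (ball (col S) 8 (y₁ ∷ dirties (col S) (verts S) ++ H)) (unique S)
             (sparse _ (≤-reflexive (cong suc (length-++ (dirties (col S) (verts S))))))
      = solved-fuse S y₀∈ x₀∈ x₀∉star (solved-fuse S′ y₃∈′ x₁∈′ x₁∉star (continue S″ helpers″ few))
      where
      A = verts S
      f = col S
      L = dirties f A ++ H
      L-clean : ∀ {x} → x ∈ A → x ∉ L → ¬ Dirty f x
      L-clean x∈ x∉ d = x∉ (∈-++⁺ˡ (∈-filter⁺ (dirty? f) x∈ d))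
      H⊆L : ∀ {z} → z ∈ H → z ∈ L
      H⊆L = ∈-++⁺ʳ (dirties f A)
      open Gadget (colouring S) refl refl refl refl y₁∈ x₀∈ {L} L-clean y₁∉ x₀∉
      S′ : State k (suc h)
      S′ = fuseState S y₀∈ x₀∈ x₀∉star
      S″ : State k h
      S″ = fuseState S′ y₃∈′ x₁∈′ x₁∉star
      H-kept : ∀ i {z} → z ∈ H → f″ i z ≡ f i z
      H-kept i z∈ = L-kept i (H⊆ helpers z∈) (H⊆L z∈)
      helpers″ : Helpers S″ (y₁ ∷ f 1ᶠ y₁ ∷ H)
      helpers″ = record
        { H-unique = (y₁≢y₂ ∷ All.tabulate λ { z∈ refl → y₁∉L (H⊆L z∈) })
            ∷ All.tabulate (λ { z∈ refl → y₂∉L (H⊆L z∈) }) ∷ H-unique helpers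
        ; H⊆ = λ { (here refl) → y₁∈″ ; (there (here refl)) → y₂∈″
                 ; (there (there z∈)) → L-∈ (H⊆ helpers z∈) (H⊆L z∈) }
        ; H-merged = λ { (here refl) → trans f₀y₁ (sym f₁y₁) ; (there (here refl)) → trans f₀y₂ (sym f₁y₂)
                       ; (there (there z∈)) → trans (H-kept 0ᶠ z∈) (trans (H-merged helpers z∈) (sym (H-kept 1ᶠ z∈))) }
        ; H-closed = λ { (here refl) → there (here f₀y₁) ; (there (here refl)) → here f₀y₂
                       ; (there (there z∈)) → there (there (subst (_∈ H) (sym (H-kept 0ᶠ z∈)) (H-closed helpers z∈))) }
        ; H-clean = λ { (here refl) → y₁-tail-clean
                      ; (there (here refl)) → y₂-tail-clean
                      ; (there (there z∈)) → λ (i , j , i≢j , eq) → H-clean helpers z∈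
                          (i , j , i≢j , trans (sym (H-kept (suc i) z∈)) (trans eq (H-kept (suc j) z∈))) } }
      few : dirtiness (col S″) (verts S″) ≤ dirtiness f A + 4 * k
      few = begin
        dirtiness (col S″) (verts S″)      ≤⟨ dirtiness-≤ (unique S′) (colouring S′) ⟩
        dirtiness f′ (verts S′) + (k + k)  ≤⟨ +-monoˡ-≤ (k + k) (dirtiness-≤ (unique S) (colouring S)) ⟩
        dirtiness f A + (k + k) + (k + k)  ≡⟨ e₀ (dirtiness f A) k ⟩
        dirtiness f A + 4 * k              ∎
        where
        open ≤-Reasoning
        e₀ : ∀ c k → c + (k + k) + (k + k) ≡ c + 4 * k
        e₀ = solve-∀

    module _ (cs : CleanSolvable (suc κ) M) where
      -- The invariants fix the final number of helpers and of dirty vertices in advance, so that at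
      -- every stage the excluded ball is smaller than the vertex set, which `room` guarantees.
      make-helpers : ∀ r h (S : State k h) {H} → Helpers S H → length H + 2 * r ≡ 2 * b →
                     dirtiness (col S) (verts S) + 4 * k * r ≤ c → room + 2 * r ≤ h → Solved S
      make-helpers zero h S helpers many few h-large = fuse-outside cs h S helpers
        (≤-reflexive (trans (sym many) (+-identityʳ _)))
      make-helpers (suc r) zero S helpers many few h-large =
        contradiction (≤-trans (m≤n+m _ room) h-large) λ ()
      make-helpers (suc r) (suc zero) S helpers many few h-large =
        contradiction (≤-trans (≤-trans (≤-reflexive (sym (*-suc 2 r))) (m≤n+m _ room)) h-large) λ { (s≤s ()) }
      make-helpers (suc r) (suc (suc h)) S {H} helpers many few h-large =
        gadget S helpers sparse λ S″ helpers″ few″ → make-helpers r h S″ helpers″ many′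
          (≤-trans (+-monoˡ-≤ (4 * k * r) few″) (≤-trans (≤-reflexive (e₂ (dirtiness (col S) (verts S)) (4 * k) r)) few))
          (+-cancelˡ-≤ 2 _ _ (≤-trans (≤-reflexive (e₃ room r)) h-large))
        where
        e₁ : ∀ l r → 2 + l + 2 * r ≡ l + 2 * suc r
        e₁ = solve-∀
        e₂ : ∀ d a r → d + a + a * r ≡ d + a * suc r
        e₂ = solve-∀
        e₃ : ∀ a r → 2 + (a + 2 * r) ≡ a + 2 * suc r
        e₃ = solve-∀
        many′ : 2 + length H + 2 * r ≡ 2 * b
        many′ = trans (e₁ (length H) r) many
        sparse : ∀ L → length L ≤ suc (dirtiness (col S) (verts S) + length H) →
                 length (ball (col S) 8 L) < length (verts S)
        sparse L short = begin-strict
          length (ball (col S) 8 L)                        ≡⟨ length-ball (col S) 8 L ⟩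
          suc k ^ 8 * length L                             ≤⟨ *-monoʳ-≤ (suc k ^ 8) short ⟩
          suc k ^ 8 * suc (dirtiness (col S) (verts S) + length H)
            ≤⟨ *-monoʳ-≤ (suc k ^ 8) (s≤s (+-mono-≤
                 (≤-trans (m≤m+n (dirtiness (col S) (verts S)) (4 * k * suc r)) few)
                 (≤-trans (m≤m+n (length H) (2 * suc r)) (≤-reflexive many)))) ⟩
          room                                             ≤⟨ ≤-trans (m≤m+n room _) h-large ⟩
          suc (suc h)                                      <⟨ n<1+n _ ⟩
          suc (suc (suc h))                                ≤⟨ m≤n*m (suc (suc (suc h))) 2 ⟩
          2 * suc (suc (suc h))                            ≡⟨ size S ⟨
          length (verts S)                                 ∎
          where open ≤-Reasoning

      add-colour : CleanSolvable k (room + 2 * b)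
      add-colour h S h-large none = make-helpers b h S no-helpers refl
        (≤-reflexive (cong (λ D → length D + 4 * k * b) none)) h-large
        where
        no-helpers : ∀ {h} {S : State k h} → Helpers S []
        no-helpers = record { H-unique = [] ; H⊆ = λ () ; H-merged = λ () ; H-closed = λ () ; H-clean = λ () }

  clean-solvable : ∀ k → CleanSolvable k (solvableSize k)
  clean-solvable zero          h S _ _ = few-colours z≤n h S
  clean-solvable (suc zero)    h S _ _ = few-colours ≤-refl h S
  clean-solvable (suc (suc κ)) = add-colour κ (solvableSize (suc κ)) (clean-solvable (suc κ))

  -- The counting recursion

  module Recursion (k : ℕ) where
    open Weights k

    choices : Colouring k → V → List V → List V
    choices f v A = A ∖ star f v

    length-choices-≤ : ∀ f v {A} → Unique A → length (choices f v A) ≤ length A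
    length-choices-≤ f v A! = unique-⊆-length (∖-unique (star f v) A!) (proj₁ ∘ ∈-∖⁻)

    length-choices-≥ : ∀ f v {A} → Unique A → length A ≤ length (choices f v A) + K
    length-choices-≥ f v {A} A! = subst (λ t → length A ≤ length (choices f v A) + t) (length-star f v)
      (length-∖ (star f v) A!)

    length-choices-clean : ∀ {f v A} → Unique A → IsColouring A f → v ∈ A → dirties f A ≡ [] →
                           length (choices f v A) + K ≡ length A
    length-choices-clean {f} {v} {A} A! F v∈A none = trans
      (cong (length (choices f v A) +_) (sym (length-star f v)))
      (length-∖-exact (star f v) A! (clean-star-unique F v∈A (clean none v∈A)) (star-⊆ F v∈A))

    -- A good partner leaves at most the penalty Y of one dirty vertex fewer. A bad one may add 2 k
    -- dirty vertices to that, which multiplies Y by `T`, and there are at most `D` bad ones.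
    sum-weights : ∀ {f A v} → Unique A → IsColouring A f → v ∈ A → v ∈ dirties f A ⊎ dirties f A ≡ [] →
      (let Y = weight (pred (dirtiness f A)) ; W = choices f v A) →
      sum (map (λ w → weight (dirtiness (fuse* v w f) (del v w A))) W) ≤ length W * Y + D * (Y * T)
    sum-weights {f} {A} {v} A! F v∈A picked =
      subst (λ t → sum (map X W) ≤ length W * Y + t * (Y * T)) (length-bad f v)
        (sum-map-exceptions _≟_ X Y (Y * T) (∖-unique (star f v) A!) (bad f v)
          (λ w∈ w∉bad → weight-mono (dirtiness-good-≤ A! F v∈A (proj₁ (∈-∖⁻ w∈)) w∉bad picked))
          (λ w∈ → ≤-trans (weight-mono (dirtiness-pick-≤ A! F picked))
                    (≤-trans (≤-reflexive (weight-+ (pred (dirtiness f A)))) (m≤n+m (Y * T) Y))))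
      where
      Y = weight (pred (dirtiness f A))
      W = choices f v A
      X : V → ℕ
      X w = weight (dirtiness (fuse* v w f) (del v w A))

    sum-upper : ∀ (F X : V → ℕ) p R e₀ W → (∀ {w} → w ∈ W → F w * p + R * e₀ ≤ R * (p + X w)) →
                sum (map F W) * p + length W * (R * e₀) ≤ R * (length W * p + sum (map X W))
    sum-upper F X p R e₀ [] h = z≤n
    sum-upper F X p R e₀ (w ∷ W) h = begin
      (F w + S) * p + (R * e₀ + L * (R * e₀))    ≡⟨ e₁ (F w) S p R e₀ L ⟩
      F w * p + R * e₀ + (S * p + L * (R * e₀))  ≤⟨ +-mono-≤ (h (here refl)) (sum-upper F X p R e₀ W (h ∘ there)) ⟩
      R * (p + X w) + R * (L * p + sum (map X W)) ≡⟨ e₂ R p (X w) L (sum (map X W)) ⟩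
      R * (p + L * p + (X w + sum (map X W)))  ∎
      where
      open ≤-Reasoning
      S = sum (map F W)
      L = length W
      e₁ : ∀ a S p R e₀ L → (a + S) * p + (R * e₀ + L * (R * e₀)) ≡ a * p + R * e₀ + (S * p + L * (R * e₀))
      e₁ = solve-∀
      e₂ : ∀ R p x L s → R * (p + x) + R * (L * p + s) ≡ R * (p + L * p + (x + s))
      e₂ = solve-∀

    sum-lower : ∀ (F X : V → ℕ) p R e₀ Q W → (∀ {w} → w ∈ W → R * (p + e₀) ≤ F w * Q * p + R * X w) →
                length W * (R * (p + e₀)) ≤ sum (map F W) * Q * p + R * sum (map X W)
    sum-lower F X p R e₀ Q [] h = z≤n
    sum-lower F X p R e₀ Q (w ∷ W) h = begin
      R * (p + e₀) + L * (R * (p + e₀))          ≤⟨ +-mono-≤ (h (here refl)) (sum-lower F X p R e₀ Q W (h ∘ there)) ⟩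
      F w * Q * p + R * X w + (S * Q * p + R * sum (map X W)) ≡⟨ e₁ (F w) S Q p R (X w) (sum (map X W)) ⟩
      (F w + S) * Q * p + R * (X w + sum (map X W)) ∎
      where
      open ≤-Reasoning
      S = sum (map F W)
      L = length W
      e₁ : ∀ a S Q p R x s → a * Q * p + R * x + (S * Q * p + R * s) ≡ (a + S) * Q * p + R * (x + s)
      e₁ = solve-∀

    length-enum-suc : ∀ h f x xs (let v = pick f x xs) →
      length (enum (suc h) f (x ∷ xs)) ≡
      sum (map (λ w → length (enum h (fuse* v w f) (del v w (x ∷ xs)))) (choices f v (x ∷ xs)))
    length-enum-suc h f x xs = trans (length-concatMap _ W)
      (cong sum (map-cong (λ w → length-map (extend (pick f x xs) w) (enum h (fuse* (pick f x xs) w f) (del (pick f x xs) w (x ∷ xs)))) W))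
      where W = choices f (pick f x xs) (x ∷ xs)

    module _ {f : Colouring k} {x : V} {xs : List V} (A! : Unique (x ∷ xs)) (F : IsColouring (x ∷ xs) f) where
      private
        A = x ∷ xs
        v = pick f x xs
      module _ {w : V} (w∈ : w ∈ choices f v A) where
        choice-∈ : w ∈ A
        choice-∈ = proj₁ (∈-∖⁻ w∈)

        choice-colouring : IsColouring (del v w A) (fuse* v w f)
        choice-colouring = fuse*-colouring F (pick-∈ f x xs) choice-∈ (proj₂ (∈-∖⁻ w∈))

        choice-length : ∀ h → length A ≡ 2 * suc (suc h) → length (del v w A) ≡ 2 * suc h
        choice-length h eq = length-del-suc h A! eq (pick-∈ f x xs) choice-∈ (∉-star⇒≢ (proj₂ (∈-∖⁻ w∈)))

    length-enum-≤ : ∀ h f {A} → Unique A → IsColouring A f → length A ≡ 2 * suc h → length (enum h f A) ≤ enumBound h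
    length-enum-≤ h f {[]} A! F eq = z≤n
    length-enum-≤ zero f {x ∷ []} A! F eq = z≤n
    length-enum-≤ zero f {x ∷ y ∷ A} A! F eq = s≤s z≤n
    length-enum-≤ (suc h) f {A@(x ∷ xs)} A! F eq = begin
      length (enum (suc h) f A)                      ≡⟨ length-enum-suc h f x xs ⟩
      sum (map (λ w → length (enum h (fuse* v w f) (del v w A))) W)
        ≤⟨ sum-map-≤ _ (λ _ → enumBound h) W (λ w∈ → length-enum-≤ h _ (del-unique A!) (choice-colouring A! F w∈) (choice-length A! F w∈ h eq)) ⟩
      sum (map (λ _ → enumBound h) W)                ≡⟨ sum-map-const (enumBound h) W ⟩
      length W * enumBound h                         ≤⟨ *-monoˡ-≤ (enumBound h) (length-choices-≤ f v A!) ⟩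
      length A * enumBound h                         ≡⟨ cong (_* enumBound h) eq ⟩
      2 * suc (suc h) * enumBound h                  ∎
      where
      open ≤-Reasoning
      v = pick f x xs
      W = choices f v A

    module Counting (h₁ : ℕ) (large : E + D * T + 2 ≤ h₁) where
      open Sizes h₁ large

      count : ℕ → Colouring k → List V → ℕ
      count d f A = length (enum (d + h₀) f A)

      -- The increase of E / m d as d decreases absorbs the choices that create dirty vertices.
      count-upper : ∀ d f {A} → Unique A → IsColouring A f → length A ≡ m d →
        count d f A * m d + Q * P d * E ≤ Q * P d * (m d + weight (dirtiness f A))
      count-upper zero f {A} A! F eq = begin
        count 0 f A * m 0 + Q * 1 * E     ≤⟨ +-mono-≤ (*-monoˡ-≤ (m 0) (length-enum-≤ h₀ f A! F eq)) (*-monoʳ-≤ (Q * 1) E≤m-1) ⟩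
        Q + Q * 1 * pred (m 0)            ≡⟨ e₀ Q (m 0) ⟩
        Q * 1 * m 0                       ≤⟨ *-monoʳ-≤ (Q * 1) (m≤m+n (m 0) _) ⟩
        Q * 1 * (m 0 + weight (dirtiness f A)) ∎
        where
        open ≤-Reasoning
        E≤m-1 : E ≤ pred (m 0)
        E≤m-1 = ≤-pred (≤-trans (≤-trans (≤-trans (≤-reflexive (+-comm 1 E)) (+-mono-≤ (m≤m+n E (D * T)) (s≤s z≤n))) large) (h₁≤m 0))
        e₀ : ∀ Q m .{{_ : NonZero m}} → Q + Q * 1 * pred m ≡ Q * 1 * m
        e₀ Q (suc m) = e′ Q m
          where
          e′ : ∀ Q m → Q + Q * 1 * m ≡ Q * 1 * suc m
          e′ = solve-∀
      count-upper (suc d) f {[]} A! F ()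
      count-upper (suc d) f {A@(x ∷ xs)} A! F eq = goal (pick-dirty f x xs)
        where
        v = pick f x xs
        v∈A = pick-∈ f x xs
        W = choices f v A
        p = m d
        R = Q * P d
        Y = weight (pred (dirtiness f A))
        a = sum (map (λ w → count d (fuse* v w f) (del v w A)) W)
        hyp : a * p + length W * (R * E) ≤ R * (length W * p + length W * Y + D * (Y * T))
        hyp = ≤-trans
          (sum-upper (λ w → count d (fuse* v w f) (del v w A)) (λ w → weight (dirtiness (fuse* v w f) (del v w A))) p R E W
            (λ w∈ → count-upper d _ (del-unique A!) (choice-colouring A! F w∈) (choice-length A! F w∈ (d + h₀) eq)))
          (*-monoʳ-≤ R (≤-trans (+-monoʳ-≤ (length W * p) (sum-weights A! F v∈A (pick-dirty f x xs)))
            (≤-reflexive (sym (+-assoc (length W * p) _ _)))))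
        instance _ = >-nonZero (≤-trans (s≤s z≤n) (2≤m d))
        shape : ∀ {X} → a * (p + 2) + R * N (suc d) * E ≤ R * N (suc d) * (p + 2 + X) →
                count (suc d) f A * m (suc d) + Q * P (suc d) * E ≤ Q * P (suc d) * (m (suc d) + X)
        shape {X} h = subst₂ _≤_
          (cong₂ (λ s t → s + t * E) (cong₂ _*_ (sym (length-enum-suc (d + h₀) f x xs)) (sym (m-suc d))) (e₀ Q (P d) (N (suc d))))
          (cong₂ (λ s t → s * (t + X)) (e₀ Q (P d) (N (suc d))) (sym (m-suc d))) h
          where
          e₀ : ∀ Q p n → Q * p * n ≡ Q * (n * p)
          e₀ = solve-∀
        goal : v ∈ dirties f A ⊎ dirties f A ≡ [] →
               count (suc d) f A * m (suc d) + Q * P (suc d) * E ≤ Q * P (suc d) * (m (suc d) + weight (dirtiness f A))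
        goal (inj₂ none) = shape (subst (λ X → a * (p + 2) + R * N (suc d) * E ≤ R * N (suc d) * (p + 2 + X)) (sym X≡K)
          (upper-clean {a} {p} {N (suc d)} {R} {K} {G} (m≤2N d) (subst₂ (λ L y → a * p + L * (R * E) ≤ R * (L * p + L * y + D * (y * T))) L≡N Y≡K hyp)))
          where
          c≡0 : dirtiness f A ≡ 0
          c≡0 = cong length none
          X≡K : weight (dirtiness f A) ≡ K
          X≡K = trans (cong weight c≡0) (*-identityʳ K)
          Y≡K : Y ≡ K
          Y≡K = trans (cong (weight ∘ pred) c≡0) (*-identityʳ K)
          L≡N : length W ≡ N (suc d)
          L≡N = +-cancelʳ-≡ K _ _ (trans (length-choices-clean A! F v∈A none) (trans eq (sym (N+K≡m (suc d)))))
        goal (inj₁ v∈D) with r , p≡E+r ← m≤n⇒∃[o]m+o≡n (E≤m d) =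
          shape (subst (λ X → a * (p + 2) + R * N (suc d) * E ≤ R * N (suc d) * (p + 2 + X)) (sym X≡32Y)
            (dirty-step p≡E+r))
          where
          dirty-step : ∀ {r} → E + r ≡ p → a * (p + 2) + R * N (suc d) * E ≤ R * N (suc d) * (p + 2 + 32 * Y)
          dirty-step {r} E+r≡p = subst (λ p → a * (p + 2) + R * N (suc d) * E ≤ R * N (suc d) * (p + 2 + 32 * Y)) E+r≡p
            (upper-dirty {a} {E} {r} {N (suc d)} {R} {K} {D * (Y * T)} {length W} {Y}
              {{subst NonZero (sym E+r≡p) (>-nonZero (≤-trans (s≤s z≤n) (2≤m d)))}}
              (back (λ p → p + 2 ≤ 2 * N (suc d)) (m≤2N d)) (back (λ p → p + 2 ≤ 2 * p) (m≤2m d))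
              (back (λ p → N (suc d) + K ≡ p + 2) (trans (N+K≡m (suc d)) (m-suc d)))
              (≤-trans (s≤s z≤n) (K≤weight (pred (dirtiness f A)))) (K≤weight (pred (dirtiness f A)))
              (back (λ p → D * (Y * T) ≤ (p + 2) * Y) (exceptional-weight d Y))
              (back (λ p → length W ≤ p + 2) (≤-trans (length-choices-≤ f v A!) (≤-reflexive (trans eq (m-suc d)))))
              (back (λ p → a * p + length W * (R * E) ≤ R * (length W * p + length W * Y + D * (Y * T))) hyp))
            where
            back : ∀ (Φ : ℕ → Set) → Φ p → Φ (E + r)
            back Φ = subst Φ (sym E+r≡p)
          X≡32Y : weight (dirtiness f A) ≡ 32 * Y
          X≡32Y = trans (cong weight (sym (suc-pred (dirtiness f A) {{>-nonZero (∈-length′ v∈D)}}))) (weight-suc (pred (dirtiness f A)))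
            where
            open import Data.List.Membership.Propositional.Properties using () renaming (∈-length to ∈-length′)

      -- This is the bound S `count` ≥ P (1 + (E - weight) / m), void once the weight reaches m + E.
      -- For d = 0 that value is S, which is why only base states of weight at most S are asked to
      -- have a completion.
      count-lower : (∀ f {A} → Unique A → IsColouring A f → length A ≡ m 0 → weight (dirtiness f A) ≤ S → 1 ≤ count 0 f A) →
        ∀ d f {A} → Unique A → IsColouring A f → length A ≡ m d →
        P d * (m d + E) ≤ count d f A * S * m d + P d * weight (dirtiness f A)
      count-lower base zero f {A} A! F eq with ≤-total (weight (dirtiness f A)) S
      ... | inj₂ S≤X = ≤-trans (*-monoʳ-≤ 1 S≤X) (m≤n+m _ (count 0 f A * S * m 0))
      ... | inj₁ X≤S = ≤-trans (begin
        1 * S                   ≤⟨ *-monoˡ-≤ S (base f A! F eq X≤S) ⟩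
        count 0 f A * S         ≤⟨ m≤m*n (count 0 f A * S) (m 0) ⟩
        count 0 f A * S * m 0   ∎) (m≤m+n _ _)
        where open ≤-Reasoning
      count-lower base (suc d) f {[]} A! F ()
      count-lower base (suc d) f {A@(x ∷ xs)} A! F eq = goal (pick-dirty f x xs)
        where
        v = pick f x xs
        v∈A = pick-∈ f x xs
        W = choices f v A
        p = m d
        R = P d
        Y = weight (pred (dirtiness f A))
        Σ = sum (map (λ w → count d (fuse* v w f) (del v w A)) W)
        hyp : length W * (R * (p + E)) ≤ Σ * S * p + R * (length W * Y + D * (Y * T))
        hyp = ≤-trans
          (sum-lower (λ w → count d (fuse* v w f) (del v w A)) (λ w → weight (dirtiness (fuse* v w f) (del v w A))) p R E S W
            (λ w∈ → count-lower base d _ (del-unique A!) (choice-colouring A! F w∈) (choice-length A! F w∈ (d + h₀) eq)))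
          (+-monoʳ-≤ (Σ * S * p) (*-monoʳ-≤ R (sum-weights A! F v∈A (pick-dirty f x xs))))
        instance _ = >-nonZero (≤-trans (s≤s z≤n) (2≤m d))
        shape : ∀ {X} → R * N (suc d) * (p + 2 + E) ≤ Σ * S * (p + 2) + R * N (suc d) * X →
                P (suc d) * (m (suc d) + E) ≤ count (suc d) f A * S * m (suc d) + P (suc d) * X
        shape {X} h = subst₂ _≤_
          (cong₂ (λ s t → s * (t + E)) (*-comm R (N (suc d))) (sym (m-suc d)))
          (cong₂ (λ s t → s + t * X) (cong₂ (λ c m → c * S * m) (sym (length-enum-suc (d + h₀) f x xs)) (sym (m-suc d))) (*-comm R (N (suc d)))) h
        goal : v ∈ dirties f A ⊎ dirties f A ≡ [] →
               P (suc d) * (m (suc d) + E) ≤ count (suc d) f A * S * m (suc d) + P (suc d) * weight (dirtiness f A)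
        goal (inj₂ none) = shape (subst (λ X → R * N (suc d) * (p + 2 + E) ≤ Σ * S * (p + 2) + R * N (suc d) * X) (sym X≡K)
          (lower-clean {Σ * S} {p} {N (suc d)} {R} {K} {G} (m≤2N d) (subst₂ (λ L y → L * (R * (p + E)) ≤ Σ * S * p + R * (L * y + D * (y * T))) L≡N Y≡K hyp)))
          where
          c≡0 : dirtiness f A ≡ 0
          c≡0 = cong length none
          X≡K : weight (dirtiness f A) ≡ K
          X≡K = trans (cong weight c≡0) (*-identityʳ K)
          Y≡K : Y ≡ K
          Y≡K = trans (cong (weight ∘ pred) c≡0) (*-identityʳ K)
          L≡N : length W ≡ N (suc d)
          L≡N = +-cancelʳ-≡ K _ _ (trans (length-choices-clean A! F v∈A none) (trans eq (sym (N+K≡m (suc d)))))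
        goal (inj₁ v∈D) = shape (subst (λ X → R * N (suc d) * (p + 2 + E) ≤ Σ * S * (p + 2) + R * N (suc d) * X) (sym X≡32Y)
          (lower-dirty {Σ * S} {p} {E} {N (suc d)} {R} {D * (Y * T)} {length W} {Y} (m≤2N d) (m≤2m d) (≤-trans (s≤s z≤n) (K≤weight (pred (dirtiness f A))))
            (exceptional-weight d Y) N≤L hyp))
          where
          N≤L : N (suc d) ≤ length W
          N≤L = +-cancelʳ-≤ K _ _ (≤-trans (≤-reflexive (trans (N+K≡m (suc d)) (sym eq))) (length-choices-≥ f v A!))
          X≡32Y : weight (dirtiness f A) ≡ 32 * Y
          X≡32Y = trans (cong weight (sym (suc-pred (dirtiness f A) {{>-nonZero (∈-length′ v∈D)}}))) (weight-suc (pred (dirtiness f A)))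
            where
            open import Data.List.Membership.Propositional.Properties using () renaming (∈-length to ∈-length′)

-- Hamilton cycles as closed alternating walks

module HamiltonCycles where
  open import Defs using (CyclicSucc)
  open import Data.Fin.Permutation using (Permutation′; permutation)
  open import Data.Nat hiding (_≟_)
  open import Data.Nat.Properties hiding (_≟_)
  open import Data.Nat.Tactic.RingSolver using (solve-∀)

  -- The walk from v that follows g and f alternately. If it meets itself then
  -- because it has closed up, so connectedness makes its period n.
  module AlternatingWalk {n : ℕ} (f g : Fin n → Fin n)
    (f-invol : ∀ x → f (f x) ≡ x) (g-invol : ∀ x → g (g x) ≡ x)
    (f-irrefl : ∀ x → f x ≢ x) (g-irrefl : ∀ x → g x ≢ x)
    (connected : ∀ (s : Fin n → Bool) → (∀ x → s (f x) ≡ s x) → (∀ x → s (g x) ≡ s x) → ∀ x y → s x ≡ s y)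
    (v : Fin n) where

    φ : Bool → Fin n → Fin n
    φ true  = g
    φ false = f

    even : ℕ → Bool
    even zero    = true
    even (suc i) = not (even i)

    even-2+ : ∀ t i → even (2 * t + i) ≡ even i
    even-2+ zero i = refl
    even-2+ (suc t) i = trans (cong (λ j → even (j + i)) (*-suc 2 t)) (trans (not-involutive _) (even-2+ t i))

    z : ℕ → Fin n
    z zero    = v
    z (suc i) = φ (even i) (z i)

    φ-invol : ∀ b x → φ b (φ b x) ≡ x
    φ-invol true  = g-invol
    φ-invol false = f-invol

    φ-irrefl : ∀ b x → φ b x ≢ x
    φ-irrefl true  = g-irrefl
    φ-irrefl false = f-irrefl

    -- The walk leaves position i and arrives at position 2 t + 1 + i by the same matching. A
    -- coincidence therefore moves inward by one step at both ends, until a matching has a fixed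
    -- point.
    odd-distinct : ∀ t i → z i ≢ z (suc (2 * t + i))
    odd-distinct zero i p = φ-irrefl (even i) (z i) (sym p)
    odd-distinct (suc t) i p = odd-distinct t (suc i) (begin
      z (suc i)                              ≡⟨ cong (φ (even i)) p ⟩
      φ (even i) (z (suc (2 * suc t + i)))   ≡⟨ cong (λ b → φ b (z (suc (2 * suc t + i)))) (even-2+ (suc t) i) ⟨
      φ (even (2 * suc t + i)) (φ (even (2 * suc t + i)) (z (2 * suc t + i)))
                                             ≡⟨ φ-invol (even (2 * suc t + i)) _ ⟩
      z (2 * suc t + i)                      ≡⟨ cong z (trans (cong (_+ i) (*-suc 2 t)) (cong suc (sym (+-suc (2 * t) i)))) ⟩
      z (suc (2 * t + suc i))                ∎)
      where open ≡-Reasoning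

    -- At an even distance both positions were reached by the same matching, so a coincidence can be
    -- traced back to the start.
    even-shift : ∀ t i → z i ≡ z (2 * t + i) → z 0 ≡ z (2 * t)
    even-shift t zero p = trans p (cong z (+-identityʳ (2 * t)))
    even-shift t (suc i) p = even-shift t i (begin
      z i                                               ≡⟨ φ-invol (even i) (z i) ⟨
      φ (even i) (z (suc i))                            ≡⟨ cong (φ (even i)) (trans p (cong z (+-suc (2 * t) i))) ⟩
      φ (even i) (φ (even (2 * t + i)) (z (2 * t + i))) ≡⟨ cong (λ b → φ b (z (suc (2 * t + i)))) (even-2+ t i) ⟨
      φ (even (2 * t + i)) (z (suc (2 * t + i)))        ≡⟨ φ-invol (even (2 * t + i)) _ ⟩
      z (2 * t + i)                                     ∎)
      where open ≡-Reasoning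

    Visited : ℕ → Fin n → Set
    Visited p x = ∃[ i ] (z (toℕ {p} i) ≡ x)

    visit : ∀ {p x} i → i < p → z i ≡ x → Visited p x
    visit i i<p q = fromℕ< i<p , trans (cong z (Fin.toℕ-fromℕ< i<p)) q

    module Period (p : ℕ) (0<p : 0 < p) (p-even : even p ≡ true) (closes : z p ≡ z 0) where
      private
        visit-≤ : ∀ {x} i → i ≤ p → z i ≡ x → Visited p x
        visit-≤ i i≤p q with m≤n⇒m<n∨m≡n i≤p
        ... | inj₁ i<p = visit i i<p q
        ... | inj₂ refl = visit 0 0<p (trans (sym closes) q)

        pred-step : ∀ b i → i ≤ p → 0 < i → even i ≡ not b → Visited p (φ b (z i))
        pred-step b (suc i) i<p _ e₀ = visit i i<p (trans (sym (φ-invol b (z i))) (cong (λ c → φ b (φ c (z i))) (sym even-i≡b)))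
          where
          even-i≡b : even i ≡ b
          even-i≡b = trans (sym (not-involutive (even i))) (trans (cong not e₀) (not-involutive b))

        back : ∀ b i → i < p → even i ≡ not b → Visited p (φ b (z i))
        back true  zero    _   ()
        back false zero    _   _ = subst (λ x → Visited p (f x)) closes (pred-step false p ≤-refl 0<p p-even)
        back b     (suc i) i<p e₀ = pred-step b (suc i) (<⇒≤ i<p) (s≤s z≤n) e₀

        forth : ∀ b i → i < p → even i ≡ b → Visited p (φ b (z i))
        forth b i i<p e₀ = visit-≤ (suc i) i<p (cong (λ c → φ c (z i)) e₀)

      -- One matching leads to the next position and the other to the previous one. At the seam the
      -- matchings fit because p is even: the last step before p uses f, the one from 0 uses g.
      step : ∀ b {x} → Visited p x → Visited p (φ b x)
      step true (i , refl) with even (toℕ i) in e₀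
      ... | true  = forth true (toℕ i) (Fin.toℕ<n i) e₀
      ... | false = back true (toℕ i) (Fin.toℕ<n i) e₀
      step false (i , refl) with even (toℕ i) in e₀
      ... | false = forth false (toℕ i) (Fin.toℕ<n i) e₀
      ... | true  = back false (toℕ i) (Fin.toℕ<n i) e₀

      visited? : ∀ x → Bool
      visited? x = does (Fin.any? λ (i : Fin p) → z (toℕ i) Fin.≟ x)

      visited?-sound : ∀ x → visited? x ≡ true → Visited p x
      visited?-sound x e₀ with Fin.any? (λ (i : Fin p) → z (toℕ i) Fin.≟ x)
      ... | yes q = q

      visited?-complete : ∀ x → Visited p x → visited? x ≡ true
      visited?-complete x q with Fin.any? (λ (i : Fin p) → z (toℕ i) Fin.≟ x)
      ... | yes _ = refl
      ... | no ¬q = contradiction q ¬q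

      visited?-step : ∀ b x → visited? (φ b x) ≡ visited? x
      visited?-step b x with Fin.any? (λ (i : Fin p) → z (toℕ i) Fin.≟ φ b x) | Fin.any? (λ (i : Fin p) → z (toℕ i) Fin.≟ x)
      ... | yes _ | yes _ = refl
      ... | no _  | no _  = refl
      ... | yes q | no ¬q = contradiction (subst (Visited p) (φ-invol b x) (step b q)) ¬q
      ... | no ¬q | yes q = contradiction (step b q) ¬q

      all-visited : ∀ x → Visited p x
      all-visited x = visited?-sound x (trans (connected visited? (visited?-step false) (visited?-step true) x v)
        (visited?-complete v (visit 0 0<p refl)))

      n≤p : n ≤ p
      n≤p = Fin.injective⇒≤ {f = λ x → proj₁ (all-visited x)} λ {x} {y} q →
        trans (sym (proj₂ (all-visited x))) (trans (cong (λ i → z (toℕ i)) q) (proj₂ (all-visited y)))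

    data EvenOrOdd : ℕ → Set where
      is-even : ∀ t → EvenOrOdd (2 * t)
      is-odd  : ∀ t → EvenOrOdd (suc (2 * t))

    evenOrOdd : ∀ d → EvenOrOdd d
    evenOrOdd zero = is-even 0
    evenOrOdd (suc d) with evenOrOdd d
    ... | is-even t = is-odd t
    ... | is-odd t = subst EvenOrOdd (*-suc 2 t) (is-even (suc t))

    repeat : ∀ d i → 0 < d → z i ≡ z (d + i) → even d ≡ true × z d ≡ z 0 × n ≤ d
    repeat d i 0<d p with evenOrOdd d
    ... | is-odd t = contradiction p (odd-distinct t i)
    ... | is-even t = even-2t , sym closes , Period.n≤p (2 * t) 0<d even-2t (sym closes)
      where
      closes = even-shift t i p
      even-2t : even (2 * t) ≡ true
      even-2t = trans (cong even (sym (+-identityʳ (2 * t)))) (even-2+ t 0)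

    -- Among n + 1 positions two coincide, so the walk closes after some d ≤ n steps; as it has then
    -- visited every vertex, d is at least n.
    period-n : even n ≡ true × z n ≡ z 0
    period-n with Fin.pigeonhole (n<1+n n) (λ i → z (toℕ i))
    ... | i , j , i<j , p with m≤n⇒∃[o]m+o≡n (<⇒≤ i<j)
    ...   | d , i+d≡j with repeat d (toℕ i) (0<d d i+d≡j) (trans p (cong z (trans (sym i+d≡j) (+-comm (toℕ i) d))))
      where
      0<d : ∀ d → toℕ i + d ≡ toℕ j → 0 < d
      0<d zero e₀ = contradiction (trans (sym (+-identityʳ (toℕ i))) e₀) (<⇒≢ i<j)
      0<d (suc d) _ = s≤s z≤n
    ...     | e₀ , closes , n≤d = subst (λ d → even d ≡ true × z d ≡ z 0) (≤-antisym d≤n n≤d) (e₀ , closes)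
      where
      d≤n : d ≤ n
      d≤n = ≤-trans (m≤n+m d (toℕ i)) (≤-trans (≤-reflexive i+d≡j) (≤-pred (Fin.toℕ<n j)))

    z-injective-< : ∀ {i j} → i < j → j < n → z i ≢ z j
    z-injective-< {i} {j} i<j j<n p with m≤n⇒∃[o]m+o≡n (<⇒≤ i<j)
    ... | zero , e₀ = contradiction (trans (sym (+-identityʳ i)) e₀) (<⇒≢ i<j)
    ... | suc d , e₀ = <⇒≱ (≤-<-trans (≤-trans (m≤n+m (suc d) i) (≤-reflexive e₀)) j<n)
          (proj₂ (proj₂ (repeat (suc d) i (s≤s z≤n) (trans p (cong z (trans (sym e₀) (+-comm i (suc d))))))))

    z-injective : ∀ {i j : Fin n} → z (toℕ i) ≡ z (toℕ j) → i ≡ j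
    z-injective {i} {j} p with <-cmp (toℕ i) (toℕ j)
    ... | tri< i<j _ _ = contradiction p (z-injective-< i<j (Fin.toℕ<n j))
    ... | tri≈ _ i≡j _ = Fin.toℕ-injective i≡j
    ... | tri> _ _ j<i = contradiction (sym p) (z-injective-< j<i (Fin.toℕ<n i))

    0<n : 0 < n
    0<n = ≤-trans (s≤s z≤n) (Fin.toℕ<n v)

    visited : ∀ x → Visited n x
    visited = Period.all-visited n 0<n (proj₁ period-n) (proj₂ period-n)

    order : Permutation′ n
    order = permutation (λ i → z (toℕ i)) (λ x → proj₁ (visited x))
      (λ x → proj₂ (visited x))
      (λ i → z-injective (proj₂ (visited (z (toℕ i)))))

    succ-edge : ∀ {i j : Fin n} → CyclicSucc i j → φ (even (toℕ i)) (z (toℕ i)) ≡ z (toℕ j)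
    succ-edge (inj₁ p) = cong z (sym p)
    succ-edge {i} {j} (inj₂ (p , q)) = trans (cong z p) (trans (proj₂ period-n) (cong z (sym q)))

    next : ∀ i → ∃[ j ] CyclicSucc {n} i j
    next i with m≤n⇒m<n∨m≡n (Fin.toℕ<n i)
    ... | inj₁ i<n = fromℕ< i<n , inj₁ (Fin.toℕ-fromℕ< i<n)
    ... | inj₂ i≡n = fromℕ< 0<n , inj₂ (i≡n , Fin.toℕ-fromℕ< 0<n)

    previous : ∀ j → ∃[ i ] (CyclicSucc {n} i j × even (toℕ i) ≡ not (even (toℕ j)))
    previous j with toℕ j in e₀ | Fin.toℕ<n j
    ... | suc i | i<n = fromℕ< (<⇒≤ i<n) , inj₁ (cong suc (sym eq)) ,
            trans (cong even eq) (sym (not-involutive (even i)))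
      where
      eq = Fin.toℕ-fromℕ< (<⇒≤ i<n)
    ... | zero | _ = fromℕ< pred<n , inj₂ (trans (cong suc eq) n≡ , refl) , trans (cong even eq) even-pred
      where
      pred<n : pred n < n
      pred<n = ≤-reflexive (suc-pred n {{>-nonZero 0<n}})
      n≡ = suc-pred n {{>-nonZero 0<n}}
      eq = Fin.toℕ-fromℕ< pred<n
      even-pred : even (pred n) ≡ false
      even-pred = trans (sym (not-involutive _)) (cong not (trans (cong even n≡) (proj₁ period-n)))

    edge⇒cyclic : ∀ b i j → φ b (z (toℕ i)) ≡ z (toℕ j) → CyclicSucc i j ⊎ CyclicSucc j i
    edge⇒cyclic b i j p with even (toℕ i) Data.Bool.≟ b
    ... | yes even≡b with next i
    ...   | i′ , s = inj₁ (subst (CyclicSucc i) (z-injective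
            (trans (sym (succ-edge s)) (trans (cong (λ c → φ c (z (toℕ i))) even≡b) p))) s)
    edge⇒cyclic b i j p | no even≢b with previous i
    ...   | i′ , s , e₀ = inj₂ (subst (λ t → CyclicSucc t i) (z-injective (begin
        z (toℕ i′)                                        ≡⟨ φ-invol (even (toℕ i′)) _ ⟨
        φ (even (toℕ i′)) (φ (even (toℕ i′)) (z (toℕ i′))) ≡⟨ cong (φ (even (toℕ i′))) (succ-edge s) ⟩
        φ (even (toℕ i′)) (z (toℕ i))                     ≡⟨ cong (λ c → φ c (z (toℕ i))) (trans e₀ (not-≢ (even (toℕ i)) b even≢b)) ⟩
        φ b (z (toℕ i))                                   ≡⟨ p ⟩
        z (toℕ j)                                         ∎)) s)
      where
      open ≡-Reasoning
      not-≢ : ∀ a b → a ≢ b → not a ≡ b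
      not-≢ true  true  q = contradiction refl q
      not-≢ true  false q = refl
      not-≢ false true  q = refl
      not-≢ false false q = contradiction refl q

    cyclic⇒edge : ∀ i j → CyclicSucc i j ⊎ CyclicSucc j i → ∃[ b ] φ b (z (toℕ i)) ≡ z (toℕ j)
    cyclic⇒edge i j (inj₁ s) = even (toℕ i) , succ-edge s
    cyclic⇒edge i j (inj₂ s) = even (toℕ j) , trans (cong (φ (even (toℕ j))) (sym (succ-edge s))) (φ-invol (even (toℕ j)) _)

-- Bounds for e and its square by powers of 1 + 1/N

module ExponentialBounds where
  open import Data.Nat hiding (_≟_)
  open import Data.Nat.Properties hiding (_≟_)
  open import Data.Nat.Tactic.RingSolver using (solve-∀)

  open ≤-Reasoning

  -- taylor p s j = j! p^j Σ_{i ≤ j} (s/p)^i / i!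
  taylor : ℕ → ℕ → ℕ → ℕ
  taylor p s zero    = 1
  taylor p s (suc j) = suc j * p * taylor p s j + s ^ suc j

  -- expNum j = j! Σ_{i ≤ j} 1 / i!
  expNum : ℕ → ℕ
  expNum zero    = 1
  expNum (suc j) = suc j * expNum j + 1

  taylor-diagonal : ∀ p j → taylor p p j ≡ p ^ j * expNum j
  taylor-diagonal p zero = refl
  taylor-diagonal p (suc j) = trans (cong (λ t → suc j * p * t + p ^ suc j) (taylor-diagonal p j))
    (e₀ p (suc j) (p ^ j) (expNum j))
    where
    e₀ : ∀ p j q x → j * p * (q * x) + p * q ≡ p * q * (j * x + 1)
    e₀ = solve-∀

  taylor-zero : ∀ p j → taylor p 0 j ≡ p ^ j * j !
  taylor-zero p zero = refl
  taylor-zero p (suc j) = trans (cong (λ t → suc j * p * t + 0) (taylor-zero p j)) (e₀ p (suc j) (p ^ j) (j !))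
    where
    e₀ : ∀ p j q x → j * p * (q * x) + 0 ≡ p * q * (j * x)
    e₀ = solve-∀

  -- Convexity: the increment of a power is at most its derivative at the right end point, and in
  -- `^-suc-≥` at least that at the left one.
  ^-suc-≤ : ∀ s j → suc s ^ suc j ≤ s ^ suc j + suc j * suc s ^ j
  ^-suc-≤ s zero = ≤-reflexive (e₀ s)
    where
    e₀ : ∀ s → suc s * 1 ≡ s * 1 + 1 * 1
    e₀ = solve-∀
  ^-suc-≤ s (suc j) = begin
    suc s * suc s ^ suc j                                  ≡⟨ e₁ s (suc s ^ suc j) ⟩
    s * suc s ^ suc j + suc s ^ suc j                      ≤⟨ +-monoˡ-≤ (suc s ^ suc j) (*-monoʳ-≤ s (^-suc-≤ s j)) ⟩
    s * (s ^ suc j + suc j * suc s ^ j) + suc s ^ suc j    ≤⟨ +-monoˡ-≤ (suc s ^ suc j) (begin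
      s * (s ^ suc j + suc j * suc s ^ j)                  ≡⟨ e₂ s (s ^ suc j) (suc j) (suc s ^ j) ⟩
      s * s ^ suc j + suc j * (s * suc s ^ j)              ≤⟨ +-monoʳ-≤ (s * s ^ suc j) (*-monoʳ-≤ (suc j) (*-monoˡ-≤ (suc s ^ j) (n≤1+n s))) ⟩
      s * s ^ suc j + suc j * suc s ^ suc j                ∎) ⟩
    s * s ^ suc j + suc j * suc s ^ suc j + suc s ^ suc j  ≡⟨ e₃ (s * s ^ suc j) (suc j) (suc s ^ suc j) ⟩
    s * s ^ suc j + suc (suc j) * suc s ^ suc j            ∎
    where
    e₁ : ∀ s x → suc s * x ≡ s * x + x
    e₁ = solve-∀
    e₂ : ∀ s x j y → s * (x + j * y) ≡ s * x + j * (s * y)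
    e₂ = solve-∀
    e₃ : ∀ a j y → a + j * y + y ≡ a + suc j * y
    e₃ = solve-∀

  ^-suc-≥ : ∀ s j → s ^ suc j + suc j * s ^ j ≤ suc s ^ suc j
  ^-suc-≥ s zero = ≤-reflexive (e₀ s)
    where
    e₀ : ∀ s → s * 1 + 1 * 1 ≡ suc s * 1
    e₀ = solve-∀
  ^-suc-≥ s (suc j) = begin
    s * s ^ suc j + suc (suc j) * s ^ suc j                      ≤⟨ m≤m+n _ (suc j * s ^ j) ⟩
    s * s ^ suc j + suc (suc j) * (s * s ^ j) + suc j * s ^ j    ≡⟨ e₀ s (s ^ j) (suc j) ⟩
    suc s * (s ^ suc j + suc j * s ^ j)                          ≤⟨ *-monoʳ-≤ (suc s) (^-suc-≥ s j) ⟩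
    suc s * suc s ^ suc j                                        ∎
    where
    e₀ : ∀ s x j → s * (s * x) + suc j * (s * x) + j * x ≡ suc s * (s * x + j * x)
    e₀ = solve-∀

  -- The same for the Taylor polynomial of exp, on an interval of length 1/p with the derivative at
  -- the right end. The derivative is the polynomial without its top term, whence the summand
  -- `suc s ^ j`.
  taylor-convex : ∀ p s j → p * taylor p (suc s) j + suc s ^ j ≤ taylor p (suc s) j + p * taylor p s j
  taylor-convex p s zero = ≤-reflexive (+-comm (p * 1) 1)
  taylor-convex p s (suc j) = begin
    p * (j′ * p * t′ + s′ ^ j′) + s′ ^ j′                         ≤⟨ +-monoˡ-≤ (s′ ^ j′) (*-monoʳ-≤ p (+-monoʳ-≤ (j′ * p * t′) (^-suc-≤ s j))) ⟩
    p * (j′ * p * t′ + (s ^ j′ + j′ * s′ ^ j)) + s′ ^ j′           ≡⟨ e₁ p j′ t′ (s ^ j′) (s′ ^ j) (s′ ^ j′) ⟩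
    j′ * p * (p * t′ + s′ ^ j) + (p * s ^ j′ + s′ ^ j′)           ≤⟨ +-monoˡ-≤ (p * s ^ j′ + s′ ^ j′) (*-monoʳ-≤ (j′ * p) (taylor-convex p s j)) ⟩
    j′ * p * (t′ + p * t) + (p * s ^ j′ + s′ ^ j′)                ≡⟨ e₂ p j′ t′ t (s ^ j′) (s′ ^ j′) ⟩
    j′ * p * t′ + s′ ^ j′ + p * (j′ * p * t + s ^ j′)              ∎
    where
    j′ = suc j
    s′ = suc s
    t′ = taylor p s′ j
    t = taylor p s j
    e₁ : ∀ p j′ t′ x y z → p * (j′ * p * t′ + (x + j′ * y)) + z ≡ j′ * p * (p * t′ + y) + (p * x + z)
    e₁ = solve-∀
    e₂ : ∀ p j′ t′ t x z → j′ * p * (t′ + p * t) + (p * x + z) ≡ j′ * p * t′ + z + p * (j′ * p * t + x)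
    e₂ = solve-∀

  -- Convexity with the derivative at the left end; the derivative of the polynomial of degree j + 1
  -- is the one of degree j.
  taylor-step-≥ : ∀ p s j → taylor p s (suc j) + suc j * taylor p s j ≤ taylor p (suc s) (suc j)
  taylor-step-≥ p s zero = ≤-reflexive (e₀ p s)
    where
    e₀ : ∀ p s → 1 * p * 1 + s * 1 + 1 * 1 ≡ 1 * p * 1 + suc s * 1
    e₀ = solve-∀
  taylor-step-≥ p s (suc j) = begin
    j′ * p * t + s ^ j′ + j′ * t                       ≡⟨ e₁ p j′ t₀ (suc j) (s ^ suc j) (s ^ j′) ⟩
    j′ * p * (t + suc j * t₀) + (s ^ j′ + j′ * s ^ suc j) ≤⟨ +-mono-≤ (*-monoʳ-≤ (j′ * p) (taylor-step-≥ p s j)) (^-suc-≥ s (suc j)) ⟩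
    j′ * p * taylor p (suc s) (suc j) + suc s ^ j′    ∎
    where
    j′ = suc (suc j)
    t₀ = taylor p s j
    t = taylor p s (suc j)
    e₁ : ∀ p j′ t₀ i x y → j′ * p * (i * p * t₀ + x) + y + j′ * (i * p * t₀ + x) ≡
                          j′ * p * (i * p * t₀ + x + i * t₀) + (y + j′ * x)
    e₁ = solve-∀

  -- e ≤ (1 + 1/N)^(N+1)
  expNum-upper : ∀ N j → N ^ suc N * expNum j ≤ suc N ^ suc N * j !
  expNum-upper N j = *-cancelˡ-≤ (p ^ j) {{m^n≢0 p j}} (begin
    p ^ j * (N ^ p * expNum j)   ≡⟨ e₀ (p ^ j) (N ^ p) (expNum j) ⟩
    N ^ p * (p ^ j * expNum j)   ≡⟨ cong (N ^ p *_) (taylor-diagonal p j) ⟨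
    N ^ p * taylor p p j         ≤⟨ iterate p ⟩
    p ^ p * taylor p 0 j         ≡⟨ cong (p ^ p *_) (taylor-zero p j) ⟩
    p ^ p * (p ^ j * j !)        ≡⟨ e₀ (p ^ p) (p ^ j) (j !) ⟩
    p ^ j * (p ^ p * j !)        ∎)
    where
    p = suc N
    e₀ : ∀ a b c → a * (b * c) ≡ b * (a * c)
    e₀ = solve-∀
    e′ : ∀ a b c → a * b * c ≡ b * (a * c)
    e′ = solve-∀
    step : ∀ s → N * taylor p (suc s) j ≤ p * taylor p s j
    step s = +-cancelˡ-≤ (taylor p (suc s) j) _ _ (≤-trans (m≤m+n _ (suc s ^ j)) (taylor-convex p s j))
    iterate : ∀ s → N ^ s * taylor p s j ≤ p ^ s * taylor p 0 j
    iterate zero = ≤-refl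
    iterate (suc s) = begin
      N * N ^ s * taylor p (suc s) j    ≡⟨ e′ N (N ^ s) (taylor p (suc s) j) ⟩
      N ^ s * (N * taylor p (suc s) j)  ≤⟨ *-monoʳ-≤ (N ^ s) (step s) ⟩
      N ^ s * (p * taylor p s j)        ≡⟨ e₀ (N ^ s) p (taylor p s j) ⟩
      p * (N ^ s * taylor p s j)        ≤⟨ *-monoʳ-≤ p (iterate s) ⟩
      p * (p ^ s * taylor p 0 j)        ≡⟨ *-assoc p (p ^ s) _ ⟨
      p * p ^ s * taylor p 0 j          ∎

  -- (1 + 1/p)^p ≤ e
  expNum-lower : ∀ p .{{_ : NonZero p}} → p ! * suc p ^ p ≤ expNum p * p ^ p
  expNum-lower p = begin
    p ! * suc p ^ p        ≤⟨ iterate p ⟩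
    taylor p p p           ≡⟨ taylor-diagonal p p ⟩
    p ^ p * expNum p       ≡⟨ *-comm (p ^ p) (expNum p) ⟩
    expNum p * p ^ p       ∎
    where
    e₁ : ∀ s f p x → suc s * f * (suc p * x) ≡ suc s * p * (f * x) + suc s * (f * x)
    e₁ = solve-∀
    -- The degree rises together with s: a step of length 1/p from the polynomial of degree s + 1
    -- gains the one of degree s over p, which gives the factor 1 + 1/p.
    iterate : ∀ s → s ! * suc p ^ s ≤ taylor p s s
    iterate zero = ≤-refl
    iterate (suc s) = begin
      suc s * s ! * (suc p * suc p ^ s)                      ≡⟨ e₁ s (s !) p (suc p ^ s) ⟩
      suc s * p * (s ! * suc p ^ s) + suc s * (s ! * suc p ^ s)
        ≤⟨ +-mono-≤ (*-monoʳ-≤ (suc s * p) (iterate s)) (*-monoʳ-≤ (suc s) (iterate s)) ⟩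
      suc s * p * taylor p s s + suc s * taylor p s s        ≤⟨ +-monoˡ-≤ (suc s * taylor p s s) (m≤m+n (suc s * p * taylor p s s) (s ^ suc s)) ⟩
      taylor p s (suc s) + suc s * taylor p s s              ≤⟨ taylor-step-≥ p s s ⟩
      taylor p (suc s) (suc s)                               ∎

  expNum-mono : ∀ {i j} → i ≤′ j → expNum i * j ! ≤ expNum j * i !
  expNum-mono ≤′-refl = ≤-refl
  expNum-mono {i} (≤′-step {j} i≤j) = begin
    expNum i * (suc j * j !)         ≡⟨ e₀ (expNum i) (suc j) (j !) ⟩
    suc j * (expNum i * j !)         ≤⟨ *-monoʳ-≤ (suc j) (expNum-mono i≤j) ⟩
    suc j * (expNum j * i !)         ≡⟨ *-assoc (suc j) (expNum j) (i !) ⟨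
    suc j * expNum j * i !           ≤⟨ *-monoˡ-≤ (i !) (m≤m+n (suc j * expNum j) 1) ⟩
    (suc j * expNum j + 1) * i !     ∎
    where
    e₀ : ∀ a b c → a * (b * c) ≡ b * (a * c)
    e₀ = solve-∀

  !≤expNum : ∀ j → j ! ≤ expNum j
  !≤expNum zero = ≤-refl
  !≤expNum (suc j) = ≤-trans (*-monoʳ-≤ (suc j) (!≤expNum j)) (m≤m+n _ 1)

  expNum≤4! : ∀ j → expNum j ≤ 4 * j !
  expNum≤4! j = ≤-trans (≤-reflexive (sym (*-identityˡ (expNum j)))) (expNum-upper 1 j)

  ^-distrib-* : ∀ a b n → (a * b) ^ n ≡ a ^ n * b ^ n
  ^-distrib-* a b zero = refl
  ^-distrib-* a b (suc n) = trans (cong (a * b *_) (^-distrib-* a b n)) (e₀ a b (a ^ n) (b ^ n))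
    where
    e₀ : ∀ a b c d → a * b * (c * d) ≡ a * c * (b * d)
    e₀ = solve-∀

  -- (1 + 1/N)^t ≤ (2N + t) / (2N - t)
  compound-upper : ∀ N t r → t + r ≡ 2 * N → suc N ^ t * r ≤ N ^ t * (2 * N + t)
  compound-upper N zero r eq = ≤-reflexive (trans (+-identityʳ r) (trans eq (e₀ N)))
    where
    e₀ : ∀ N → 2 * N ≡ 1 * (2 * N + 0)
    e₀ = solve-∀
  compound-upper N (suc t) r eq = *-cancelʳ-≤ _ _ (suc r) (begin
    suc N * suc N ^ t * r * suc r                        ≡⟨ e₁ N (suc N ^ t) r ⟩
    suc N * r * (suc N ^ t * suc r)                      ≤⟨ *-monoʳ-≤ (suc N * r) (compound-upper N t (suc r) (trans (+-suc t r) eq)) ⟩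
    suc N * r * (N ^ t * (2 * N + t))                    ≡⟨ e₂ N r (N ^ t) t ⟩
    N ^ t * (suc N * r * (2 * N + t))                    ≤⟨ *-monoʳ-≤ (N ^ t) key ⟩
    N ^ t * (N * (2 * N + suc t) * suc r)                ≡⟨ e₃ N r (N ^ t) t ⟩
    N * N ^ t * (2 * N + suc t) * suc r                  ∎)
    where
    e₁ : ∀ N x r → suc N * x * r * suc r ≡ suc N * r * (x * suc r)
    e₁ = solve-∀
    e₂ : ∀ N r x t → suc N * r * (x * (2 * N + t)) ≡ x * (suc N * r * (2 * N + t))
    e₂ = solve-∀
    e₃ : ∀ N r x t → x * (N * (2 * N + suc t) * suc r) ≡ N * x * (2 * N + suc t) * suc r
    e₃ = solve-∀
    e₄ : ∀ N r t → 2 * (suc N * r * (2 * N + t)) ≡ (2 + 2 * N) * r * (2 * N + t)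
    e₄ = solve-∀
    e₅ : ∀ t r → (suc t + r + 2) * r * (suc t + r + t) + 2 * (suc t * suc t + r) ≡
                 (suc t + r) * (suc t + r + suc t) * suc r
    e₅ = solve-∀
    e₆ : ∀ N r t → 2 * N * (2 * N + suc t) * suc r ≡ 2 * (N * (2 * N + suc t) * suc r)
    e₆ = solve-∀
    key : suc N * r * (2 * N + t) ≤ N * (2 * N + suc t) * suc r
    key = *-cancelˡ-≤ 2 (begin
      2 * (suc N * r * (2 * N + t))                        ≡⟨ e₄ N r t ⟩
      (2 + 2 * N) * r * (2 * N + t)                        ≡⟨ cong (λ a → (2 + a) * r * (a + t)) eq ⟨
      (2 + (suc t + r)) * r * (suc t + r + t)              ≡⟨ cong (λ a → a * r * (suc t + r + t)) (+-comm 2 (suc t + r)) ⟩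
      (suc t + r + 2) * r * (suc t + r + t)                ≤⟨ m≤m+n _ _ ⟩
      (suc t + r + 2) * r * (suc t + r + t) + 2 * (suc t * suc t + r) ≡⟨ e₅ t r ⟩
      (suc t + r) * (suc t + r + suc t) * suc r            ≡⟨ cong (λ a → a * (a + suc t) * suc r) eq ⟩
      2 * N * (2 * N + suc t) * suc r                      ≡⟨ e₆ N r t ⟩
      2 * (N * (2 * N + suc t) * suc r)                    ∎)

  private
    square-mono : ∀ {a b} → a ≤ b → a * a ≤ b * b
    square-mono a≤b = *-mono-≤ a≤b a≤b

    ^-double : ∀ a n → a ^ (2 * n) ≡ a ^ n * a ^ n
    ^-double a n = trans (cong (a ^_) (cong (n +_) (+-identityʳ n))) (^-distribˡ-+-* a n n)

    -- The factor (1 + 1/N)² tends to 1 for N = z M. If B were at least X + 1, then M = 3 X + 1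
    -- would already give a contradiction, since X (2 N + 1) < N².
    archimedes : ∀ {B X} z .{{_ : NonZero z}} →
      (∀ M .{{_ : NonZero M}} → B * ((z * M) * (z * M)) ≤ X * (suc (z * M) * suc (z * M))) → B ≤ X
    archimedes {B} {X} z h with B ≤? X
    ... | yes B≤X = B≤X
    ... | no B≰X = contradiction (begin-strict
      X * (suc N * suc N)                    ≡⟨ e₁ X N ⟩
      X * (N * N) + (2 * N + 1) * X          <⟨ +-monoʳ-< (X * (N * N)) (begin-strict
        (2 * N + 1) * X                      ≤⟨ *-monoˡ-≤ X (+-monoʳ-≤ (2 * N) 1≤N) ⟩
        (2 * N + N) * X                      ≡⟨ e₂ N X ⟩
        N * (3 * X)                          <⟨ *-monoʳ-< N {{>-nonZero 1≤N}} (n<1+n (3 * X)) ⟩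
        N * suc (3 * X)                      ≤⟨ *-monoʳ-≤ N (m≤n*m (suc (3 * X)) z) ⟩
        N * N                                ∎) ⟩
      X * (N * N) + N * N                    ≡⟨ +-comm (X * (N * N)) (N * N) ⟩
      suc X * (N * N)                        ≤⟨ *-monoˡ-≤ (N * N) (≰⇒> B≰X) ⟩
      B * (N * N)                            ∎) (≤⇒≯ (h (suc (3 * X))))
      where
      N = z * suc (3 * X)
      1≤N : 1 ≤ N
      1≤N = ≤-trans (s≤s z≤n) (m≤n*m (suc (3 * X)) z)
      e₁ : ∀ X N → X * (suc N * suc N) ≡ X * (N * N) + (2 * N + 1) * X
      e₁ = solve-∀
      e₂ : ∀ N X → (2 * N + N) * X ≡ N * (3 * X)
      e₂ = solve-∀

  -- e² ≤ (1 + 1/y)^(2y+1)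
  e²-upper : ∀ y .{{_ : NonZero y}} j → (let z = suc (2 * y)) →
             expNum j * expNum j * y ^ z ≤ suc y ^ z * (j ! * j !)
  e²-upper y j = archimedes z λ M → at M
    where
    z = suc (2 * y)
    a = expNum j
    b = j !
    at : ∀ M .{{_ : NonZero M}} → a * a * y ^ z * ((z * M) * (z * M)) ≤ suc y ^ z * (b * b) * (suc (z * M) * suc (z * M))
    at M = *-cancelʳ-≤ _ _ (u * u) {{m*n≢0 u u}} (begin
      a * a * y ^ z * (N * N) * (u * u)                ≡⟨ e₁ a (y ^ z) N u ⟩
      (N * u * a) * (N * u * a) * y ^ z                ≤⟨ *-monoˡ-≤ (y ^ z) (square-mono (expNum-upper N j)) ⟩
      (suc N * v * b) * (suc N * v * b) * y ^ z        ≡⟨ e₂ (suc N) v b (y ^ z) ⟩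
      (v * v * y ^ z) * (b * b * (suc N * suc N))      ≤⟨ *-monoˡ-≤ (b * b * (suc N * suc N)) powers ⟩
      (u * u * suc y ^ z) * (b * b * (suc N * suc N))  ≡⟨ e₃ u (suc y ^ z) b (suc N) ⟩
      suc y ^ z * (b * b) * (suc N * suc N) * (u * u)  ∎)
      where
      N = z * M
      u = N ^ N
      v = suc N ^ N
      instance
        N≢0 : NonZero N
        N≢0 = m*n≢0 z M
        u≢0 : NonZero u
        u≢0 = m^n≢0 N N
        4M≢0 : NonZero (4 * M)
        4M≢0 = m*n≢0 4 M
      e₁ : ∀ a Y N u → a * a * Y * (N * N) * (u * u) ≡ (N * u * a) * (N * u * a) * Y
      e₁ = solve-∀
      e₂ : ∀ n v b Y → (n * v * b) * (n * v * b) * Y ≡ (v * v * Y) * (b * b * (n * n))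
      e₂ = solve-∀
      e₃ : ∀ u Y b n → (u * u * Y) * (b * b * (n * n)) ≡ Y * (b * b) * (n * n) * (u * u)
      e₃ = solve-∀
      e₄ : ∀ y M → 2 * M + y * (4 * M) ≡ 2 * (suc (2 * y) * M)
      e₄ = solve-∀
      e₅ : ∀ x y M → x * (2 * (suc (2 * y) * M) + 2 * M) ≡ x * suc y * (4 * M)
      e₅ = solve-∀
      -- For t = 2 M the quotient (2 N + t) / (2 N - t) equals (z + 1) / (z - 1) = (y + 1) / y. The
      -- z-th power then turns the exponent 2 M into 2 N.
      base : suc N ^ (2 * M) * y ≤ N ^ (2 * M) * suc y
      base = *-cancelʳ-≤ _ _ (4 * M) (begin
        suc N ^ (2 * M) * y * (4 * M)        ≡⟨ *-assoc (suc N ^ (2 * M)) y (4 * M) ⟩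
        suc N ^ (2 * M) * (y * (4 * M))      ≤⟨ compound-upper N (2 * M) (y * (4 * M)) (e₄ y M) ⟩
        N ^ (2 * M) * (2 * N + 2 * M)        ≡⟨ e₅ (N ^ (2 * M)) y M ⟩
        N ^ (2 * M) * suc y * (4 * M)        ∎)
      twice : ∀ x → (x ^ (2 * M)) ^ z ≡ x ^ N * x ^ N
      twice x = trans (^-*-assoc x (2 * M) z) (trans (cong (x ^_) (e₆ M z)) (^-double x N))
        where
        e₆ : ∀ M z → 2 * M * z ≡ 2 * (z * M)
        e₆ = solve-∀
      powers : v * v * y ^ z ≤ u * u * suc y ^ z
      powers = begin
        v * v * y ^ z                        ≡⟨ cong (_* y ^ z) (twice (suc N)) ⟨
        (suc N ^ (2 * M)) ^ z * y ^ z        ≡⟨ ^-distrib-* (suc N ^ (2 * M)) y z ⟨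
        (suc N ^ (2 * M) * y) ^ z            ≤⟨ ^-monoˡ-≤ z base ⟩
        (N ^ (2 * M) * suc y) ^ z            ≡⟨ ^-distrib-* (N ^ (2 * M)) (suc y) z ⟩
        (N ^ (2 * M)) ^ z * suc y ^ z        ≡⟨ cong (_* suc y ^ z) (twice N) ⟩
        u * u * suc y ^ z                    ∎

  -- This is t (t - 1), so that `compound-lower` keeps the first three terms of the binomial
  -- expansion of (1 + 1/N)^t.
  pairs : ℕ → ℕ
  pairs zero    = 0
  pairs (suc t) = pairs t + 2 * t

  pairs-+ : ∀ t → pairs t + t ≡ t * t
  pairs-+ zero = refl
  pairs-+ (suc t) = trans (e₁ (pairs t) t) (trans (cong (_+ suc (2 * t)) (pairs-+ t)) (e₂ t))
    where
    e₁ : ∀ c t → c + 2 * t + suc t ≡ c + t + suc (2 * t)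
    e₁ = solve-∀
    e₂ : ∀ t → t * t + suc (2 * t) ≡ suc t * suc t
    e₂ = solve-∀

  compound-lower : ∀ N t → N ^ t * (2 * (N * N) + 2 * t * N + pairs t) ≤ suc N ^ t * (2 * (N * N))
  compound-lower N zero = ≤-reflexive (e₀ N)
    where
    e₀ : ∀ N → 1 * (2 * (N * N) + 2 * 0 * N + 0) ≡ 1 * (2 * (N * N))
    e₀ = solve-∀
  compound-lower N (suc t) = begin
    N * N ^ t * (2 * (N * N) + 2 * suc t * N + (pairs t + 2 * t)) ≤⟨ m≤m+n _ (N ^ t * pairs t) ⟩
    N * N ^ t * (2 * (N * N) + 2 * suc t * N + (pairs t + 2 * t)) + N ^ t * pairs t ≡⟨ e₁ N (N ^ t) t (pairs t) ⟩
    suc N * (N ^ t * (2 * (N * N) + 2 * t * N + pairs t))         ≤⟨ *-monoʳ-≤ (suc N) (compound-lower N t) ⟩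
    suc N * (suc N ^ t * (2 * (N * N)))                           ≡⟨ *-assoc (suc N) (suc N ^ t) _ ⟨
    suc N * suc N ^ t * (2 * (N * N))                             ∎
    where
    e₁ : ∀ N x t c → N * x * (2 * (N * N) + 2 * suc t * N + (c + 2 * t)) + x * c ≡
                     suc N * (x * (2 * (N * N) + 2 * t * N + c))
    e₁ = solve-∀

  bernoulli : ∀ w t → (let v = w + 3) → v ^ t * v ≤ w ^ t * v + 3 * t * v ^ t
  bernoulli w zero = m≤m+n _ _
  bernoulli w (suc t) = begin
    v * v ^ t * v                                       ≡⟨ *-assoc v (v ^ t) v ⟩
    v * (v ^ t * v)                                     ≤⟨ *-monoʳ-≤ v (bernoulli w t) ⟩
    v * (w ^ t * v + 3 * t * v ^ t)                     ≡⟨ e₁ w (w ^ t) t (v ^ t) ⟩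
    w * w ^ t * v + (3 * (v * w ^ t) + 3 * t * (v * v ^ t))
      ≤⟨ +-monoʳ-≤ (w * w ^ t * v) (+-monoˡ-≤ _ (*-monoʳ-≤ 3 (*-monoʳ-≤ v (^-monoˡ-≤ t (m≤m+n w 3))))) ⟩
    w * w ^ t * v + (3 * (v * v ^ t) + 3 * t * (v * v ^ t)) ≡⟨ e₂ (w * w ^ t * v) (v * v ^ t) t ⟩
    w * w ^ t * v + 3 * suc t * (v * v ^ t)             ∎
    where
    v = w + 3
    e₁ : ∀ w x t y → (w + 3) * (x * (w + 3) + 3 * t * y) ≡ w * x * (w + 3) + (3 * ((w + 3) * x) + 3 * t * ((w + 3) * y))
    e₁ = solve-∀
    e₂ : ∀ a b t → a + (3 * b + 3 * t * b) ≡ a + 3 * suc t * b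
    e₂ = solve-∀

  -- e² ≥ (1 + 1/y)^z (1 - 3/z²) for z = 2y+1
  e²-lower : ∀ y .{{_ : NonZero y}} j → (let z = suc (2 * y)) → z * z ≤ j →
             suc y ^ z * (j ! * j !) * (z * z) ≤ 3 * (suc y ^ z * (j ! * j !)) + expNum j * expNum j * y ^ z * (z * z)
  -- w is z³ - 3. With N = z², the power (1 + 1/N)^(2z) is at least (1 + 1/y) (1 - 3/z³). Taking
  -- z-th powers gives the exponent 2 N on the left, and Bernoulli's inequality bounds the loss on
  -- the right by 3/z².
  e²-lower y j z²≤j with m≤n⇒∃[o]m+o≡n {3} {suc (2 * y) * (suc (2 * y) * suc (2 * y))}
      (≤-trans 3≤z (m≤m*n z (z * z)))
    where
    z = suc (2 * y)
    3≤z : 3 ≤ z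
    3≤z = s≤s (*-monoʳ-≤ 2 (>-nonZero⁻¹ y))
  ... | w , 3+w≡z³ = *-cancelʳ-≤ _ _ (g * U) {{m*n≢0 g U}} (begin
      Y * (b * b) * (z * z) * (g * U)                             ≡⟨ e₁ Y b (z * z) g U ⟩
      (g * (z * z)) * (Y * (b * b) * U)                           ≤⟨ *-monoˡ-≤ (Y * (b * b) * U) bern ⟩
      (w ^ z * (z * z) + 3 * g) * (Y * (b * b) * U)               ≡⟨ e₂ (w ^ z) (z * z) g Y b U ⟩
      3 * (Y * (b * b)) * (g * U) + (U * (Y * w ^ z)) * (b * b * (z * z))
        ≤⟨ +-monoʳ-≤ (3 * (Y * (b * b)) * (g * U)) (*-monoˡ-≤ (b * b * (z * z)) powers) ⟩
      3 * (Y * (b * b)) * (g * U) + (W * (g * y ^ z)) * (b * b * (z * z))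
        ≡⟨ cong (3 * (Y * (b * b)) * (g * U) +_) (e₃ W g (y ^ z) b (z * z)) ⟩
      3 * (Y * (b * b)) * (g * U) + (W * (b * b)) * (g * y ^ z * (z * z))
        ≤⟨ +-monoʳ-≤ (3 * (Y * (b * b)) * (g * U)) (*-monoˡ-≤ (g * y ^ z * (z * z)) exps) ⟩
      3 * (Y * (b * b)) * (g * U) + (a * a * U) * (g * y ^ z * (z * z)) ≡⟨ e₄ (Y * (b * b)) g U (a * a) (y ^ z) (z * z) ⟩
      (3 * (Y * (b * b)) + a * a * y ^ z * (z * z)) * (g * U)     ∎)
    where
    z = suc (2 * y)
    N = z * z
    a = expNum j
    b = j !
    Y = suc y ^ z
    v = w + 3
    v≡z³ : v ≡ z * (z * z)
    v≡z³ = trans (+-comm w 3) 3+w≡z³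
    g = v ^ z
    U = N ^ N * N ^ N
    W = suc N ^ N * suc N ^ N
    instance
      N≢0 : NonZero N
      N≢0 = m*n≢0 z z
      v≢0 : NonZero v
      v≢0 = subst NonZero (+-comm 3 w) _
      g≢0 : NonZero g
      g≢0 = m^n≢0 v z
      NN≢0 : NonZero (N ^ N)
      NN≢0 = m^n≢0 N N
      U≢0 : NonZero U
      U≢0 = m*n≢0 (N ^ N) (N ^ N)
    e₁ : ∀ Y b z g U → Y * (b * b) * z * (g * U) ≡ (g * z) * (Y * (b * b) * U)
    e₁ = solve-∀
    e₂ : ∀ w z g Y b U → (w * z + 3 * g) * (Y * (b * b) * U) ≡ 3 * (Y * (b * b)) * (g * U) + (U * (Y * w)) * (b * b * z)
    e₂ = solve-∀
    e₃ : ∀ W g y b z → (W * (g * y)) * (b * b * z) ≡ (W * (b * b)) * (g * y * z)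
    e₃ = solve-∀
    e₄ : ∀ X g U a y z → 3 * X * (g * U) + (a * U) * (g * y * z) ≡ (3 * X + a * y * z) * (g * U)
    e₄ = solve-∀
    bern : g * (z * z) ≤ w ^ z * (z * z) + 3 * g
    bern = *-cancelˡ-≤ z (begin
      z * (g * (z * z))                      ≡⟨ e₅ z g ⟩
      g * (z * (z * z))                      ≡⟨ cong (g *_) v≡z³ ⟨
      g * v                                  ≤⟨ bernoulli w z ⟩
      w ^ z * v + 3 * z * g                  ≡⟨ cong (λ t → w ^ z * t + 3 * z * g) v≡z³ ⟩
      w ^ z * (z * (z * z)) + 3 * z * g      ≡⟨ e₆ (w ^ z) z g ⟩
      z * (w ^ z * (z * z) + 3 * g)          ∎)
      where
      e₅ : ∀ z g → z * (g * (z * z)) ≡ g * (z * (z * z))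
      e₅ = solve-∀
      e₆ : ∀ x z g → x * (z * (z * z)) + 3 * z * g ≡ z * (x * (z * z) + 3 * g)
      e₆ = solve-∀
    exps : W * (b * b) ≤ a * a * U
    exps = begin
      W * (b * b)                                    ≡⟨ e₇ (suc N ^ N) b ⟩
      (suc N ^ N * b) * (suc N ^ N * b)              ≤⟨ square-mono one ⟩
      (a * N ^ N) * (a * N ^ N)                      ≡⟨ e₈ a (N ^ N) ⟩
      a * a * U                                      ∎
      where
      e₇ : ∀ x b → (x * x) * (b * b) ≡ (x * b) * (x * b)
      e₇ = solve-∀
      e₈ : ∀ a x → (a * x) * (a * x) ≡ a * a * (x * x)
      e₈ = solve-∀
      e₉ : ∀ f x b → f * (x * b) ≡ (f * x) * b
      e₉ = solve-∀
      e₁₀ : ∀ s x b → s * x * b ≡ s * b * x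
      e₁₀ = solve-∀
      e₁₁ : ∀ a f x → a * f * x ≡ f * (a * x)
      e₁₁ = solve-∀
      one : suc N ^ N * b ≤ a * N ^ N
      one = *-cancelˡ-≤ (N !) {{N !≢0}} (begin
        N ! * (suc N ^ N * b)        ≡⟨ e₉ (N !) (suc N ^ N) b ⟩
        N ! * suc N ^ N * b          ≤⟨ *-monoˡ-≤ b (expNum-lower N) ⟩
        expNum N * N ^ N * b         ≡⟨ e₁₀ (expNum N) (N ^ N) b ⟩
        expNum N * b * N ^ N         ≤⟨ *-monoˡ-≤ (N ^ N) (expNum-mono (≤⇒≤′ z²≤j)) ⟩
        a * N ! * N ^ N              ≡⟨ e₁₁ a (N !) (N ^ N) ⟩
        N ! * (a * N ^ N)            ∎)
    twice : ∀ x → (x ^ (2 * z)) ^ z ≡ x ^ N * x ^ N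
    twice x = trans (^-*-assoc x (2 * z) z) (trans (cong (x ^_) (*-assoc 2 z z)) (^-double x N))
    c = pairs (2 * z)
    -- After division by 2 y N²: (1 + 1/y) (1 - 3/z³) is at most the first three binomial terms of
    -- (1 + 1/N)^(2z).
    poly : 2 * z * (suc y * w) ≤ y * (2 * (N * N) + 2 * (2 * z) * N + c)
    poly = +-cancelʳ-≤ (2 * z * y + 2 * z * suc y * 3) _ _ (begin
      2 * z * (suc y * w) + (2 * z * y + 2 * z * suc y * 3)               ≡⟨ e₁₂ z y w ⟩
      2 * z * suc y * (w + 3) + 2 * z * y                                 ≡⟨ cong (λ t → 2 * z * suc y * t + 2 * z * y) v≡z³ ⟩
      2 * z * suc y * (z * (z * z)) + 2 * z * y                           ≤⟨ m≤m+n _ (4 * z) ⟩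
      2 * z * suc y * (z * (z * z)) + 2 * z * y + 4 * z                   ≡⟨ e₁₃ y ⟩
      y * (2 * (N * N) + 2 * (2 * z) * N + 2 * z * (2 * z)) + 2 * z * suc y * 3 ≡⟨ cong (λ t → y * (2 * (N * N) + 2 * (2 * z) * N + t) + 2 * z * suc y * 3) (pairs-+ (2 * z)) ⟨
      y * (2 * (N * N) + 2 * (2 * z) * N + (c + 2 * z)) + 2 * z * suc y * 3     ≡⟨ e₁₄ y (2 * (N * N) + 2 * (2 * z) * N) c (2 * z) (2 * z * suc y * 3) ⟩
      y * (2 * (N * N) + 2 * (2 * z) * N + c) + (2 * z * y + 2 * z * suc y * 3) ∎)
      where
      e₁₂ : ∀ z y w → 2 * z * (suc y * w) + (2 * z * y + 2 * z * suc y * 3) ≡ 2 * z * suc y * (w + 3) + 2 * z * y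
      e₁₂ = solve-∀
      e₁₃ : ∀ y → (let z = suc (2 * y)) →
        2 * z * suc y * (z * (z * z)) + 2 * z * y + 4 * z ≡
        y * (2 * (z * z * (z * z)) + 2 * (2 * z) * (z * z) + 2 * z * (2 * z)) + 2 * z * suc y * 3
      e₁₃ = solve-∀
      e₁₄ : ∀ y A c t r → y * (A + (c + t)) + r ≡ y * (A + c) + (t * y + r)
      e₁₄ = solve-∀
    base : N ^ (2 * z) * (suc y * w) ≤ suc N ^ (2 * z) * (v * y)
    base = *-cancelˡ-≤ (2 * z) (begin
      2 * z * (N ^ (2 * z) * (suc y * w))                  ≡⟨ e₁₅ (2 * z) (N ^ (2 * z)) (suc y * w) ⟩
      N ^ (2 * z) * (2 * z * (suc y * w))                  ≤⟨ *-monoʳ-≤ (N ^ (2 * z)) poly ⟩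
      N ^ (2 * z) * (y * (2 * (N * N) + 2 * (2 * z) * N + c)) ≡⟨ e₁₆ (N ^ (2 * z)) y _ ⟩
      N ^ (2 * z) * (2 * (N * N) + 2 * (2 * z) * N + c) * y ≤⟨ *-monoˡ-≤ y (compound-lower N (2 * z)) ⟩
      suc N ^ (2 * z) * (2 * (N * N)) * y                  ≡⟨ e₁₇ (suc N ^ (2 * z)) z y ⟩
      2 * z * (suc N ^ (2 * z) * (z * (z * z) * y))        ≡⟨ cong (λ t → 2 * z * (suc N ^ (2 * z) * (t * y))) v≡z³ ⟨
      2 * z * (suc N ^ (2 * z) * (v * y))                  ∎)
      where
      e₁₅ : ∀ a b c → a * (b * c) ≡ b * (a * c)
      e₁₅ = solve-∀
      e₁₆ : ∀ a b c → a * (b * c) ≡ a * c * b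
      e₁₆ = solve-∀
      e₁₇ : ∀ x z y → x * (2 * (z * z * (z * z))) * y ≡ 2 * z * (x * (z * (z * z) * y))
      e₁₇ = solve-∀
    powers : U * (Y * w ^ z) ≤ W * (g * y ^ z)
    powers = begin
      U * (Y * w ^ z)                              ≡⟨ cong₂ _*_ (twice N) (^-distrib-* (suc y) w z) ⟨
      (N ^ (2 * z)) ^ z * (suc y * w) ^ z          ≡⟨ ^-distrib-* (N ^ (2 * z)) (suc y * w) z ⟨
      (N ^ (2 * z) * (suc y * w)) ^ z              ≤⟨ ^-monoˡ-≤ z base ⟩
      (suc N ^ (2 * z) * (v * y)) ^ z              ≡⟨ ^-distrib-* (suc N ^ (2 * z)) (v * y) z ⟩
      (suc N ^ (2 * z)) ^ z * (v * y) ^ z          ≡⟨ cong₂ _*_ (twice (suc N)) (^-distrib-* v y z) ⟩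
      W * (g * y ^ z)                              ∎

-- Comparing the product of the numbers of choices with powers of n/e

module ProductBounds where
  open import Data.Nat hiding (_≟_)
  open import Data.Nat.Properties hiding (_≟_)
  open import Data.Nat.Tactic.RingSolver using (solve-∀)
  open ExponentialBounds

  open ≤-Reasoning

  prod₂ : ℕ → ℕ → ℕ
  prod₂ B zero    = 1
  prod₂ B (suc d) = (2 * suc d + B) * prod₂ B d

  sq : ℕ → ℕ
  sq a = a * a

  -- Both comparisons telescope: ((q+1)/q)² lies between (q+2)/q and (q+1)/(q-1).
  prod₂-suc-upper : ∀ B d → sq (prod₂ (suc B) d) * suc B ≤ sq (prod₂ B d) * (2 * d + suc B)
  prod₂-suc-upper B zero = ≤-refl
  prod₂-suc-upper B (suc d) = begin
    sq ((2 * suc d + suc B) * O₁) * suc B           ≡⟨ e₁ d B O₁ ⟩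
    sq (r + 2) * (sq O₁ * suc B)                    ≤⟨ *-monoʳ-≤ (sq (r + 2)) (prod₂-suc-upper B d) ⟩
    sq (r + 2) * (sq O₀ * r)                        ≤⟨ m≤m+n _ (sq O₀ * (r + 2)) ⟩
    sq (r + 2) * (sq O₀ * r) + sq O₀ * (r + 2)      ≡⟨ e₂ d B O₀ ⟩
    sq ((2 * suc d + B) * O₀) * (2 * suc d + suc B) ∎
    where
    O₀ = prod₂ B d
    O₁ = prod₂ (suc B) d
    r = 2 * d + suc B
    e₁ : ∀ d B O → (2 * suc d + suc B) * O * ((2 * suc d + suc B) * O) * suc B ≡
                   (2 * d + suc B + 2) * (2 * d + suc B + 2) * (O * O * suc B)
    e₁ = solve-∀
    e₂ : ∀ d B O → (let r = 2 * d + suc B) → (r + 2) * (r + 2) * (O * O * r) + O * O * (r + 2) ≡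
                   (2 * suc d + B) * O * ((2 * suc d + B) * O) * (2 * suc d + suc B)
    e₂ = solve-∀

  prod₂-suc-lower : ∀ B d → sq (prod₂ B d) * (2 * d + (B + 2)) ≤ sq (prod₂ (suc B) d) * (B + 2)
  prod₂-suc-lower B zero = ≤-refl
  prod₂-suc-lower B (suc d) = begin
    sq ((2 * suc d + B) * O₀) * (2 * suc d + (B + 2)) ≡⟨ e₁ d B O₀ ⟩
    q * (q + 2) * (sq O₀ * q)                         ≤⟨ *-monoʳ-≤ (q * (q + 2)) (prod₂-suc-lower B d) ⟩
    q * (q + 2) * (sq O₁ * (B + 2))                   ≤⟨ m≤m+n _ (sq O₁ * (B + 2)) ⟩
    q * (q + 2) * (sq O₁ * (B + 2)) + sq O₁ * (B + 2) ≡⟨ e₂ d B O₁ ⟩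
    sq ((2 * suc d + suc B) * O₁) * (B + 2)           ∎
    where
    O₀ = prod₂ B d
    O₁ = prod₂ (suc B) d
    q = 2 * d + (B + 2)
    e₁ : ∀ d B O → (let q = 2 * d + (B + 2)) →
         (2 * suc d + B) * O * ((2 * suc d + B) * O) * (2 * suc d + (B + 2)) ≡ q * (q + 2) * (O * O * q)
    e₁ = solve-∀
    e₂ : ∀ d B O → (let q = 2 * d + (B + 2)) →
         q * (q + 2) * (O * O * (B + 2)) + O * O * (B + 2) ≡ (2 * suc d + suc B) * O * ((2 * suc d + suc B) * O) * (B + 2)
    e₂ = solve-∀

  prod₂-+-upper : ∀ B d {k} i → i ≤ k → sq (prod₂ (i + B) d) ≤ sq (prod₂ B d) * (2 * d + (B + suc k)) ^ i
  prod₂-+-upper B d zero _ = ≤-reflexive (sym (*-identityʳ _))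
  prod₂-+-upper B d {k} (suc i) i<k = begin
    sq (prod₂ (suc (i + B)) d)                      ≤⟨ m≤m*n _ (suc (i + B)) ⟩
    sq (prod₂ (suc (i + B)) d) * suc (i + B)        ≤⟨ prod₂-suc-upper (i + B) d ⟩
    sq (prod₂ (i + B) d) * (2 * d + suc (i + B))    ≤⟨ *-mono-≤ (prod₂-+-upper B d i (<⇒≤ i<k)) small ⟩
    sq (prod₂ B d) * M ^ i * M                      ≡⟨ e₀ (sq (prod₂ B d)) (M ^ i) M ⟩
    sq (prod₂ B d) * (M * M ^ i)                    ∎
    where
    M = 2 * d + (B + suc k)
    e₀ : ∀ a b c → a * b * c ≡ a * (c * b)
    e₀ = solve-∀
    small : 2 * d + suc (i + B) ≤ M
    small = +-monoʳ-≤ (2 * d) (≤-trans (≤-reflexive (+-comm (suc i) B)) (+-monoʳ-≤ B (≤-trans i<k (n≤1+n k))))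

  -- The factor 2 in R comes from bounding M by twice the end term 2 d + (i + B + 2) of each
  -- telescoping product, which is where k ≤ B enters.
  prod₂-+-lower : ∀ B d {k} → k ≤ B → ∀ i → i ≤ k →
                  sq (prod₂ B d) * (2 * d + (B + suc k)) ^ i ≤ sq (prod₂ (i + B) d) * (2 * (B + suc k)) ^ i
  prod₂-+-lower B d k≤B zero _ = ≤-refl
  prod₂-+-lower B d {k} k≤B (suc i) i<k = begin
    sq (prod₂ B d) * (M * M ^ i)                               ≡⟨ e₀ (sq (prod₂ B d)) M (M ^ i) ⟩
    sq (prod₂ B d) * M ^ i * M                                 ≤⟨ *-monoˡ-≤ M (prod₂-+-lower B d k≤B i (<⇒≤ i<k)) ⟩
    sq (prod₂ (i + B) d) * R ^ i * M                           ≤⟨ *-monoʳ-≤ (sq (prod₂ (i + B) d) * R ^ i) M≤ ⟩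
    sq (prod₂ (i + B) d) * R ^ i * (2 * (2 * d + (i + B + 2))) ≡⟨ e′ (sq (prod₂ (i + B) d)) (R ^ i) (2 * d + (i + B + 2)) ⟩
    sq (prod₂ (i + B) d) * (2 * d + (i + B + 2)) * (2 * R ^ i) ≤⟨ *-monoˡ-≤ (2 * R ^ i) (prod₂-suc-lower (i + B) d) ⟩
    sq (prod₂ (suc (i + B)) d) * (i + B + 2) * (2 * R ^ i)     ≤⟨ *-monoˡ-≤ (2 * R ^ i) (*-monoʳ-≤ (sq (prod₂ (suc (i + B)) d)) small) ⟩
    sq (prod₂ (suc (i + B)) d) * (B + suc k) * (2 * R ^ i)     ≡⟨ e″ (sq (prod₂ (suc (i + B)) d)) (B + suc k) (R ^ i) ⟩
    sq (prod₂ (suc (i + B)) d) * (R * R ^ i)                   ∎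
    where
    M = 2 * d + (B + suc k)
    R = 2 * (B + suc k)
    e₀ : ∀ a b c → a * (b * c) ≡ a * c * b
    e₀ = solve-∀
    e′ : ∀ a b c → a * b * (2 * c) ≡ a * c * (2 * b)
    e′ = solve-∀
    e″ : ∀ a b c → a * b * (2 * c) ≡ a * (2 * b * c)
    e″ = solve-∀
    small : i + B + 2 ≤ B + suc k
    small = ≤-trans (≤-reflexive (e₃ i B)) (+-monoʳ-≤ B (s≤s i<k))
      where
      e₃ : ∀ i B → i + B + 2 ≡ B + suc (suc i)
      e₃ = solve-∀
    M≤ : M ≤ 2 * (2 * d + (i + B + 2))
    M≤ = begin
      2 * d + (B + suc k)                    ≤⟨ +-monoʳ-≤ (2 * d) (+-monoʳ-≤ B (s≤s k≤B)) ⟩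
      2 * d + (B + suc B)                    ≤⟨ m≤m+n _ (2 * d + 2 * i + 3) ⟩
      2 * d + (B + suc B) + (2 * d + 2 * i + 3) ≡⟨ e₄ d B i ⟩
      2 * (2 * d + (i + B + 2))              ∎
      where
      e₄ : ∀ d B i → 2 * d + (B + suc B) + (2 * d + 2 * i + 3) ≡ 2 * (2 * d + (i + B + 2))
      e₄ = solve-∀

  -- With n = 2y, y = suc (d + h), the product (n-1)(n-3)⋯ is compared with (n/e)^(n/2).
  -- The factors (2y-1)/2y and (y-1)/y make the two comparisons monotone in d.
  module DoubleFactorial (h : ℕ) where
    W Z : ℕ → ℕ → ℕ
    W j d = sq (prod₂ (suc (2 * h)) d) * expNum j ^ (2 * suc (d + h))
    Z j d = 4 ^ d * suc (d + h) ^ (2 * suc (d + h)) * (j !) ^ (2 * suc (d + h))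

    -- Fixed by the case d = 0, with `expNum j` between j! and 4 j!.
    C₁ C₂ : ℕ
    C₁ = 2 * 4 ^ (2 * suc h)
    C₂ = suc h * suc h ^ (2 * suc h)

    private
      ^-2-suc : ∀ a y → a ^ (2 * suc y) ≡ a ^ (2 * y) * (a * a)
      ^-2-suc a y = trans (cong (a ^_) (*-suc 2 y)) (e₀ a (a ^ (2 * y)))
        where
        e₀ : ∀ a x → a * (a * x) ≡ x * (a * a)
        e₀ = solve-∀

      W-suc : ∀ j d → (let y = suc (d + h)) → W j (suc d) ≡ W j d * (suc (2 * y) * suc (2 * y) * (expNum j * expNum j))
      W-suc j d = trans (cong₂ _*_ (cong sq (cong (_* prod₂ (suc (2 * h)) d) (e₁ d h))) (^-2-suc (expNum j) (suc (d + h))))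
        (e₂ (suc (2 * suc (d + h))) (prod₂ (suc (2 * h)) d) (expNum j ^ (2 * suc (d + h))) (expNum j))
        where
        e₁ : ∀ d h → 2 * suc d + suc (2 * h) ≡ suc (2 * suc (d + h))
        e₁ = solve-∀
        e₂ : ∀ z p x a → z * p * (z * p) * (x * (a * a)) ≡ p * p * x * (z * z * (a * a))
        e₂ = solve-∀

      Z-suc : ∀ j d → (let y = suc (d + h)) →
              Z j (suc d) ≡ 4 * 4 ^ d * (suc y * suc y ^ suc (2 * y)) * ((j !) ^ (2 * y) * (j ! * j !))
      Z-suc j d = cong₂ (λ s t → 4 * 4 ^ d * s * t) (cong (suc (suc (d + h)) ^_) (*-suc 2 (suc (d + h)))) (^-2-suc (j !) (suc (d + h)))

    -- By `e²-upper` a step multiplies W / Z by at most (2y + 1)² / (4 y (y + 1)). Together with the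
    -- change of the correcting factor this becomes (2y - 1) (2y + 1) / (4 y²), which is below 1.
    W-upper′ : ∀ j d → (let y = suc (d + h)) → W j d * (2 * y) ≤ C₁ * Z j d * suc (2 * (d + h))
    W-upper′ j zero = begin
      1 * expNum j ^ (2 * y) * (2 * y)                  ≤⟨ *-mono-≤ (*-monoʳ-≤ 1 (^-monoˡ-≤ (2 * y) (expNum≤4! j))) 2y≤ ⟩
      1 * (4 * j !) ^ (2 * y) * (2 * suc (2 * h))       ≡⟨ cong (λ t → 1 * t * (2 * suc (2 * h))) (^-distrib-* 4 (j !) (2 * y)) ⟩
      1 * (4 ^ (2 * y) * (j !) ^ (2 * y)) * (2 * suc (2 * h))
        ≤⟨ m≤m*n _ (y ^ (2 * y)) {{m^n≢0 y (2 * y)}} ⟩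
      1 * (4 ^ (2 * y) * (j !) ^ (2 * y)) * (2 * suc (2 * h)) * y ^ (2 * y)
                                                        ≡⟨ e₀ (4 ^ (2 * y)) ((j !) ^ (2 * y)) (suc (2 * h)) (y ^ (2 * y)) ⟩
      C₁ * (1 * y ^ (2 * y) * (j !) ^ (2 * y)) * suc (2 * h) ∎
      where
      y = suc h
      e₀ : ∀ f b s x → 1 * (f * b) * (2 * s) * x ≡ 2 * f * (1 * x * b) * s
      e₀ = solve-∀
      2y≤ : 2 * y ≤ 2 * suc (2 * h)
      2y≤ = *-monoʳ-≤ 2 (s≤s (m≤n*m h 2))
    W-upper′ j (suc d) = begin
      W j (suc d) * (2 * suc y)                         ≡⟨ cong (_* (2 * suc y)) (W-suc j d) ⟩
      w * (z * z * (a * a)) * (2 * suc y)               ≡⟨ e₁ w z (a * a) (suc y) ⟩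
      w * z * (a * a) * (2 * suc y * z)                 ≤⟨ *-monoˡ-≤ (2 * suc y * z) core ⟩
      2 * (C₁ * F * β * B * (b * b)) * (2 * suc y * z)  ≡⟨ e₂ C₁ F β B (b * b) (suc y) z ⟩
      C₁ * (4 * F * (suc y * β) * (B * (b * b))) * z    ≡⟨ cong (λ t → C₁ * t * z) (Z-suc j d) ⟨
      C₁ * Z j (suc d) * z                              ∎
      where
      t = d + h
      y = suc t
      z = suc (2 * y)
      a = expNum j
      b = j !
      w = W j d
      F = 4 ^ d
      α = y ^ (2 * y)
      β = suc y ^ z
      B = b ^ (2 * y)
      instance
        α≢0 : NonZero α
        α≢0 = m^n≢0 y (2 * y)
      e₁ : ∀ w z a s → w * (z * z * a) * (2 * s) ≡ w * z * a * (2 * s * z)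
      e₁ = solve-∀
      e₂ : ∀ C F β B b s z → 2 * (C * F * β * B * b) * (2 * s * z) ≡ C * (4 * F * (s * β) * (B * b)) * z
      e₂ = solve-∀
      e₃ : ∀ w z a y α → w * z * a * (y * α * (2 * y)) ≡ w * (2 * y) * (z * (a * (y * α)))
      e₃ = solve-∀
      e₄ : ∀ C F α B s z X → C * (F * α * B) * s * (z * X) ≡ C * (F * α * B) * X * (s * z)
      e₄ = solve-∀
      e₅ : ∀ C F α B β b y → C * (F * α * B) * (β * b) * (4 * (y * y)) ≡ 2 * (C * F * β * B * b) * (y * α * (2 * y))
      e₅ = solve-∀
      e₆ : ∀ t → suc (2 * t) * suc (2 * suc t) + 1 ≡ 4 * (suc t * suc t)
      e₆ = solve-∀
      core : w * z * (a * a) ≤ 2 * (C₁ * F * β * B * (b * b))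
      core = *-cancelʳ-≤ _ _ (y * α * (2 * y)) {{m*n≢0 (y * α) (2 * y) {{m*n≢0 y α}}}} (begin
        w * z * (a * a) * (y * α * (2 * y))             ≡⟨ e₃ w z (a * a) y α ⟩
        w * (2 * y) * (z * (a * a * (y * α)))           ≤⟨ *-mono-≤ (W-upper′ j d) (*-monoʳ-≤ z (e²-upper y j)) ⟩
        C₁ * Z j d * suc (2 * t) * (z * (β * (b * b)))  ≡⟨ e₄ C₁ F α B (suc (2 * t)) z (β * (b * b)) ⟩
        C₁ * (F * α * B) * (β * (b * b)) * (suc (2 * t) * z) ≤⟨ *-monoʳ-≤ (C₁ * (F * α * B) * (β * (b * b))) (≤-trans (m≤m+n _ 1) (≤-reflexive (e₆ t))) ⟩
        C₁ * (F * α * B) * (β * (b * b)) * (4 * (y * y)) ≡⟨ e₅ C₁ F α B β (b * b) y ⟩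
        2 * (C₁ * F * β * B * (b * b)) * (y * α * (2 * y)) ∎)

    -- The loss 1 - 3/z² in `e²-lower`, with z = 2y + 1, is absorbed by the correcting factor since
    -- 4 (y - 1) (y + 1)² + 3 y ≤ y z². The bound on j provides the terms of the exponential series
    -- that each step requires.
    W-lower′ : ∀ j d → (let y = suc (d + h)) → 1 ≤ h → 2 * y * (2 * y) ≤ j → Z j d * y ≤ C₂ * W j d * (d + h)
    W-lower′ j zero 1≤h _ = begin
      1 * y ^ (2 * y) * (j !) ^ (2 * y) * y             ≤⟨ *-monoˡ-≤ y (*-monoʳ-≤ (1 * y ^ (2 * y)) (^-monoˡ-≤ (2 * y) (!≤expNum j))) ⟩
      1 * y ^ (2 * y) * expNum j ^ (2 * y) * y          ≡⟨ e₀ (y ^ (2 * y)) (expNum j ^ (2 * y)) y ⟩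
      C₂ * (1 * expNum j ^ (2 * y)) * 1                 ≤⟨ *-monoʳ-≤ (C₂ * (1 * expNum j ^ (2 * y))) 1≤h ⟩
      C₂ * (1 * expNum j ^ (2 * y)) * h                 ∎
      where
      y = suc h
      e₀ : ∀ x a y → 1 * x * a * y ≡ y * x * (1 * a) * 1
      e₀ = solve-∀
    W-lower′ j (suc d) 1≤h large = *-cancelʳ-≤ _ _ (y * α) {{m*n≢0 y α}} (begin
      Z j (suc d) * suc y * (y * α)                                 ≡⟨ cong (λ t → t * suc y * (y * α)) (Z-suc j d) ⟩
      4 * F * (suc y * β) * (B * (b * b)) * suc y * (y * α)         ≡⟨ e₁ F (suc y) β B (b * b) y α ⟩
      F * α * B * y * (4 * (suc y * suc y) * (β * (b * b)))
        ≤⟨ *-monoˡ-≤ (4 * (suc y * suc y) * (β * (b * b))) (W-lower′ j d 1≤h (≤-trans (*-mono-≤ 2y≤ 2y≤) large)) ⟩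
      C₂ * w * t * (4 * (suc y * suc y) * (β * (b * b)))            ≡⟨ e₂ C₂ w t (suc y) (β * (b * b)) ⟩
      C₂ * w * (4 * t * (suc y * suc y) * (β * (b * b)))            ≤⟨ *-monoʳ-≤ (C₂ * w) key ⟩
      C₂ * w * (y * (a * a * (y * α) * (z * z)))                    ≡⟨ e₃ C₂ w y (a * a) α z ⟩
      C₂ * (w * (z * z * (a * a))) * y * (y * α)                    ≡⟨ cong (λ t → C₂ * t * y * (y * α)) (W-suc j d) ⟨
      C₂ * W j (suc d) * y * (y * α)                                ∎)
      where
      t = d + h
      y = suc t
      z = suc (2 * y)
      a = expNum j
      b = j !
      w = W j d
      F = 4 ^ d
      α = y ^ (2 * y)
      β = suc y ^ z
      B = b ^ (2 * y)
      instance
        α≢0 : NonZero α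
        α≢0 = m^n≢0 y (2 * y)
      2y≤ : 2 * y ≤ 2 * suc y
      2y≤ = *-monoʳ-≤ 2 (n≤1+n y)
      z≤ : z ≤ 2 * suc y
      z≤ = ≤-trans (n≤1+n z) (≤-reflexive (sym (*-suc 2 y)))
      e₁ : ∀ F s β B b y α → 4 * F * (s * β) * (B * b) * s * (y * α) ≡ F * α * B * y * (4 * (s * s) * (β * b))
      e₁ = solve-∀
      e₂ : ∀ C w t s X → C * w * t * (4 * (s * s) * X) ≡ C * w * (4 * t * (s * s) * X)
      e₂ = solve-∀
      e₃ : ∀ C w y a α z → C * w * (y * (a * (y * α) * (z * z))) ≡ C * (w * (z * z * a)) * y * (y * α)
      e₃ = solve-∀
      e₄ : ∀ t X → (let y = suc t ; z = suc (2 * y)) →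
           4 * t * (suc y * suc y) * X + y * (3 * X) + (2 * y + 4) * X ≡ y * (X * (z * z))
      e₄ = solve-∀
      e₅ : ∀ y p q → y * (3 * p + q) ≡ y * q + y * (3 * p)
      e₅ = solve-∀
      key : 4 * t * (suc y * suc y) * (β * (b * b)) ≤ y * (a * a * (y * α) * (z * z))
      key = +-cancelʳ-≤ (y * (3 * (β * (b * b)))) _ _ (begin
        4 * t * (suc y * suc y) * (β * (b * b)) + y * (3 * (β * (b * b))) ≤⟨ m≤m+n _ ((2 * y + 4) * (β * (b * b))) ⟩
        4 * t * (suc y * suc y) * (β * (b * b)) + y * (3 * (β * (b * b))) + (2 * y + 4) * (β * (b * b)) ≡⟨ e₄ t (β * (b * b)) ⟩
        y * (β * (b * b) * (z * z))                       ≤⟨ *-monoʳ-≤ y (e²-lower y j (≤-trans (*-mono-≤ z≤ z≤) large)) ⟩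
        y * (3 * (β * (b * b)) + a * a * (y * α) * (z * z)) ≡⟨ e₅ y (β * (b * b)) (a * a * (y * α) * (z * z)) ⟩
        y * (a * a * (y * α) * (z * z)) + y * (3 * (β * (b * b))) ∎)

    private
      Z-power : ∀ j d → (let n = 2 * suc (d + h)) → 4 ^ suc h * Z j d ≡ n ^ n * (j !) ^ n
      Z-power j d = trans (e₁ (4 ^ suc h) (4 ^ d) (y ^ (2 * y)) ((j !) ^ (2 * y)))
        (cong (_* (j !) ^ (2 * y)) (begin-equality
          4 ^ d * 4 ^ suc h * y ^ (2 * y)   ≡⟨ cong (_* y ^ (2 * y)) (^-distribˡ-+-* 4 d (suc h)) ⟨
          4 ^ (d + suc h) * y ^ (2 * y)     ≡⟨ cong (λ t → 4 ^ t * y ^ (2 * y)) (+-suc d h) ⟩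
          4 ^ y * y ^ (2 * y)               ≡⟨ cong (_* y ^ (2 * y)) (^-*-assoc 2 2 y) ⟩
          2 ^ (2 * y) * y ^ (2 * y)         ≡⟨ ^-distrib-* 2 y (2 * y) ⟨
          (2 * y) ^ (2 * y)                 ∎))
        where
        y = suc (d + h)
        e₁ : ∀ x f a b → x * (f * a * b) ≡ f * x * a * b
        e₁ = solve-∀

    W-upper : ∀ j d → (let n = 2 * suc (d + h)) → W j d ≤ C₁ * (n ^ n * (j !) ^ n)
    W-upper j d = begin
      W j d                      ≤⟨ *-cancelʳ-≤ _ _ (2 * y) (≤-trans (W-upper′ j d) (*-monoʳ-≤ (C₁ * Z j d) (≤-trans (n≤1+n _) (≤-reflexive (sym (*-suc 2 (d + h))))))) ⟩
      C₁ * Z j d                 ≤⟨ *-monoʳ-≤ C₁ (m≤n*m (Z j d) (4 ^ suc h) {{m^n≢0 4 (suc h)}}) ⟩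
      C₁ * (4 ^ suc h * Z j d)   ≡⟨ cong (C₁ *_) (Z-power j d) ⟩
      C₁ * (n ^ n * (j !) ^ n)   ∎
      where
      y = suc (d + h)
      n = 2 * y

    W-lower : ∀ j d → (let n = 2 * suc (d + h)) → 1 ≤ h → n * n ≤ j → n ^ n * (j !) ^ n ≤ 4 ^ suc h * C₂ * W j d
    W-lower j d 1≤h large = begin
      n ^ n * (j !) ^ n          ≡⟨ Z-power j d ⟨
      4 ^ suc h * Z j d          ≤⟨ *-monoʳ-≤ (4 ^ suc h) (*-cancelʳ-≤ _ _ y (≤-trans (W-lower′ j d 1≤h large) (*-monoʳ-≤ (C₂ * W j d) (n≤1+n (d + h))))) ⟩
      4 ^ suc h * (C₂ * W j d)   ≡⟨ *-assoc (4 ^ suc h) C₂ (W j d) ⟨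
      4 ^ suc h * C₂ * W j d     ∎
      where
      y = suc (d + h)
      n = 2 * y

-- Passing from natural to real numbers

module RealBounds where
  open import Defs
  import Data.Integer as ℤ
  import Data.Integer.Properties as ℤ
  open import Data.Integer using (+_)
  open import Data.Nat as ℕ using (ℕ; zero; suc; _!; NonZero)
  import Data.Nat.Properties as ℕ
  import Data.Nat.DivMod as ℕ
  open import Data.Nat.Properties using (_!≢0)
  import Data.Nat.Tactic.RingSolver as ℕ-Ring
  open import Data.Rational hiding (NonZero; Positive)
  import Data.Rational as ℚ
  open import Data.Rational.Properties
  open import Data.Rational.Solver using (module +-*-Solver)
  import Data.Rational.Unnormalised as ℚᵘ
  import Data.Rational.Unnormalised.Properties as ℚᵘ
  open ExponentialBounds using (expNum)

  /-≡ : ∀ a b c d .{{_ : NonZero b}} .{{_ : NonZero d}} → a ℕ.* d ≡ c ℕ.* b → + a / b ≡ + c / d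
  /-≡ a b c d eq = ≤-antisym (/-mono a b c d (ℕ.≤-reflexive eq)) (/-mono c d a b (ℕ.≤-reflexive (sym eq)))

  /-* : ∀ a b c d .{{_ : NonZero b}} .{{_ : NonZero d}} .{{_ : NonZero (b ℕ.* d)}} →
        + a / b * (+ c / d) ≡ + (a ℕ.* c) / (b ℕ.* d)
  /-* a b@(suc b-1) c d@(suc d-1) = toℚᵘ-injective (begin
    toℚᵘ (+ a / b * (+ c / d))
      ≈⟨ toℚᵘ-homo-* (+ a / b) (+ c / d) ⟩
    toℚᵘ (+ a / b) ℚᵘ.* toℚᵘ (+ c / d)
      ≈⟨ ℚᵘ.*-cong (toℚᵘ-fromℚᵘ (ℚᵘ.mkℚᵘ (+ a) b-1)) (toℚᵘ-fromℚᵘ (ℚᵘ.mkℚᵘ (+ c) d-1)) ⟩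
    ℚᵘ.mkℚᵘ (+ a) b-1 ℚᵘ.* ℚᵘ.mkℚᵘ (+ c) d-1
      ≈⟨ ℚᵘ.*≡* (cong (ℤ._* + (b ℕ.* d)) (sym (ℤ.pos-* a c))) ⟩
    ℚᵘ.mkℚᵘ (+ (a ℕ.* c)) (ℕ.pred (b ℕ.* d))
      ≈⟨ ℚᵘ.≃-sym (toℚᵘ-fromℚᵘ (ℚᵘ.mkℚᵘ (+ (a ℕ.* c)) (ℕ.pred (b ℕ.* d)))) ⟩
    toℚᵘ (+ (a ℕ.* c) / (b ℕ.* d)) ∎)
    where open ℚᵘ.≃-Reasoning

  ι : ℕ → ℚ
  ι n = + n / 1

  ι-* : ∀ a b → ι (a ℕ.* b) ≡ ι a * ι b
  ι-* a b = sym (/-* a 1 b 1)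

  ι-mono : ∀ {a b} → a ℕ.≤ b → ι a ≤ ι b
  ι-mono {a} {b} a≤b = /-mono a 1 b 1 (ℕ.*-monoˡ-≤ 1 a≤b)

  0≤ι : ∀ n → 0ℚ ≤ ι n
  0≤ι n = ι-mono {0} {n} ℕ.z≤n

  0<ι : ∀ n .{{_ : NonZero n}} → 0ℚ < ι n
  0<ι n = <-≤-trans (*<* (ℤ.+<+ (ℕ.s≤s ℕ.z≤n))) (ι-mono {1} {n} (ℕ.>-nonZero⁻¹ n))

  pow : ℚ → ℕ → ℚ
  pow q zero    = 1ℚ
  pow q (suc k) = q * pow q k

  module _ where
    open +-*-Solver

    private
      interchange : ∀ a b c d → a * b * (c * d) ≡ a * c * (b * d)
      interchange = solve 4 (λ a b c d → a :* b :* (c :* d) := a :* c :* (b :* d)) refl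

      regroup : ∀ p q s t → p * q * (p * q) * (s * s * (t * t)) ≡ p * s * (p * s) * (q * t * (q * t))
      regroup = solve 4 (λ p q s t → p :* q :* (p :* q) :* (s :* s :* (t :* t)) :=
                                     p :* s :* (p :* s) :* (q :* t :* (q :* t))) refl

      unit-square : ∀ x → 1ℚ * 1ℚ * x ≡ x
      unit-square = solve 1 (λ x → con 1ℚ :* con 1ℚ :* x := x) refl

      assoc₁ : ∀ f s x b → f * f * (s * x) * b ≡ f * f * s * (x * b)
      assoc₁ = solve 4 (λ f s x b → f :* f :* (s :* x) :* b := f :* f :* s :* (x :* b)) refl

      assoc₂ : ∀ c s f x b → c * s * (f * f) * x * b ≡ c * s * (f * f) * (x * b)
      assoc₂ = solve 5 (λ c s f x b → c :* s :* (f :* f) :* x :* b := c :* s :* (f :* f) :* (x :* b)) refl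

      assoc₃ : ∀ c t s f x → c * (t * s) * (f * f) * x ≡ c * t * (f * f) * (s * x)
      assoc₃ = solve 5 (λ c t s f x → c :* (t :* s) :* (f :* f) :* x := c :* t :* (f :* f) :* (s :* x)) refl

      square-* : ∀ c g → c * (c * (g * g)) ≡ c * g * (c * g)
      square-* = solve 2 (λ c g → c :* (c :* (g :* g)) := c :* g :* (c :* g)) refl

    pow-* : ∀ a b k → pow (a * b) k ≡ pow a k * pow b k
    pow-* a b zero = refl
    pow-* a b (suc k) = trans (cong (a * b *_) (pow-* a b k)) (interchange a b (pow a k) (pow b k))

    pow-+ : ∀ q m n → pow q (m ℕ.+ n) ≡ pow q m * pow q n
    pow-+ q zero n = sym (*-identityˡ (pow q n))
    pow-+ q (suc m) n = trans (cong (q *_) (pow-+ q m n)) (sym (*-assoc q (pow q m) (pow q n)))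

    pow-2* : ∀ q h → pow q (2 ℕ.* h) ≡ pow q h * pow q h
    pow-2* q h = trans (cong (λ t → pow q (h ℕ.+ t)) (ℕ.+-identityʳ h)) (pow-+ q h h)

    pow-1 : ∀ k → pow 1ℚ k ≡ 1ℚ
    pow-1 zero = refl
    pow-1 (suc k) = trans (*-identityˡ (pow 1ℚ k)) (pow-1 k)

    0≤* : ∀ {p q} → 0ℚ ≤ p → 0ℚ ≤ q → 0ℚ ≤ p * q
    0≤* {p} {q} 0≤p 0≤q = subst (_≤ p * q) (*-zeroˡ q) (*-mono-≤-nonNeg ≤-refl 0≤q 0≤p ≤-refl)

    pow-pos : ∀ {q} → 0ℚ < q → ∀ k → 0ℚ < pow q k
    pow-pos 0<q zero = *<* (ℤ.+<+ (ℕ.s≤s ℕ.z≤n))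
    pow-pos 0<q (suc k) = *-pos 0<q (pow-pos 0<q k)

    pow-nonNeg : ∀ {q} → 0ℚ ≤ q → ∀ k → 0ℚ ≤ pow q k
    pow-nonNeg 0≤q zero = ι-mono {0} {1} ℕ.z≤n
    pow-nonNeg 0≤q (suc k) = 0≤* 0≤q (pow-nonNeg 0≤q k)

    pow-mono : ∀ {p q} → 0ℚ ≤ p → p ≤ q → ∀ k → pow p k ≤ pow q k
    pow-mono 0≤p p≤q zero = ≤-refl
    pow-mono 0≤p p≤q (suc k) = *-mono-≤-nonNeg 0≤p (pow-nonNeg (≤-trans 0≤p p≤q) k) p≤q (pow-mono 0≤p p≤q k)

    ι-^ : ∀ a k → ι (a ℕ.^ k) ≡ pow (ι a) k
    ι-^ a zero = refl
    ι-^ a (suc k) = trans (ι-* a (a ℕ.^ k)) (cong (ι a *_) (ι-^ a k))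

    square-cancel : ∀ {x y} → 0ℚ ≤ y → x * x ≤ y * y → x ≤ y
    square-cancel {x} {y} 0≤y h with <-cmp x y
    ... | tri< x<y _ _ = <⇒≤ x<y
    ... | tri≈ _ x≡y _ = ≤-reflexive x≡y
    ... | tri> _ _ y<x = contradiction (≤-<-trans h (≤-<-trans (*-mono-≤-nonNeg 0≤y 0≤y (<⇒≤ y<x) ≤-refl)
          (*-monoʳ-<-pos x {{positive (≤-<-trans 0≤y y<x)}} y<x))) (<-irrefl refl)

    -- In the notation of the theorem, r = n^(-1/2) and w = n/e.
    module Squares {r σ w ρ : ℚ} {n h k : ℕ} (2h≡n : 2 ℕ.* h ≡ n) (rσ≡1 : r * σ ≡ 1ℚ) (wρ≡n : w * ρ ≡ ι n)
      (0<σ : 0ℚ < σ) (0<ρ : 0ℚ < ρ) (0≤r : 0ℚ ≤ r) (0≤w : 0ℚ ≤ w)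
      (σ²≤n : σ * σ ≤ ι n) (n≤4σ² : ι n ≤ ι 4 * (σ * σ))
      {a b : ℕ} .{{_ : NonZero b}} (ρb≡a : ρ * ι b ≡ ι a) where

      g X Sk : ℚ
      g = pow r k * pow w h
      Sk = pow (σ * σ) k
      X = Sk * pow ρ n

      0≤g : 0ℚ ≤ g
      0≤g = 0≤* (pow-nonNeg 0≤r k) (pow-nonNeg 0≤w h)

      0<X : 0ℚ < X
      0<X = *-pos (pow-pos (*-pos 0<σ 0<σ) k) (pow-pos 0<ρ n)

      -- Squaring makes both exponents integral; `X` collects σ^(2k) and ρ^n, which cancel the
      -- inverse of √n and the inverse of e.
      g²X : g * g * X ≡ pow (ι n) n
      g²X = begin
        g * g * X                                            ≡⟨ cong (g * g *_) (cong₂ _*_ (pow-* σ σ k) (trans (cong (pow ρ) (sym 2h≡n)) (pow-2* ρ h))) ⟩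
        g * g * (pow σ k * pow σ k * (pow ρ h * pow ρ h))    ≡⟨ regroup (pow r k) (pow w h) (pow σ k) (pow ρ h) ⟩
        pow r k * pow σ k * (pow r k * pow σ k) * (pow w h * pow ρ h * (pow w h * pow ρ h))
          ≡⟨ cong₂ (λ s t → s * s * (t * t)) (trans (sym (pow-* r σ k)) (trans (cong (λ q → pow q k) rσ≡1) (pow-1 k)))
                                             (trans (sym (pow-* w ρ h)) (cong (λ q → pow q h) wρ≡n)) ⟩
        1ℚ * 1ℚ * (pow (ι n) h * pow (ι n) h)                ≡⟨ unit-square (pow (ι n) h * pow (ι n) h) ⟩
        pow (ι n) h * pow (ι n) h                            ≡⟨ pow-2* (ι n) h ⟨
        pow (ι n) (2 ℕ.* h)                                  ≡⟨ cong (pow (ι n)) 2h≡n ⟩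
        pow (ι n) n                                          ∎
        where open ≡-Reasoning

      private
        ρⁿbⁿ : pow ρ n * ι (b ℕ.^ n) ≡ ι (a ℕ.^ n)
        ρⁿbⁿ = trans (cong (pow ρ n *_) (ι-^ b n)) (trans (sym (pow-* ρ (ι b) n)) (trans (cong (λ q → pow q n) ρb≡a) (sym (ι-^ a n))))
        0<bⁿ : 0ℚ < ι (b ℕ.^ n)
        0<bⁿ = 0<ι (b ℕ.^ n) {{ℕ.m^n≢0 b n}}
        Sk≤ : Sk ≤ ι (n ℕ.^ k)
        Sk≤ = subst (Sk ≤_) (sym (ι-^ n k)) (pow-mono (<⇒≤ (*-pos 0<σ 0<σ)) σ²≤n k)
        ≤Sk : ι (n ℕ.^ k) ≤ ι (4 ℕ.^ k) * Sk
        ≤Sk = subst₂ _≤_ (sym (ι-^ n k)) (trans (pow-* (ι 4) (σ * σ) k) (cong (_* Sk) (sym (ι-^ 4 k)))) (pow-mono (0≤ι n) n≤4σ² k)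

        -- As c ≥ 1 gives c ≤ c², no root of the constant has to be taken.
        from-squares : ∀ {c x y} → 0ℚ ≤ x → 0ℚ ≤ y → 1ℚ ≤ c → x * x * X ≤ c * (y * y * X) → x ≤ c * y
        from-squares {c} {x} {y} 0≤x 0≤y 1≤c le = square-cancel (0≤* 0≤c 0≤y) (*-cancelʳ-≤-pos X {{positive 0<X}} (begin
          x * x * X                 ≤⟨ le ⟩
          c * (y * y * X)           ≡⟨ *-assoc c (y * y) X ⟨
          c * (y * y) * X           ≡⟨ cong (_* X) (*-identityˡ (c * (y * y))) ⟨
          1ℚ * (c * (y * y)) * X    ≤⟨ *-mono-≤-nonNeg (0≤* (≤-trans (ι-mono {0} {1} ℕ.z≤n) ≤-refl) (0≤* 0≤c (0≤* 0≤y 0≤y))) (<⇒≤ 0<X)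
                                         (*-mono-≤-nonNeg (ι-mono {0} {1} ℕ.z≤n) (0≤* 0≤c (0≤* 0≤y 0≤y)) 1≤c ≤-refl) ≤-refl ⟩
          c * (c * (y * y)) * X     ≡⟨ cong (_* X) (square-* c y) ⟩
          c * y * (c * y) * X       ∎))
          where
          open ≤-Reasoning
          0≤c : 0ℚ ≤ c
          0≤c = ≤-trans (ι-mono {0} {1} ℕ.z≤n) 1≤c

      upper : ∀ F C .{{_ : NonZero C}} → F ℕ.* F ℕ.* n ℕ.^ k ℕ.* a ℕ.^ n ℕ.≤ C ℕ.* (n ℕ.^ n ℕ.* b ℕ.^ n) → ι F ≤ ι C * g
      upper F C le = from-squares (0≤ι F) 0≤g (ι-mono {1} {C} (ℕ.>-nonZero⁻¹ C)) (*-cancelʳ-≤-pos (ι (b ℕ.^ n)) {{positive 0<bⁿ}} (begin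
        ι F * ι F * X * ι (b ℕ.^ n)               ≡⟨ assoc₁ (ι F) Sk (pow ρ n) (ι (b ℕ.^ n)) ⟩
        ι F * ι F * Sk * (pow ρ n * ι (b ℕ.^ n))  ≡⟨ cong (ι F * ι F * Sk *_) ρⁿbⁿ ⟩
        ι F * ι F * Sk * ι (a ℕ.^ n)              ≤⟨ *-mono-≤-nonNeg (0≤* (0≤* (0≤ι F) (0≤ι F)) (pow-nonNeg (<⇒≤ (*-pos 0<σ 0<σ)) k)) (0≤ι (a ℕ.^ n))
                                                       (*-mono-≤-nonNeg (0≤* (0≤ι F) (0≤ι F)) (0≤ι (n ℕ.^ k)) ≤-refl Sk≤) ≤-refl ⟩
        ι F * ι F * ι (n ℕ.^ k) * ι (a ℕ.^ n)     ≡⟨ cong (λ t → t * ι (n ℕ.^ k) * ι (a ℕ.^ n)) (ι-* F F) ⟨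
        ι (F ℕ.* F) * ι (n ℕ.^ k) * ι (a ℕ.^ n)   ≡⟨ cong (_* ι (a ℕ.^ n)) (ι-* (F ℕ.* F) (n ℕ.^ k)) ⟨
        ι (F ℕ.* F ℕ.* n ℕ.^ k) * ι (a ℕ.^ n)     ≡⟨ ι-* (F ℕ.* F ℕ.* n ℕ.^ k) (a ℕ.^ n) ⟨
        ι (F ℕ.* F ℕ.* n ℕ.^ k ℕ.* a ℕ.^ n)       ≤⟨ ι-mono le ⟩
        ι (C ℕ.* (n ℕ.^ n ℕ.* b ℕ.^ n))           ≡⟨ trans (ι-* C _) (cong (ι C *_) (ι-* (n ℕ.^ n) (b ℕ.^ n))) ⟩
        ι C * (ι (n ℕ.^ n) * ι (b ℕ.^ n))         ≡⟨ cong (λ t → ι C * (t * ι (b ℕ.^ n))) (trans (ι-^ n n) (sym g²X)) ⟩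
        ι C * (g * g * X * ι (b ℕ.^ n))           ≡⟨ *-assoc (ι C) (g * g * X) (ι (b ℕ.^ n)) ⟨
        ι C * (g * g * X) * ι (b ℕ.^ n)           ∎))
        where open ≤-Reasoning

      lower : ∀ F C .{{_ : NonZero C}} → n ℕ.^ n ℕ.* b ℕ.^ n ℕ.≤ C ℕ.* n ℕ.^ k ℕ.* (F ℕ.* F) ℕ.* a ℕ.^ n → g ≤ ι (C ℕ.* 4 ℕ.^ k) * ι F
      lower F C le = from-squares 0≤g (0≤ι F) (ι-mono {1} (ℕ.>-nonZero⁻¹ (C ℕ.* 4 ℕ.^ k) {{ℕ.m*n≢0 C (4 ℕ.^ k)}})) (begin
        g * g * X                                  ≡⟨ g²X ⟩
        pow (ι n) n                                ≤⟨ *-cancelʳ-≤-pos (ι (b ℕ.^ n)) {{positive 0<bⁿ}} (begin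
          pow (ι n) n * ι (b ℕ.^ n)                  ≡⟨ cong (_* ι (b ℕ.^ n)) (ι-^ n n) ⟨
          ι (n ℕ.^ n) * ι (b ℕ.^ n)                  ≡⟨ ι-* (n ℕ.^ n) (b ℕ.^ n) ⟨
          ι (n ℕ.^ n ℕ.* b ℕ.^ n)                    ≤⟨ ι-mono le ⟩
          ι (C ℕ.* n ℕ.^ k ℕ.* (F ℕ.* F) ℕ.* a ℕ.^ n) ≡⟨ trans (ι-* (C ℕ.* n ℕ.^ k ℕ.* (F ℕ.* F)) (a ℕ.^ n)) (cong (_* ι (a ℕ.^ n)) (trans (ι-* (C ℕ.* n ℕ.^ k) (F ℕ.* F)) (cong₂ _*_ (ι-* C (n ℕ.^ k)) (ι-* F F)))) ⟩
          ι C * ι (n ℕ.^ k) * (ι F * ι F) * ι (a ℕ.^ n) ≡⟨ cong (ι C * ι (n ℕ.^ k) * (ι F * ι F) *_) ρⁿbⁿ ⟨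
          ι C * ι (n ℕ.^ k) * (ι F * ι F) * (pow ρ n * ι (b ℕ.^ n)) ≡⟨ assoc₂ (ι C) (ι (n ℕ.^ k)) (ι F) (pow ρ n) (ι (b ℕ.^ n)) ⟨
          ι C * ι (n ℕ.^ k) * (ι F * ι F) * pow ρ n * ι (b ℕ.^ n) ∎) ⟩
        ι C * ι (n ℕ.^ k) * (ι F * ι F) * pow ρ n  ≤⟨ *-mono-≤-nonNeg (0≤* (0≤* (0≤ι C) (0≤ι (n ℕ.^ k))) F²) (<⇒≤ (pow-pos 0<ρ n))
                                                       (*-mono-≤-nonNeg (0≤* (0≤ι C) (0≤ι (n ℕ.^ k))) F²
                                                         (*-mono-≤-nonNeg (0≤ι C) (0≤* (0≤ι (4 ℕ.^ k)) (pow-nonNeg (<⇒≤ (*-pos 0<σ 0<σ)) k)) ≤-refl ≤Sk) ≤-refl) ≤-refl ⟩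
        ι C * (ι (4 ℕ.^ k) * Sk) * (ι F * ι F) * pow ρ n ≡⟨ assoc₃ (ι C) (ι (4 ℕ.^ k)) Sk (ι F) (pow ρ n) ⟩
        ι C * ι (4 ℕ.^ k) * (ι F * ι F) * X        ≡⟨ cong (λ t → t * (ι F * ι F) * X) (ι-* C (4 ℕ.^ k)) ⟨
        ι (C ℕ.* 4 ℕ.^ k) * (ι F * ι F) * X        ≡⟨ *-assoc (ι (C ℕ.* 4 ℕ.^ k)) (ι F * ι F) X ⟩
        ι (C ℕ.* 4 ℕ.^ k) * (ι F * ι F * X)        ∎)
        where
        open ≤-Reasoning
        instance
          4ᵏ≢0 : NonZero (4 ℕ.^ k)
          4ᵏ≢0 = ℕ.m^n≢0 4 k
        F² : 0ℚ ≤ ι F * ι F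
        F² = 0≤* (0≤ι F) (0≤ι F)

  expSum≡ : ∀ j → expSum j ≡ (+ expNum j / (j !)) {{j !≢0}}
  expSum≡ zero = refl
  expSum≡ (suc j) = trans (cong (_+ 1/fact (suc j)) (trans (expSum≡ j)
      (/-≡ (expNum j) (j !) (suc j ℕ.* expNum j) (suc j !) {{j !≢0}} {{suc j !≢0}} (assoc (expNum j) (suc j) (j !)))))
    (/-+ (suc j ℕ.* expNum j) 1 (suc j !) {{suc j !≢0}})
    where
    assoc : ∀ a s b → a ℕ.* (s ℕ.* b) ≡ s ℕ.* a ℕ.* b
    assoc = ℕ-Ring.solve-∀

  seq-^ʳ : ∀ x k j → seq (x ^ʳ k) j ≡ pow (seq x j) k
  seq-^ʳ x zero j = refl
  seq-^ʳ x (suc k) j = cong (seq x j *_) (seq-^ʳ x k j)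

  module Growth (k n : ℕ) .{{n≢0 : NonZero n}} {h : ℕ} (2h≡n : 2 ℕ.* h ≡ n) (j : ℕ) where
    private
      σ = seq (√ n) j
      ρ = expSum j
      p = suc j
      s = proj₁ (isqrt (n ℕ.* (p ℕ.* p)))
      lo = proj₁ (proj₂ (isqrt (n ℕ.* (p ℕ.* p))))
      hi = proj₂ (proj₂ (isqrt (n ℕ.* (p ℕ.* p))))
      1≤σ : 1ℚ ≤ σ
      1≤σ = proj₂ (proj₂ (proj₂ (0<√ n))) j ℕ.z≤n
      1≤ρ : 1ℚ ≤ ρ
      1≤ρ = proj₂ (proj₂ (proj₂ 0<e)) j ℕ.z≤n
      0<1 : 0ℚ < 1ℚ
      0<1 = *<* (ℤ.+<+ (ℕ.s≤s ℕ.z≤n))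
      0<σ = <-≤-trans 0<1 1≤σ
      0<ρ = <-≤-trans 0<1 1≤ρ
      r = seq (recip (√ n) (0<√ n)) j
      v = seq (recip e 0<e) j

      -- `recip` inverts the maximum of q and the known positive lower bound. For √n and for e that
      -- bound is 1 at every index, so the maximum is q itself.
      inverse : ∀ {q} (1≤q : 1ℚ ≤ q) → (1/ (1ℚ ⊔ q)) {{>-nonZero (0<⊔ 0<1 q)}} * q ≡ 1ℚ
      inverse {q} 1≤q = trans (cong ((1/ (1ℚ ⊔ q)) {{>-nonZero (0<⊔ 0<1 q)}} *_) (sym (p≤q⇒p⊔q≡q 1≤q)))
        (*-inverseˡ (1ℚ ⊔ q) {{>-nonZero (0<⊔ 0<1 q)}})

      s²≡ : σ * σ ≡ (+ (s ℕ.* s) / (p ℕ.* p))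
      s²≡ = /-* s p s p

      σ²≤n : σ * σ ≤ ι n
      σ²≤n = subst (_≤ ι n) (sym s²≡) (/-mono (s ℕ.* s) (p ℕ.* p) n 1 (ℕ.≤-trans (ℕ.≤-reflexive (ℕ.*-identityʳ (s ℕ.* s))) lo))

      s≢0 : 1 ℕ.≤ s
      s≢0 with s | hi
      ... | suc _ | _ = ℕ.s≤s ℕ.z≤n
      ... | zero | h = contradiction (ℕ.m*n≢0 n (p ℕ.* p)) λ nz → ℕ.<⇒≱ h (ℕ.>-nonZero⁻¹ _ {{nz}})

      -- The approximation σ = s / p guarantees only √n < (s + 1) / p, and s + 1 ≤ 2 s. This makes
      -- the estimate valid at every index j.
      n≤4σ² : ι n ≤ ι 4 * (σ * σ)
      n≤4σ² = subst (ι n ≤_) (sym (trans (cong (ι 4 *_) s²≡) (/-* 4 1 (s ℕ.* s) (p ℕ.* p))))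
        (/-mono n 1 (4 ℕ.* (s ℕ.* s)) (1 ℕ.* (p ℕ.* p)) (begin
          n ℕ.* (1 ℕ.* (p ℕ.* p))       ≡⟨ cong (n ℕ.*_) (ℕ.*-identityˡ (p ℕ.* p)) ⟩
          n ℕ.* (p ℕ.* p)               ≤⟨ ℕ.<⇒≤ hi ⟩
          suc s ℕ.* suc s               ≤⟨ ℕ.*-mono-≤ s+1≤2s s+1≤2s ⟩
          (s ℕ.+ s) ℕ.* (s ℕ.+ s)       ≡⟨ e′ s ⟩
          4 ℕ.* (s ℕ.* s) ℕ.* 1         ∎))
        where
        open ℕ.≤-Reasoning
        s+1≤2s : suc s ℕ.≤ s ℕ.+ s
        s+1≤2s = ℕ.+-monoˡ-≤ s s≢0
        e′ : ∀ s → (s ℕ.+ s) ℕ.* (s ℕ.+ s) ≡ 4 ℕ.* (s ℕ.* s) ℕ.* 1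
        e′ = ℕ-Ring.solve-∀

      ρb≡a : ρ * ι (j !) ≡ ι (expNum j)
      ρb≡a = trans (cong (_* ι (j !)) (expSum≡ j)) (trans (/-* (expNum j) (j !) (j !) 1 {{j !≢0}} {{_}} {{b1}})
        (/-≡ (expNum j ℕ.* j !) (j ! ℕ.* 1) (expNum j) 1 {{b1}} (e₁ (expNum j) (j !))))
        where
        b1 : NonZero (j ! ℕ.* 1)
        b1 = ℕ.m*n≢0 (j !) 1 {{j !≢0}}
        e₁ : ∀ a b → a ℕ.* b ℕ.* 1 ≡ a ℕ.* (b ℕ.* 1)
        e₁ = ℕ-Ring.solve-∀

      module Sq = Squares {r} {σ} {ι n * v} {ρ} {n} {h} {k} 2h≡n (inverse 1≤σ)
        (trans (*-assoc (ι n) v ρ) (trans (cong (ι n *_) (inverse 1≤ρ)) (*-identityʳ (ι n))))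
        0<σ 0<ρ (<⇒≤ (0<1/ (0<⊔ 0<1 σ))) (0≤* (0≤ι n) (<⇒≤ (0<1/ (0<⊔ 0<1 ρ)))) σ²≤n n≤4σ² {expNum j} {j !} {{j !≢0}} ρb≡a

      n/2≡h : n ℕ./ 2 ≡ h
      n/2≡h = trans (cong (ℕ._/ 2) (trans (sym 2h≡n) (ℕ.*-comm 2 h))) (ℕ.m*n/n≡m h 2)

      seq-growth : seq (growth k n) j ≡ Sq.g
      seq-growth = cong₂ _*_ (seq-^ʳ (recip (√ n) (0<√ n)) k j)
        (trans (seq-^ʳ (ofℕ n *ʳ recip e 0<e) (n ℕ./ 2) j) (cong (pow (ι n * v)) n/2≡h))

    growth-upper : ∀ F C .{{_ : NonZero C}} →
      F ℕ.* F ℕ.* n ℕ.^ k ℕ.* expNum j ℕ.^ n ℕ.≤ C ℕ.* (n ℕ.^ n ℕ.* (j !) ℕ.^ n) → ι F ≤ ι C * seq (growth k n) j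
    growth-upper F C le = subst (λ g → ι F ≤ ι C * g) (sym seq-growth) (Sq.upper F C le)

    growth-lower : ∀ F C .{{_ : NonZero C}} →
      n ℕ.^ n ℕ.* (j !) ℕ.^ n ℕ.≤ C ℕ.* n ℕ.^ k ℕ.* (F ℕ.* F) ℕ.* expNum j ℕ.^ n → seq (growth k n) j ≤ ι (C ℕ.* 4 ℕ.^ k) * ι F
    growth-lower F C le = subst (_≤ ι (C ℕ.* 4 ℕ.^ k) * ι F) (sym seq-growth) (Sq.lower F C le)

open import Data.Nat using (ℕ)

-- Edge sets and partner functions

module MatchingEnumeration {n : ℕ} where
  open import Defs
  open import Data.Fin.Permutation using (_⟨$⟩ʳ_; _⟨$⟩ˡ_; inverseʳ)
  open import Data.Fin.Subset using (⁅_⁆) renaming (_∈_ to _∈ˢ_; _∪_ to _∪ˢ_)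
  open import Data.Fin.Subset.Properties using (x∈⁅x⁆; x∈⁅y⁆⇒x≡y; ⊆-antisym; x∈p∪q⁻; x∈p∪q⁺)
  open import Data.Nat as ℕ using (zero; suc; _≤_; _<_; z≤n; s≤s)
  import Data.Nat.Properties as ℕ
  open import Data.Vec using (lookup; tabulate)
  open import Data.Vec.Properties using (lookup∘tabulate; tabulate∘lookup; tabulate-cong; lookup-zipWith)
  open import Function.Bundles using (mk⇔; Equivalence)
  open HamiltonCycles
  open Contraction (Fin._≟_ {n})

  open Matching
  open IsPerfectMatching
  open IsHamiltonCycle

  vertices : List (Fin n)
  vertices = allFin n

  toEdges : (Fin n → Fin n) → EdgeSet n
  toEdges g = tabulate λ u → ⁅ g u ⁆

  toEdges⁺ : ∀ g {u v} → g u ≡ v → toEdges g ∋ u ∼ v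
  toEdges⁺ g {u} refl = subst (g u ∈ˢ_) (sym (lookup∘tabulate (λ u → ⁅ g u ⁆) u)) (x∈⁅x⁆ (g u))

  toEdges⁻ : ∀ g {u v} → toEdges g ∋ u ∼ v → g u ≡ v
  toEdges⁻ g {u} {v} p = sym (x∈⁅y⁆⇒x≡y (g u) (subst (v ∈ˢ_) (lookup∘tabulate (λ u → ⁅ g u ⁆) u) p))

  toEdges-perfect : ∀ {g} → Matching vertices g → IsPerfectMatching (toEdges g)
  toEdges-perfect {g} m = record
    { symmetric = λ u v p → toEdges⁺ g (swap m (∈-allFin u) (toEdges⁻ g p))
    ; irreflexive = λ u p → irrefl m (∈-allFin u) (toEdges⁻ g p)
    ; disjoint = λ u v w p q → trans (sym (toEdges⁻ g p)) (toEdges⁻ g q)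
    ; covers = λ u → g u , toEdges⁺ g refl }

  module _ {M : EdgeSet n} (pm : IsPerfectMatching M) where
    partner : Fin n → Fin n
    partner u = proj₁ (covers pm u)

    partner⁺ : ∀ {u v} → partner u ≡ v → M ∋ u ∼ v
    partner⁺ {u} refl = proj₂ (covers pm u)

    partner⁻ : ∀ {u v} → M ∋ u ∼ v → partner u ≡ v
    partner⁻ {u} {v} = disjoint pm u (partner u) v (proj₂ (covers pm u))

    partner-matching : Matching vertices partner
    partner-matching = record
      { closed = λ {x} _ → ∈-allFin (partner x)
      ; irrefl = λ {x} _ p → irreflexive pm x (partner⁺ p)
      ; invol = λ {x} _ → partner⁻ (symmetric pm x (partner x) (partner⁺ refl)) }

    toEdges-partner : ∀ {g} → (∀ u → g u ≡ partner u) → toEdges g ≡ M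
    toEdges-partner {g} same = trans (tabulate-cong λ u → ⊆-antisym
        (λ {v} p → partner⁺ (trans (sym (same u)) (sym (x∈⁅y⁆⇒x≡y (g u) p))))
        (λ {v} p → subst (_∈ˢ ⁅ g u ⁆) (trans (same u) (partner⁻ p)) (x∈⁅x⁆ (g u))))
      (tabulate∘lookup M)

  toEdges-differ : ∀ {g g′} → Differ vertices g g′ → toEdges g ≢ toEdges g′
  toEdges-differ {g} {g′} (x , _ , gx≢g′x) eq = gx≢g′x (sym (toEdges⁻ g′ (subst (_∋ x ∼ g x) eq (toEdges⁺ g refl))))

  module _ {M N : EdgeSet n} (pM : IsPerfectMatching M) (pN : IsPerfectMatching N) where
    private
      g = partner pM
      f = partner pN
      mg = partner-matching pM
      mf = partner-matching pN

    union⁻ : ∀ {u v} → (M ∪ᴱ N) ∋ u ∼ v → g u ≡ v ⊎ f u ≡ v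
    union⁻ {u} {v} p with x∈p∪q⁻ (lookup M u) (lookup N u) (subst (v ∈ˢ_) (lookup-zipWith _∪ˢ_ u M N) p)
    ... | inj₁ q = inj₁ (partner⁻ pM q)
    ... | inj₂ q = inj₂ (partner⁻ pN q)

    union⁺ : ∀ {u v} → g u ≡ v ⊎ f u ≡ v → (M ∪ᴱ N) ∋ u ∼ v
    union⁺ {u} {v} p = subst (v ∈ˢ_) (sym (lookup-zipWith _∪ˢ_ u M N)) (x∈p∪q⁺ (by p))
      where
      by : g u ≡ v ⊎ f u ≡ v → v ∈ˢ lookup M u ⊎ v ∈ˢ lookup N u
      by (inj₁ q) = inj₁ (partner⁺ pM q)
      by (inj₂ q) = inj₂ (partner⁺ pN q)

    -- Consecutive vertices of the cyclic order get the same label, and the order reaches every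
    -- vertex from its start.
    hamilton⇒connected : IsHamiltonCycle (M ∪ᴱ N) → Connected vertices f g
    hamilton⇒connected ham s sf sg {x} {y} _ _ = trans (to-start x) (sym (to-start y))
      where
      π = order ham
      0<n : 0 < n
      0<n = ℕ.≤-trans (s≤s z≤n) (3≤n ham)
      edge-invariant : ∀ {u v} → (M ∪ᴱ N) ∋ u ∼ v → s v ≡ s u
      edge-invariant {u} p with union⁻ p
      ... | inj₁ q = trans (cong s (sym q)) (sg (∈-allFin u))
      ... | inj₂ q = trans (cong s (sym q)) (sf (∈-allFin u))
      along : ∀ t (t<n : t < n) → s (π ⟨$⟩ʳ fromℕ< t<n) ≡ s (π ⟨$⟩ʳ fromℕ< 0<n)
      along zero t<n = refl
      along (suc t) t<n = trans (edge-invariant (Equivalence.from (edges ham i j) (inj₁ (inj₁ step)))) (along t (ℕ.<⇒≤ t<n))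
        where
        i = fromℕ< (ℕ.<⇒≤ t<n)
        j = fromℕ< t<n
        step : toℕ j ≡ suc (toℕ i)
        step = trans (Fin.toℕ-fromℕ< t<n) (cong suc (sym (Fin.toℕ-fromℕ< (ℕ.<⇒≤ t<n))))
      to-start : ∀ x → s x ≡ s (π ⟨$⟩ʳ fromℕ< 0<n)
      to-start x = trans (cong s (sym (trans (cong (π ⟨$⟩ʳ_) (Fin.fromℕ<-toℕ i (Fin.toℕ<n i))) (inverseʳ π)))) (along (toℕ i) (Fin.toℕ<n i))
        where i = π ⟨$⟩ˡ x

    connected⇒hamilton : 3 ≤ n → Connected vertices f g → IsHamiltonCycle (M ∪ᴱ N)
    connected⇒hamilton 3≤n con = record
      { 3≤n = 3≤n
      ; order = Walk.order
      ; edges = λ i j → mk⇔ (λ p → to i j (union⁻ p)) (λ q → union⁺ (from i j (Walk.cyclic⇒edge i j q))) }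
      where
      module Walk = AlternatingWalk f g (λ x → invol mf (∈-allFin x)) (λ x → invol mg (∈-allFin x))
        (λ x → irrefl mf (∈-allFin x)) (λ x → irrefl mg (∈-allFin x))
        (λ s sf sg x y → con s (λ {x} _ → sf x) (λ {x} _ → sg x) (∈-allFin x) (∈-allFin y))
        (fromℕ< (ℕ.≤-trans (s≤s z≤n) 3≤n))
      to : ∀ i j → g (Walk.z (toℕ i)) ≡ Walk.z (toℕ j) ⊎ f (Walk.z (toℕ i)) ≡ Walk.z (toℕ j) → CyclicSucc i j ⊎ CyclicSucc j i
      to i j (inj₁ p) = Walk.edge⇒cyclic true i j p
      to i j (inj₂ p) = Walk.edge⇒cyclic false i j p
      from : ∀ i j → ∃[ b ] Walk.φ b (Walk.z (toℕ i)) ≡ Walk.z (toℕ j) → g (Walk.z (toℕ i)) ≡ Walk.z (toℕ j) ⊎ f (Walk.z (toℕ i)) ≡ Walk.z (toℕ j)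
      from i j (true , p) = inj₁ p
      from i j (false , p) = inj₂ p

  module _ {k : ℕ} (M : Fin k → EdgeSet n) (pm : ∀ i → IsPerfectMatching (M i)) (3≤n : 3 ≤ n) where
    partners : Colouring k
    partners i = partner (pm i)

    partners-colouring : IsColouring vertices partners
    partners-colouring i = partner-matching (pm i)

    Wanted : EdgeSet n → Set
    Wanted M* = IsPerfectMatching M* × (∀ i → IsHamiltonCycle (M* ∪ᴱ M i))

    good⇒wanted : ∀ {g} → Good vertices partners g → Wanted (toEdges g)
    good⇒wanted {g} (m , con) = perfect , λ i → connected⇒hamilton perfect (pm i) 3≤n (connected i)
      where
      perfect = toEdges-perfect m
      same : ∀ u → partner perfect u ≡ g u
      same u = refl
      connected : ∀ i → Connected vertices (partners i) (partner perfect)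
      connected i = con i

    wanted⇒good : ∀ {M*} ((pM* , _) : Wanted M*) → Good vertices partners (partner pM*)
    wanted⇒good (pM* , ham) = partner-matching pM* , λ i → hamilton⇒connected pM* (pm i) (ham i)

    enumeration : ∀ h → n ≡ 2 ℕ.* suc h → HasCardinality Wanted (length (enum h partners vertices))
    enumeration h n≡ = map toEdges gs ,
      AllPairs.map⁺ (AllPairs.map toEdges-differ (enum-distinct h unique)) ,
      (λ x → mk⇔ sound complete) ,
      length-map toEdges gs
      where
      gs = enum h partners vertices
      unique = Unique.allFin⁺ n
      size : length vertices ≡ 2 ℕ.* suc h
      size = trans (length-tabulate {n = n} id) n≡
      sound : ∀ {x} → x ∈ map toEdges gs → Wanted x
      sound x∈ with ∈-map⁻ toEdges x∈
      ... | g , g∈ , refl = good⇒wanted (All.lookup (enum-sound h unique partners-colouring size) g∈)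
      complete : ∀ {x} → Wanted x → x ∈ map toEdges gs
      complete {x} w with find (enum-complete h unique partners-colouring size (wanted⇒good w))
      ... | g , g∈ , same = subst (_∈ map toEdges gs) (toEdges-partner (proj₁ w) (λ u → same (∈-allFin u))) (∈-map⁺ toEdges g∈)

open import Defs
open import Data.Nat using (ℕ; NonZero; _≤_)
open import Data.Nat.Divisibility using (_∣_)
open import Data.Fin using (Fin)
open import Data.Product using (∃-syntax; _×_)
open import Relation.Binary.PropositionalEquality using (_≢_)

open import Data.Integer using (+_)
open import Data.Nat using (zero; suc; _+_; _*_; _^_; _<_; z≤n; s≤s; _!)
open import Data.Nat.Divisibility using (divides)
open import Data.Nat.Properties
open import Data.Nat.Tactic.RingSolver using (solve-∀)
import Data.Rational as ℚ
import Data.Rational.Properties as ℚ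
open Constants
open ExponentialBounds
open ProductBounds
open RealBounds

-- Choice of the threshold and the final constants

module Threshold (k : ℕ) where
  open Weights k

  -- The summand `2 * (M + dB)` gives the base states room to get rid of their dirty vertices; the
  -- others are what the recursion requires.
  M dB h₁ : ℕ
  M = solvableSize k
  dB = dirtyBound k
  h₁ = E + D * T + 2 + 2 * (M + dB)

  large : E + D * T + 2 ≤ h₁
  large = m≤m+n _ _

  open Sizes h₁ large public
  open DoubleFactorial h₀ public

  B R C-upper C-lower : ℕ
  B = 2 * h₁ + K
  R = 2 * (B + suc k)
  C-upper = suc (Q * Q * R ^ k * C₁)
  C-lower = suc (4 ^ suc h₀ * C₂ * (S * S))

  P≡prod₂ : ∀ d → P d ≡ prod₂ B d
  P≡prod₂ zero = refl
  P≡prod₂ (suc d) = cong (N (suc d) *_) (P≡prod₂ d)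

  private
    e-kB : k + B ≡ suc (2 * h₀)
    e-kB = e₀ k h₁
      where
      e₀ : ∀ k h → k + (2 * h + suc k) ≡ suc (2 * (k + h))
      e₀ = solve-∀
    e-m : ∀ d → 2 * d + (B + suc k) ≡ m d
    e-m d = trans (sym (+-assoc (2 * d) B (suc k))) (N+K≡m d)

  -- B is 2 h₀ + 1 - k, so k unit shifts turn every factor m - 1 - k of P into m - 1. This is where
  -- n^(-k/2) originates.
  P-upper : ∀ d → sq (P d) * m d ^ k ≤ sq (prod₂ (suc (2 * h₀)) d) * R ^ k
  P-upper d = subst₂ (λ s t → sq s * t ^ k ≤ sq (prod₂ (suc (2 * h₀)) d) * R ^ k) (sym (P≡prod₂ d)) (e-m d)
    (subst (λ s → sq (prod₂ B d) * (2 * d + (B + suc k)) ^ k ≤ sq (prod₂ s d) * R ^ k) e-kB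
      (prod₂-+-lower B d (≤-trans (n≤1+n k) (m≤n+m K (2 * h₁))) k ≤-refl))

  P-lower : ∀ d → sq (prod₂ (suc (2 * h₀)) d) ≤ sq (P d) * m d ^ k
  P-lower d = subst₂ (λ s t → sq (prod₂ (suc (2 * h₀)) d) ≤ sq s * t ^ k) (sym (P≡prod₂ d)) (e-m d)
    (subst (λ s → sq (prod₂ s d) ≤ sq (prod₂ B d) * (2 * d + (B + suc k)) ^ k) e-kB
      (prod₂-+-upper B d k ≤-refl))

  upper-bound : ∀ d F j → (let n = m d) → F ≤ Q * P d →
                F * F * n ^ k * expNum j ^ n ≤ C-upper * (n ^ n * (j !) ^ n)
  upper-bound d F j F≤QP = begin
    F * F * n ^ k * expNum j ^ n                        ≤⟨ *-monoˡ-≤ (expNum j ^ n) (*-monoˡ-≤ (n ^ k) (*-mono-≤ F≤QP F≤QP)) ⟩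
    Q * P d * (Q * P d) * n ^ k * expNum j ^ n          ≡⟨ e₁ Q (P d) (n ^ k) (expNum j ^ n) ⟩
    Q * Q * (sq (P d) * n ^ k) * expNum j ^ n           ≤⟨ *-monoˡ-≤ (expNum j ^ n) (*-monoʳ-≤ (Q * Q) (P-upper d)) ⟩
    Q * Q * (sq (prod₂ (suc (2 * h₀)) d) * R ^ k) * expNum j ^ n
                                                        ≡⟨ e₂ (Q * Q) (sq (prod₂ (suc (2 * h₀)) d)) (R ^ k) (expNum j ^ n) ⟩
    Q * Q * R ^ k * W j d                               ≤⟨ *-monoʳ-≤ (Q * Q * R ^ k) (W-upper j d) ⟩
    Q * Q * R ^ k * (C₁ * (n ^ n * (j !) ^ n))          ≡⟨ *-assoc (Q * Q * R ^ k) C₁ _ ⟨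
    Q * Q * R ^ k * C₁ * (n ^ n * (j !) ^ n)            ≤⟨ *-monoˡ-≤ (n ^ n * (j !) ^ n) (n≤1+n (Q * Q * R ^ k * C₁)) ⟩
    C-upper * (n ^ n * (j !) ^ n)                       ∎
    where
    open ≤-Reasoning
    n = m d
    e₁ : ∀ q p n a → q * p * (q * p) * n * a ≡ q * q * (p * p * n) * a
    e₁ = solve-∀
    e₂ : ∀ q o r a → q * (o * r) * a ≡ q * r * (o * a)
    e₂ = solve-∀

  1≤h₀ : 1 ≤ h₀
  1≤h₀ = ≤-trans (≤-trans (≤-trans (s≤s z≤n) (m≤n+m 2 (E + D * T))) large) (m≤n+m h₁ k)

  lower-bound : ∀ d F j → (let n = m d) → P d ≤ F * S → n * n ≤ j →
                n ^ n * (j !) ^ n ≤ C-lower * n ^ k * (F * F) * expNum j ^ n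
  lower-bound d F j P≤FS n²≤j = begin
    n ^ n * (j !) ^ n                                     ≤⟨ W-lower j d 1≤h₀ n²≤j ⟩
    C * (sq (prod₂ (suc (2 * h₀)) d) * expNum j ^ n)      ≤⟨ *-monoʳ-≤ C (*-monoˡ-≤ (expNum j ^ n) (P-lower d)) ⟩
    C * (sq (P d) * n ^ k * expNum j ^ n)
      ≤⟨ *-monoʳ-≤ C (*-monoˡ-≤ (expNum j ^ n) (*-monoˡ-≤ (n ^ k) (*-mono-≤ P≤FS P≤FS))) ⟩
    C * (F * S * (F * S) * n ^ k * expNum j ^ n)          ≡⟨ e₁ C F S (n ^ k) (expNum j ^ n) ⟩
    C * (S * S) * (n ^ k * (F * F) * expNum j ^ n)        ≤⟨ *-monoˡ-≤ (n ^ k * (F * F) * expNum j ^ n) (n≤1+n (C * (S * S))) ⟩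
    C-lower * (n ^ k * (F * F) * expNum j ^ n)            ≡⟨ e₂ C-lower (n ^ k) (F * F) (expNum j ^ n) ⟩
    C-lower * n ^ k * (F * F) * expNum j ^ n              ∎
    where
    open ≤-Reasoning
    n = m d
    C = 4 ^ suc h₀ * C₂
    e₁ : ∀ c f s n a → c * (f * s * (f * s) * n * a) ≡ c * (s * s) * (n * (f * f) * a)
    e₁ = solve-∀
    e₂ : ∀ c n f a → c * (n * f * a) ≡ c * n * f * a
    e₂ = solve-∀

  -- The weight is exponential, so 4 c ≤ 32^c ≤ S, and S = 2 h₀ + 2 + E. The other half of 4 h₀
  -- covers 4 (M + dB) together with 2 + E by the choice of h₁.
  light⇒small : ∀ c → weight c ≤ S → M + c + dB ≤ h₀
  light⇒small c light = *-cancelˡ-≤ 4 (begin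
    4 * (M + c + dB)                                 ≡⟨ e₁ M c dB ⟩
    4 * (M + dB) + 4 * c                             ≤⟨ +-monoʳ-≤ (4 * (M + dB)) (≤-trans (4c≤32^c c) (≤-trans (m≤n*m (32 ^ c) K) light)) ⟩
    4 * (M + dB) + (2 * suc h₀ + E)                  ≤⟨ m≤m+n _ (E + 2 * (D * T) + 2 + 2 * k) ⟩
    4 * (M + dB) + (2 * suc h₀ + E) + (E + 2 * (D * T) + 2 + 2 * k) ≡⟨ e₂ (M + dB) E (D * T) k ⟩
    4 * h₀                                           ∎)
    where
    open ≤-Reasoning
    e₁ : ∀ m c b → 4 * (m + c + b) ≡ 4 * (m + b) + 4 * c
    e₁ = solve-∀
    e₂ : ∀ x E y k → (let h = k + (E + y + 2 + 2 * x)) → 4 * x + (2 * suc h + E) + (E + 2 * y + 2 + 2 * k) ≡ 4 * h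
    e₂ = solve-∀
    4c≤32^c : ∀ c → 4 * c ≤ 32 ^ c
    4c≤32^c zero = z≤n
    4c≤32^c (suc c) = begin
      4 * suc c                  ≡⟨ *-suc 4 c ⟩
      4 + 4 * c                  ≤⟨ +-mono-≤ (*-monoʳ-≤ 4 (m^n>0 32 c)) (4c≤32^c c) ⟩
      4 * 32 ^ c + 32 ^ c        ≤⟨ m≤m+n _ (27 * 32 ^ c) ⟩
      4 * 32 ^ c + 32 ^ c + 27 * 32 ^ c ≡⟨ e₃ (32 ^ c) ⟩
      32 * 32 ^ c                ∎
      where
      e₃ : ∀ x → 4 * x + x + 27 * x ≡ 32 * x
      e₃ = solve-∀

module Enumeration (k n : ℕ) where
  open Weights k
  open Threshold k
  open MatchingEnumeration {n}
  open Contraction (Fin._≟_ {n})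
  open Recursion k
  open Counting h₁ large using (count-upper; count-lower)
  open Counting h₁ large public using (count)

  private
    any⇒nonempty : ∀ {B : Set} {Φ : B → Set} {xs : List B} → Any Φ xs → 1 ≤ length xs
    any⇒nonempty (here _)  = s≤s z≤n
    any⇒nonempty (there _) = s≤s z≤n

  solved⇒counted : ∀ h (St : State k h) → Solved St → 1 ≤ length (enum h (State.col St) (State.verts St))
  solved⇒counted h St (g , good) =
    any⇒nonempty (enum-complete h (State.unique St) (State.colouring St) (State.size St) good)

  base-count : ∀ f {A} → Unique A → IsColouring A f → length A ≡ m 0 → weight (dirtiness f A) ≤ S → 1 ≤ count 0 f A
  base-count f {A} A! F eq light = solved⇒counted h₀ state
    (solve-dirty (clean-solvable k) (dirtiness f A) h₀ state ≤-refl (light⇒small (dirtiness f A) light))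
    where
    state : State k h₀
    state = record { verts = A ; col = f ; unique = A! ; colouring = F ; size = eq }

  module _ {d : ℕ} (n≡m : n ≡ m d) {f : Colouring k} (F : IsColouring vertices f) (none : dirties f vertices ≡ []) where
    private
      size : length vertices ≡ m d
      size = trans (length-tabulate {n = n} id) n≡m
      X≡K : weight (dirtiness f vertices) ≡ K
      X≡K = trans (cong (λ c → weight (length c)) none) (*-identityʳ K)
      instance
        m≢0 : NonZero (m d)
        m≢0 = _

    count≤ : count d f vertices ≤ Q * P d
    count≤ = *-cancelʳ-≤ _ _ (m d) (+-cancelʳ-≤ (Q * P d * E) _ _ (begin
      count d f vertices * m d + Q * P d * E         ≤⟨ count-upper d f (Unique.allFin⁺ n) F size ⟩
      Q * P d * (m d + weight (dirtiness f vertices)) ≤⟨ *-monoʳ-≤ (Q * P d) (+-monoʳ-≤ (m d) (≤-trans (≤-reflexive X≡K) (m≤m+n K G))) ⟩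
      Q * P d * (m d + E)                            ≡⟨ *-distribˡ-+ (Q * P d) (m d) E ⟩
      Q * P d * m d + Q * P d * E                    ∎))
      where open ≤-Reasoning

    ≤count : P d ≤ count d f vertices * S
    ≤count = *-cancelʳ-≤ _ _ (m d) (+-cancelʳ-≤ (P d * E) _ _ (begin
      P d * m d + P d * E                            ≡⟨ *-distribˡ-+ (P d) (m d) E ⟨
      P d * (m d + E)                                ≤⟨ count-lower base-count d f (Unique.allFin⁺ n) F size ⟩
      count d f vertices * S * m d + P d * weight (dirtiness f vertices)
        ≤⟨ +-monoʳ-≤ (count d f vertices * S * m d) (*-monoʳ-≤ (P d) (≤-trans (≤-reflexive X≡K) (m≤m+n K G))) ⟩
      count d f vertices * S * m d + P d * E         ∎))
      where open ≤-Reasoning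

  disjoint⇒clean : (M : Fin k → EdgeSet n) (pm : ∀ i → IsPerfectMatching (M i)) (3≤n : 3 ≤ n) →
                   (∀ i j → i ≢ j → EdgeDisjoint (M i) (M j)) → dirties (partners M pm 3≤n) vertices ≡ []
  disjoint⇒clean M pm 3≤n disjoint = filter-none (dirty? (partners M pm 3≤n)) {xs = vertices} (All.tabulate λ {x} _ (i , j , i≢j , eq) →
    disjoint i j i≢j x (partner (pm i) x) (partner⁺ (pm i) refl , partner⁺ (pm j) (sym eq)))

reciprocal : ∀ C .{{_ : NonZero C}} → (+ 1 ℚ./ C) ℚ.* ι C ≡ ℚ.1ℚ
reciprocal C = trans (/-* 1 C C 1) (/-≡ (1 * C) (C * 1) 1 1 (e₀ C))
  where
  instance
    C1≢0 : NonZero (C * 1)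
    C1≢0 = m*n≢0 C 1
  e₀ : ∀ C → 1 * C * 1 ≡ 1 * (C * 1)
  e₀ = solve-∀

divide : ∀ {c C g F} → ℚ.0ℚ ℚ.≤ c → c ℚ.* C ≡ ℚ.1ℚ → g ℚ.≤ C ℚ.* F → c ℚ.* g ℚ.≤ F
divide {c} {C} {g} {F} 0≤c cC≡1 g≤CF = begin
  c ℚ.* g            ≤⟨ ℚ.*-monoˡ-≤-nonNeg c {{ℚ.nonNegative 0≤c}} g≤CF ⟩
  c ℚ.* (C ℚ.* F)    ≡⟨ ℚ.*-assoc c C F ⟨
  c ℚ.* C ℚ.* F      ≡⟨ cong (ℚ._* F) cC≡1 ⟩
  ℚ.1ℚ ℚ.* F         ≡⟨ ℚ.*-identityˡ F ⟩
  F                  ∎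
  where open ℚ.≤-Reasoning

Wanted : ∀ {k n} → (Fin k → EdgeSet n) → EdgeSet n → Set
Wanted M M* = IsPerfectMatching M* × (∀ i → IsHamiltonCycle (M* ∪ᴱ M i))

-- The theorem with square roots and e cleared: squares are compared, and
-- expNum j / j! stands for e.
NaturalBounds : (k n₀ C C′ : ℕ) → Set
NaturalBounds k n₀ C C′ = ∀ n → n₀ ≤ n → 2 ∣ n → (M : Fin k → EdgeSet n) →
  (∀ i → IsPerfectMatching (M i)) → (∀ i j → i ≢ j → EdgeDisjoint (M i) (M j)) →
  ∃[ F ] (HasCardinality (Wanted M) F
    × (∀ j → F * F * n ^ k * expNum j ^ n ≤ C * (n ^ n * (j !) ^ n))
    × (∀ j → n * n ≤ j → n ^ n * (j !) ^ n ≤ C′ * n ^ k * (F * F) * expNum j ^ n))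

natural-bounds : ∀ k → NaturalBounds k (Threshold.m k 0) (Threshold.C-upper k) (Threshold.C-lower k)
natural-bounds k n m₀≤n (divides q n≡q*2) M pm disjoint
  with m≤n⇒∃[o]m+o≡n (*-cancelˡ-≤ {_} {q} 2 (≤-trans m₀≤n (≤-reflexive (trans n≡q*2 (*-comm q 2)))))
... | d , h₀+d≡q = F , enumeration M pm 3≤n (d + h₀) n≡m ,
    (λ j → subst (λ n → F * F * n ^ k * expNum j ^ n ≤ C-upper * (n ^ n * (j !) ^ n)) (sym n≡m)
      (upper-bound d F j (count≤ {d} n≡m (partners-colouring M pm 3≤n) none))) ,
    (λ j n²≤j → subst (λ n → n ^ n * (j !) ^ n ≤ C-lower * n ^ k * (F * F) * expNum j ^ n) (sym n≡m)
      (lower-bound d F j (≤count {d} n≡m (partners-colouring M pm 3≤n) none) (subst (λ n → n * n ≤ j) n≡m n²≤j)))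
  where
  open Threshold k hiding (M)
  open Enumeration k n
  open MatchingEnumeration {n} hiding (Wanted)
  n≡m : n ≡ m d
  n≡m = trans n≡q*2 (trans (*-comm q 2) (cong (2 *_) (trans (sym h₀+d≡q) (cong suc (+-comm h₀ d)))))
  3≤n : 3 ≤ n
  3≤n = ≤-trans (n≤1+n 3) (≤-trans (*-monoʳ-≤ 2 (s≤s 1≤h₀)) m₀≤n)
  F = count d (partners M pm 3≤n) vertices
  none = disjoint⇒clean M pm 3≤n disjoint

positive-ofℚ : ∀ {q} → ℚ.0ℚ ℚ.< q → Positive (ofℚ q)
positive-ofℚ {q} 0<q = q , 0<q , 0 , λ _ _ → ℚ.≤-refl

≤ʳ-divide : ∀ (x : ℝ) {c C F} → ℚ.0ℚ ℚ.≤ c → c ℚ.* ι C ≡ ℚ.1ℚ → ∀ J → (∀ j → J ≤ j → seq x j ℚ.≤ ι C ℚ.* ι F) →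
           ofℚ c *ʳ x ≤ʳ ofℕ F
≤ʳ-divide x {c} {C} 0≤c cC≡1 J le ε 0<ε = J , λ j J≤j → ≤+ε 0<ε (divide {c} {ι C} 0≤c cC≡1 (le j J≤j))

≤ʳ-multiply : ∀ (x : ℝ) {C F} → (∀ j → ι F ℚ.≤ ι C ℚ.* seq x j) → ofℕ F ≤ʳ ofℕ C *ʳ x
≤ʳ-multiply x le ε 0<ε = 0 , λ j _ → ≤+ε 0<ε (le j)

RealBounds : ℕ → ℕ → ℝ → ℝ → Set
RealBounds k n₀ c C = ∀ n .{{_ : NonZero n}} → n₀ ≤ n → 2 ∣ n → (M : Fin k → EdgeSet n) →
  (∀ i → IsPerfectMatching (M i)) → (∀ i j → i ≢ j → EdgeDisjoint (M i) (M j)) →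
  ∃[ F ] (HasCardinality (Wanted M) F × c *ʳ growth k n ≤ʳ ofℕ F × ofℕ F ≤ʳ C *ʳ growth k n)

real-bounds : ∀ {k n₀ C C′ c} .{{_ : NonZero C}} .{{_ : NonZero C′}} →
  ℚ.0ℚ ℚ.≤ c → c ℚ.* ι (C′ * 4 ^ k) ≡ ℚ.1ℚ → NaturalBounds k n₀ C C′ → RealBounds k n₀ (ofℚ c) (ofℕ C)
real-bounds {k} {n₀} {C} {C′} {c} 0≤c cC≡1 natural n n₀≤n 2∣n@(divides q n≡q*2) M pm disjoint =
  conclude (natural n n₀≤n 2∣n M pm disjoint)
  where
  2q≡n : 2 * q ≡ n
  2q≡n = trans (*-comm 2 q) (sym n≡q*2)
  conclude : ∃[ F ] (HasCardinality (Wanted M) F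
      × (∀ j → F * F * n ^ k * expNum j ^ n ≤ C * (n ^ n * (j !) ^ n))
      × (∀ j → n * n ≤ j → n ^ n * (j !) ^ n ≤ C′ * n ^ k * (F * F) * expNum j ^ n)) →
    ∃[ F ] (HasCardinality (Wanted M) F × ofℚ c *ʳ growth k n ≤ʳ ofℕ F × ofℕ F ≤ʳ ofℕ C *ʳ growth k n)
  conclude (F , card , upper , lower) = F , card ,
    -- The lower bound holds from the approximation with index n² on, which suffices for an
    -- inequality between limits.
    ≤ʳ-divide (growth k n) {c} {C′ * 4 ^ k} {F} 0≤c cC≡1 (n * n) (λ j n²≤j → Growth.growth-lower k n {q} 2q≡n j F C′ (lower j n²≤j)) ,
    ≤ʳ-multiply (growth k n) {C} {F} (λ j → Growth.growth-upper k n {q} 2q≡n j F C (upper j))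

0<reciprocal : ∀ C .{{_ : NonZero C}} → ℚ.0ℚ ℚ.< (+ 1 ℚ./ C)
0<reciprocal C = ℚ.positive⁻¹ (+ 1 ℚ./ C) {{ℚ.normalize-pos 1 C}}

theorem1p4 : ∀ (k : ℕ) →
    ∃[ c ] ∃[ C ] ∃[ n₀ ] (Positive c × Positive C ×
    (∀ (n : ℕ) .{{_ : NonZero n}} → n₀ ≤ n → 2 ∣ n →
    (M : Fin k → EdgeSet n) →
    (∀ i → IsPerfectMatching (M i)) →
    (∀ i j → i ≢ j → EdgeDisjoint (M i) (M j)) →
    ∃[ N ] (HasCardinality
    (λ M* → IsPerfectMatching M* × (∀ i → IsHamiltonCycle (M* ∪ᴱ M i))) N
    × c *ʳ growth k n ≤ʳ ofℕ N
    × ofℕ N ≤ʳ C *ʳ growth k n)))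
theorem1p4 k = ofℚ (+ 1 ℚ./ C″) , ofℕ C-upper , m 0 , positive-ofℚ (0<reciprocal C″) , positive-ofℚ (0<ι C-upper) ,
  real-bounds {k} {m 0} {C-upper} {C-lower} (ℚ.<⇒≤ (0<reciprocal C″)) (reciprocal C″) (natural-bounds k)
  where
  open Threshold k
  -- The factor 4^k is the price of the estimate n ≤ 4 σ² for the approximations σ of √n.
  C″ : ℕ
  C″ = C-lower * 4 ^ k
  instance
    4ᵏ≢0 : NonZero (4 ^ k)
    4ᵏ≢0 = m^n≢0 4 k
    C″≢0 : NonZero C″
    C″≢0 = m*n≢0 C-lower (4 ^ k)
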